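{- Let $r\geq 1$, $n\geq 1$ and $1\leq k\leq rn$ be integers. Then $$E^*(\mathcal{B}^{(r)}_{n,k},z)=\sum_{\substack{(\sigma,c)\in\mathfrak{S}^{(r)}_n\\ \mathrm{fexc}(\sigma,c)=rn-k}} z^{\lceil \mathrm{fdes}^*(\sigma,c)/r\rceil}.$$
   Context: Ehrhart series: for $\mathcal{X}\subset\mathbb{R}^n$ (here a convex integral polytope with possibly some faces removed), $E(\mathcal{X},t)$ denotes the polynomial in $t$ such that $E(\mathcal{X},t)=\#(t\mathcal{X}\cap\mathbb{Z}^n)$ for every integer $t>0$, where $t\mathcal{X}=\{tx: x\in\mathcal{X}\}$; and $E^*(\mathcal{X},z):=(1-z)^{n+1}\sum_{t\geq 0}E(\mathcal{X},t)z^t$ (the value at $t=0$ is that of the polynomial). Multi-hypersimplices: for $1\le k<rn$, $\mathcal{B}^{(r)}_{n,k}=\{v\in[0,r]^n : k-1\leq\sum_i v_i<k\}$; for $k=rn$, $\mathcal{B}^{(r)}_{n,k}=\{v\in[0,r]^n : k-1\leq\sum_i v_i\leq k\}$. Colored permutations: $\mathfrak{S}_n^{(r)}$ is the set of pairs $(\sigma,c)$ with $\sigma\in\mathfrak{S}_n$ a permutation of $\{1,\dots,n\}$ and $c=(c_1,\dots,c_n)\in\{0,1,\dots,r-1\}^n$. Define $\mathrm{fexc}(\sigma,c)=r\cdot\#\{i\in\{1,\dots,n\}:\sigma_i>i\text{ and }c_i=0\}+\sum_{i=1}^n c_i$; $\mathrm{des}^*(\sigma,c)=\#\{i : 1\leq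 i\leq n-1,\ c_i<c_{i+1}\text{, or }c_i=c_{i+1}\text{ and }\sigma_i>\sigma_{i+1}\}$; $\mathrm{fdes}^*(\sigma,c)=r\cdot\mathrm{des}^*(\sigma,c)+c_1$. -}

module Defs where

open import Data.Bool using (if_then_else_)
open import Data.Fin using (Fin; suc; toℕ; inject₁)
import Data.Fin as Fin
open import Data.Fin.Properties using (_≟_; _<?_)
open import Data.Integer using (ℤ; +_)
open import Data.List using (List; []; _∷_; length; map; foldr; filter; upTo; cartesianProduct; cartesianProductWith)
import Data.List as List
open import Data.List.Membership.Propositional using (_∈_)
import Data.List.Relation.Unary.Unique.Propositional as List
open import Data.Nat using (ℕ; zero; suc; pred; _∸_; NonZero)
import Data.Nat as ℕ
import Data.Nat.DivMod as ℕ
open import Data.Product using (_×_; _,_; ∃-syntax)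
open import Data.Rational using (ℚ; 0ℚ; 1ℚ; _+_; _*_; _-_; _≤_; _<_; _/_)
open import Data.Sum using (_⊎_)
open import Data.Vec using (Vec; []; _∷_; lookup; count; allFin)
import Data.Vec as Vec
open import Data.Vec.Relation.Unary.All using (All)
open import Data.Vec.Relation.Unary.AllPairs using (allPairs?)
open import Data.Vec.Relation.Unary.Unique.Propositional using (Unique)
open import Function using (_⇔_)
open import Level using (0ℓ)
open import Relation.Binary.PropositionalEquality using (_≡_)
open import Relation.Nullary using (does)
open import Relation.Nullary.Decidable using (¬?; _×-dec_; _⊎-dec_)
open import Relation.Unary using (Pred; Decidable)

fromℤ : ℤ → ℚ
fromℤ i = i / 1

fromℕ : ℕ → ℚ
fromℕ m = fromℤ (+ m)

------------------------------------------------------------------------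
-- Formal power series over ℚ, as coefficient sequences

PowerSeries : Set
PowerSeries = ℕ → ℚ

sumℚ : List ℚ → ℚ
sumℚ = foldr _+_ 0ℚ

infixl 7 _·_

_·_ : PowerSeries → PowerSeries → PowerSeries
(f · g) m = sumℚ (map (λ i → f i * g (m ∸ i)) (upTo (suc m)))

z^_ : ℕ → PowerSeries
(z^ e) m = if does (m ℕ.≟ e) then 1ℚ else 0ℚ

1-z : PowerSeries
1-z m = (z^ 0) m - (z^ 1) m

power : PowerSeries → ℕ → PowerSeries
power f zero    = z^ 0
power f (suc d) = f · power f d

sumSeries : List PowerSeries → PowerSeries
sumSeries fs m = sumℚ (map (λ f → f m) fs)

------------------------------------------------------------------------
-- Ehrhart series

-- Coefficients in order of increasing degree; trailing zeros are allowed.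
Polynomial : Set
Polynomial = List ℚ

eval : Polynomial → ℚ → ℚ
eval p x = foldr (λ a s → a + x * s) 0ℚ p

-- Regions are given by their rational points.  Nothing is lost for lattice
-- point counts: for an integer t > 0 and an integer vector v, the only
-- solution x of t x = v is rational.
Region : ℕ → Set₁
Region n = Pred (Vec ℚ n) 0ℓ

LatticePointOf_·_ : ∀ {n} → ℕ → Region n → Pred (Vec ℤ n) 0ℓ
(LatticePointOf t · X) v =
  ∃[ x ] X x × Vec.map (fromℕ t *_) x ≡ Vec.map fromℤ v

HasCardinality : {A : Set} → Pred A 0ℓ → ℕ → Set
HasCardinality P m =
  ∃[ xs ] List.Unique xs × (∀ v → v ∈ xs ⇔ P v) × length xs ≡ m

IsEhrhartPolynomial : ∀ {n} → Region n → Polynomial → Set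
IsEhrhartPolynomial X E = ∀ t → 0 ℕ.< t →
  ∃[ m ] HasCardinality (LatticePointOf t · X) m × eval E (fromℕ t) ≡ fromℕ m

-- E*(X, z) in terms of the dimension n of the ambient space and the Ehrhart
-- polynomial E of X.  The constant term of the series is the value E(0) of
-- the polynomial, which need not be a lattice point count.
E* : ℕ → Polynomial → PowerSeries
E* n E = power 1-z (suc n) · (λ t → eval E (fromℕ t))

------------------------------------------------------------------------
-- Multi-hypersimplices

coordinateSum : ∀ {n} → Vec ℚ n → ℚ
coordinateSum = Vec.foldr′ _+_ 0ℚ

multiHypersimplex : (r n k : ℕ) → Region n
multiHypersimplex r n k v =
    All (λ x → 0ℚ ≤ x × x ≤ fromℕ r) v
  × fromℕ k - 1ℚ ≤ coordinateSum v
  × ( (k ℕ.< r ℕ.* n × coordinateSum v < fromℕ k)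
    ⊎ (k ≡ r ℕ.* n × coordinateSum v ≤ fromℕ k) )

------------------------------------------------------------------------
-- Colored permutations

-- A permutation in one-line notation; the letters 1, …, n are represented
-- by the elements of Fin n, and likewise the positions.
IsPermutation : ∀ {n} → Vec (Fin n) n → Set
IsPermutation = Unique

isPermutation? : ∀ {n} → Decidable (IsPermutation {n})
isPermutation? = allPairs? (λ x y → ¬? (x ≟ y))

words : (a n : ℕ) → List (Vec (Fin a) n)
words a zero    = [] ∷ []
words a (suc n) = cartesianProductWith _∷_ (List.allFin a) (words a n)

coloredPermutations : (r n : ℕ) → List (Vec (Fin n) n × Vec (Fin r) n)
coloredPermutations r n =
  cartesianProduct (filter isPermutation? (words n n)) (words r n)

module _ {r n : ℕ} where

  IsUncoloredExcedance : Vec (Fin n) n → Vec (Fin r) n → Pred (Fin n) 0ℓ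
  IsUncoloredExcedance σ c i = i Fin.< lookup σ i × toℕ (lookup c i) ≡ 0

  isUncoloredExcedance? : ∀ σ c → Decidable (IsUncoloredExcedance σ c)
  isUncoloredExcedance? σ c i =
    (i <? lookup σ i) ×-dec (toℕ (lookup c i) ℕ.≟ 0)

  fexc : Vec (Fin n) n × Vec (Fin r) n → ℕ
  fexc (σ , c) =
    r ℕ.* count (isUncoloredExcedance? σ c) (allFin n) ℕ.+ Vec.sum (Vec.map toℕ c)

module _ {r m : ℕ} (σ : Vec (Fin (suc m)) (suc m)) (c : Vec (Fin r) (suc m)) where

  -- For i : Fin m, the adjacent positions are inject₁ i and suc i.
  IsDescent* : Pred (Fin m) 0ℓ
  IsDescent* i =
      lookup c (inject₁ i) Fin.< lookup c (suc i)
    ⊎ ( lookup c (inject₁ i) ≡ lookup c (suc i)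
      × lookup σ (suc i) Fin.< lookup σ (inject₁ i) )

  isDescent*? : Decidable IsDescent*
  isDescent*? i =
    (lookup c (inject₁ i) <? lookup c (suc i))
    ⊎-dec ( (lookup c (inject₁ i) ≟ lookup c (suc i))
            ×-dec (lookup σ (suc i) <? lookup σ (inject₁ i)) )

des* : ∀ {r n} .{{_ : NonZero n}} → Vec (Fin n) n × Vec (Fin r) n → ℕ
des* {n = suc m} (σ , c) = count (isDescent*? σ c) (allFin m)

fdes* : ∀ {r n} .{{_ : NonZero n}} → Vec (Fin n) n × Vec (Fin r) n → ℕ
fdes* {r} {suc m} (σ , c) = r ℕ.* des* (σ , c) ℕ.+ toℕ (Vec.head c)

⌈_/_⌉ : (a b : ℕ) .{{_ : NonZero b}} → ℕ
⌈ a / b ⌉ = (a ℕ.+ pred b) ℕ./ b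

coloredPermutationsWithFexc : (r n e : ℕ) → List (Vec (Fin n) n × Vec (Fin r) n)
coloredPermutationsWithFexc r n e =
  filter (λ w → fexc w ℕ.≟ e) (coloredPermutations r n)

-- Let t > 0 and R = r t.  Expanding (Σ z^⌈fdes*/r⌉) / (1 - z)ⁿ⁺¹ over the colored
-- permutations, the coefficient of zᵗ counts pairs of (σ, c) and a sequence
-- R ≥ N₁ ≥ … ≥ Nₙ ≥ 0 with Nᵢ ≡ cᵢ mod r, in which σ increases along equal Nᵢ.
-- Putting Nᵢ at position σᵢ turns them into the words over {0, …, R}, and fexc into
-- Σ (aₚ mod r) plus r for each aₚ ≡ 0 mod r lying beyond its place in the sorted word.
-- On the other side, complementing coordinates turns the lattice points of the t-th
-- dilate into the words with a prescribed value of ⌊(Σ aₚ ∸ 1) / t⌋.  So the two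
-- statistics have to be equidistributed; we compare Σ y^stat for integers y.
--
-- For the first, cut the word into rows along its sorted rearrangement and read the
-- resulting table by a closed walk, as in the proof of MacMahon's master theorem.
-- The walks satisfy a linear system, whose elimination gives a linear recurrence in
-- the length n.  For the second, the same recurrence comes from telescoping over one
-- letter.  A large y then separates the powers of y.
--
-- The value of the Ehrhart polynomial at 0 is forced by the vanishing of iterated
-- differences on both sides.

module Submission where

open import Defs
open import Algebra using (CommutativeMonoid)
import Algebra.Properties.CommutativeMonoid.Sum as CMSum
import Algebra.Properties.Semiring.Sum as SemiringSum
open import Data.Bool using (Bool; true; false; not; _∧_; _∨_; if_then_else_)
open import Data.Fin using (Fin; zero; suc; toℕ)
import Data.Fin as Fin
import Data.Fin.Properties as Fin
open import Data.Fin.Permutation using (Permutation; permutation; _⟨$⟩ʳ_; _⟨$⟩ˡ_; inverseˡ; inverseʳ; flip)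
open import Data.Integer using (ℤ; 0ℤ; 1ℤ) renaming (+_ to pos)
import Data.Integer as ℤ hiding (+_)
import Data.Integer.Properties as ℤ
open import Data.Integer.Tactic.RingSolver using (solve-∀)
import Data.Nat.Tactic.RingSolver as ℕSolver
open import Data.List using (List; []; _∷_; _∷ʳ_; _++_; map; length)
import Data.List as List
import Data.List.Properties as List
open import Data.List.Membership.Propositional using (_∈_)
import Data.List.Membership.Propositional.Properties as ∈
open import Data.List.Membership.Propositional.Properties.WithK using (unique∧set⇒bag)
open import Data.List.Relation.Binary.BagAndSetEquality using (∼bag⇒↭)
open import Data.List.Relation.Binary.Permutation.Propositional using (_↭_)
import Data.List.Relation.Binary.Permutation.Propositional as ↭
open import Data.List.Relation.Binary.Permutation.Propositional.Properties using (↭-length)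
open import Data.List.Relation.Unary.All using ([]; _∷_)
open import Data.List.Relation.Unary.AllPairs using ([]; _∷_)
open import Data.List.Relation.Unary.Any using (here; there)
open import Data.List.Relation.Unary.Unique.Propositional using (Unique)
import Data.List.Relation.Unary.Unique.Propositional.Properties as Unique
open import Data.Nat using (ℕ; zero; suc; _+_; _*_; _∸_; _≤_; _<_; z≤n; s≤s; NonZero)
import Data.Nat as ℕ
import Data.Nat.Properties as ℕ
import Data.Nat.DivMod as ℕ
import Data.Nat.Divisibility as ℕ
open import Data.Product using (_×_; _,_; proj₁; proj₂; ∃-syntax)
open import Data.Rational using (ℚ; 0ℚ; 1ℚ)
import Data.Rational as ℚ
import Data.Rational.Properties as ℚ
import Data.Rational.Unnormalised as ℚᵘ
import Data.Rational.Unnormalised.Properties as ℚᵘ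
import Data.Rational.Solver as ℚSolver
open import Data.Sum using (_⊎_; inj₁; inj₂)
open import Data.Unit using (⊤; tt)
open import Data.Vec using (Vec; []; _∷_; lookup; updateAt; replicate)
import Data.Vec as Vec
import Data.Vec.Properties as Vec
import Data.Vec.Relation.Unary.All as VecAll
import Data.Vec.Relation.Unary.AllPairs as VecAllPairs
import Data.Vec.Relation.Unary.Unique.Propositional.Properties as VecUnique
open import Function using (_∘_; id; _⇔_; mk⇔; Equivalence)
open import Relation.Binary.PropositionalEquality
open import Relation.Binary.Definitions using (tri<; tri≈; tri>)
open import Relation.Nullary using (¬_; Dec; yes; no; does; contradiction)
open import Relation.Nullary.Decidable using (dec-true; dec-false; does-⇔; map′; ¬?; _×-dec_; _⊎-dec_)

open SemiringSum ℤ.+-*-semiring using ()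
  renaming (sum to ∑; sum-cong-≗ to ∑-cong; ∑-distrib-+ to ∑-+; *-distribˡ-sum to *-distribˡ-∑; sum-replicate-zero to ∑-zero)
open CMSum ℤ.+-0-commutativeMonoid using (∑-comm)
open CMSum ℤ.*-1-commutativeMonoid using ()
  renaming (sum to ∏; sum-cong-≗ to ∏-cong; sum-permute to ∏-permute)
open CMSum ℕ.+-0-commutativeMonoid using ()
  renaming (sum to ∑ⁿ; sum-cong-≗ to ∑ⁿ-cong; sum-permute to ∑ⁿ-permute; ∑-distrib-+ to ∑ⁿ-+; sum-replicate-zero to ∑ⁿ-zero)
open SemiringSum ℕ.+-*-semiring using () renaming (*-distribˡ-sum to *-distribˡ-∑ⁿ)

-- Finite sums and products

-- In a walk of MacMahon's type the weight of a step should depend on its two ends only. Loops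
-- violate this: whether one is an excedance depends on the order inside its row and on equal
-- letters in other rows. Remembering whether the walker last went down or up decides it, provided
-- that entries are taken from the front of a row in the first case and from the back in the second:
-- a loop met at the front is never an excedance, and balance forces one met at the back to be one.
-- This gives two unknowns per letter, but going up to `N` and going down to `N - 1` lead to the
-- same sequence, so the linear system is a chain `X` with one link per letter. Its ends are tied
-- together by `we (suc i) ≡ y * wd i`. Generating functions in the length, with variable u, are
-- kept as sequences, and `D w` stands for the factor 1 - w u; all identities are stated with
-- denominators cleared. At y = 1 the final recurrence reads 0 = 0, hence the exclusion of that
-- value.

module _ {c ℓ} (M : CommutativeMonoid c ℓ) where

  open CommutativeMonoid M using (Carrier; _≈_; _∙_; ∙-cong; ∙-congʳ; assoc; comm)
    renaming (sym to ≈-sym; trans to ≈-trans)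
  open CMSum M using () renaming (sum to ⨁)

  -- Inserting one entry into a table changes one factor of a product of row weights, or one summand
  -- of a letter count; the general monoid covers both.
  sum-changeAt : ∀ {n} {f g : Fin n → Carrier} i k → f i ≈ k ∙ g i →
                 (∀ j → j ≢ i → f j ≈ g j) → ⨁ f ≈ k ∙ ⨁ g
  sum-changeAt {suc n} {f} {g} zero k at other =
    ≈-trans (∙-cong at (⨁-cong (λ j → other (suc j) λ ()))) (assoc _ _ _)
    where
    ⨁-cong : ∀ {m} {f g : Fin m → Carrier} → (∀ j → f j ≈ g j) → ⨁ f ≈ ⨁ g
    ⨁-cong {zero}  eq = CommutativeMonoid.refl M
    ⨁-cong {suc m} eq = ∙-cong (eq zero) (⨁-cong (eq ∘ suc))
  sum-changeAt {suc n} {f} {g} (suc i) k at other =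
    ≈-trans (∙-cong (other zero λ ()) (sum-changeAt i k at (λ j j≢i → other (suc j) (j≢i ∘ Fin.suc-injective))))
    (≈-trans (≈-sym (assoc _ _ _)) (≈-trans (∙-congʳ (comm _ _)) (assoc _ _ _)))

∏-changeAt : ∀ {n} {f g : Fin n → ℤ} i k → f i ≡ k ℤ.* g i →
             (∀ j → j ≢ i → f j ≡ g j) → ∏ f ≡ k ℤ.* ∏ g
∏-changeAt = sum-changeAt ℤ.*-1-commutativeMonoid

∑ⁿ-changeAt : ∀ {n} {f g : Fin n → ℕ} i k → f i ≡ k + g i →
              (∀ j → j ≢ i → f j ≡ g j) → ∑ⁿ f ≡ k + ∑ⁿ g
∑ⁿ-changeAt = sum-changeAt ℕ.+-0-commutativeMonoid

∑-≡0 : ∀ {n} {f : Fin n → ℤ} → (∀ i → f i ≡ 0ℤ) → ∑ f ≡ 0ℤ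
∑-≡0 {n} eq = trans (∑-cong eq) (∑-zero n)

∏-≡0 : ∀ {n} {f : Fin n → ℤ} i → f i ≡ 0ℤ → ∏ f ≡ 0ℤ
∏-≡0 {f = f} zero    eq = trans (cong (ℤ._* ∏ (f ∘ suc)) eq) (ℤ.*-zeroˡ (∏ (f ∘ suc)))
∏-≡0 {f = f} (suc i) eq = trans (cong (f zero ℤ.*_) (∏-≡0 i eq)) (ℤ.*-zeroʳ (f zero))

∑ⁿ-mono : ∀ {n} {f g : Fin n → ℕ} → (∀ i → f i ≤ g i) → ∑ⁿ f ≤ ∑ⁿ g
∑ⁿ-mono {zero}  le = z≤n
∑ⁿ-mono {suc n} le = ℕ.+-mono-≤ (le zero) (∑ⁿ-mono (le ∘ suc))

δ : ℕ → ℕ → ℤ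
δ zero    zero    = 1ℤ
δ zero    (suc _) = 0ℤ
δ (suc _) zero    = 0ℤ
δ (suc a) (suc b) = δ a b

δ-≢ : ∀ {a b} → a ≢ b → δ a b ≡ 0ℤ
δ-≢ {zero}  {zero}  a≢b = contradiction refl a≢b
δ-≢ {zero}  {suc b} a≢b = refl
δ-≢ {suc a} {zero}  a≢b = refl
δ-≢ {suc a} {suc b} a≢b = δ-≢ (a≢b ∘ cong suc)

δ-refl : ∀ a → δ a a ≡ 1ℤ
δ-refl zero    = refl
δ-refl (suc a) = δ-refl a

δ-+ : ∀ k a b → δ (k + a) (k + b) ≡ δ a b
δ-+ zero    a b = refl
δ-+ (suc k) a b = δ-+ k a b

-- A failing equation makes both sides zero. Thus identities between weights may be proved under the
-- assumption that the table is balanced.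
∏δ-cong : ∀ {n} (f g : Fin n → ℕ) {p q : ℤ} → ((∀ i → f i ≡ g i) → p ≡ q) →
          ∏ (λ i → δ (f i) (g i)) ℤ.* p ≡ ∏ (λ i → δ (f i) (g i)) ℤ.* q
∏δ-cong f g {p} {q} p≡q with Fin.all? (λ i → f i ℕ.≟ g i)
... | yes f≡g = cong (∏ (λ i → δ (f i) (g i)) ℤ.*_) (p≡q f≡g)
... | no  f≢g with Fin.¬∀⟶∃¬ _ (λ i → f i ≡ g i) (λ i → f i ℕ.≟ g i) f≢g
...   | i , fi≢gi = trans (vanish p) (sym (vanish q))
  where
  vanish : ∀ z → ∏ (λ i → δ (f i) (g i)) ℤ.* z ≡ 0ℤ
  vanish z = trans (cong (ℤ._* z) (∏-≡0 i (δ-≢ fi≢gi))) (ℤ.*-zeroˡ z)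

e : ∀ {A} → Fin A → Fin A → ℕ
e x b = if does (x Fin.≟ b) then 1 else 0

e-refl : ∀ {A} (x : Fin A) → e x x ≡ 1
e-refl x with x Fin.≟ x
... | yes _   = refl
... | no  x≢x = contradiction refl x≢x

e-≢ : ∀ {A} {x b : Fin A} → x ≢ b → e x b ≡ 0
e-≢ {x = x} {b} x≢b with x Fin.≟ b
... | yes x≡b = contradiction x≡b x≢b
... | no  _   = refl

e-sym : ∀ {A} (x b : Fin A) → e x b ≡ e b x
e-sym x b with x Fin.≟ b
... | yes refl = sym (e-refl b)
... | no  x≢b  = sym (e-≢ (x≢b ∘ sym))

-- Tables

-- A word is cut into rows along its sorted rearrangement: the row of x holds the
-- entries at the positions where the sorted word has x.
Table : ℕ → ℕ → Set
Table A m = Vec (List (Fin A)) m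

-- The sum over the tables with n entries in total.
∑ᵗ : (A m n : ℕ) → (Table A m → ℤ) → ℤ
∑ᵗ A zero    zero    F = F []
∑ᵗ A zero    (suc n) F = 0ℤ
∑ᵗ A (suc m) zero    F = ∑ᵗ A m zero (λ T → F ([] ∷ T))
∑ᵗ A (suc m) (suc n) F =
  ∑ᵗ A m (suc n) (λ T → F ([] ∷ T)) ℤ.+
  ∑ (λ b → ∑ᵗ A (suc m) n (λ T → F (updateAt T zero (b ∷_))))

module _ {A : ℕ} where

  ∑ᵗ-cong : ∀ m n {F G : Table A m → ℤ} → (∀ T → F T ≡ G T) → ∑ᵗ A m n F ≡ ∑ᵗ A m n G
  ∑ᵗ-cong zero    zero    eq = eq []
  ∑ᵗ-cong zero    (suc n) eq = refl
  ∑ᵗ-cong (suc m) zero    eq = ∑ᵗ-cong m zero (λ T → eq ([] ∷ T))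
  ∑ᵗ-cong (suc m) (suc n) eq = cong₂ ℤ._+_
    (∑ᵗ-cong m (suc n) (λ T → eq ([] ∷ T)))
    (∑-cong (λ b → ∑ᵗ-cong (suc m) n (λ T → eq (updateAt T zero (b ∷_)))))

  ∑ᵗ-≡0 : ∀ m n {F : Table A m → ℤ} → (∀ T → F T ≡ 0ℤ) → ∑ᵗ A m n F ≡ 0ℤ
  ∑ᵗ-≡0 zero    zero    eq = eq []
  ∑ᵗ-≡0 zero    (suc n) eq = refl
  ∑ᵗ-≡0 (suc m) zero    eq = ∑ᵗ-≡0 m zero (λ T → eq ([] ∷ T))
  ∑ᵗ-≡0 (suc m) (suc n) eq = cong₂ ℤ._+_
    (∑ᵗ-≡0 m (suc n) (λ T → eq ([] ∷ T)))
    (∑-≡0 (λ b → ∑ᵗ-≡0 (suc m) n (λ T → eq (updateAt T zero (b ∷_)))))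

  ∑ᵗ-* : ∀ m n k (F : Table A m → ℤ) → ∑ᵗ A m n (λ T → k ℤ.* F T) ≡ k ℤ.* ∑ᵗ A m n F
  ∑ᵗ-* zero    zero    k F = refl
  ∑ᵗ-* zero    (suc n) k F = sym (ℤ.*-zeroʳ k)
  ∑ᵗ-* (suc m) zero    k F = ∑ᵗ-* m zero k (λ T → F ([] ∷ T))
  ∑ᵗ-* (suc m) (suc n) k F = trans
    (cong₂ ℤ._+_ (∑ᵗ-* m (suc n) k (λ T → F ([] ∷ T)))
      (trans (∑-cong (λ b → ∑ᵗ-* (suc m) n k (λ T → F (updateAt T zero (b ∷_)))))
             (sym (*-distribˡ-∑ k (λ b → ∑ᵗ A (suc m) n (λ T → F (updateAt T zero (b ∷_))))))))
    (sym (ℤ.*-distribˡ-+ k _ _))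

  ∑ᵗ-size-0 : ∀ m (F : Table A m → ℤ) → ∑ᵗ A m 0 F ≡ F (replicate m [])
  ∑ᵗ-size-0 zero    F = refl
  ∑ᵗ-size-0 (suc m) F = ∑ᵗ-size-0 m (λ T → F ([] ∷ T))

  -- Abstracts from the end of the row at which an entry is inserted, since the walker uses both
  -- ends.
  HeadPull : (Fin A → List (Fin A) → List (Fin A)) → Set
  HeadPull add = ∀ m n F → ∑ᵗ A (suc m) (suc n) F ≡
    ∑ᵗ A m (suc n) (λ T → F ([] ∷ T)) ℤ.+
    ∑ (λ b → ∑ᵗ A (suc m) n (λ T → F (updateAt T zero (add b))))

  headPull-front : HeadPull _∷_
  headPull-front m n F = refl

  swap-∑ : ∀ {m n} (u : ℤ) (f : Fin m → ℤ) (g : Fin n → Fin m → ℤ) →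
           u ℤ.+ ∑ (λ c → f c ℤ.+ ∑ (λ b → g b c)) ≡ u ℤ.+ (∑ f ℤ.+ ∑ (λ b → ∑ (g b)))
  swap-∑ u f g = cong (ℤ._+_ u) (trans (∑-+ f (λ c → ∑ (λ b → g b c)))
    (cong (ℤ._+_ (∑ f)) (∑-comm (λ c b → g b c))))

  -- Split off a first entry, then a last one by induction. A row with a single entry is where the
  -- two coincide; otherwise the two insertions commute.
  headPull-back : HeadPull (λ b row → row ∷ʳ b)
  headPull-back m zero    F = refl
  headPull-back m (suc n) F = begin
    empty ℤ.+ ∑ (λ c → ∑ᵗ A (suc m) (suc n) (λ T → F (updateAt T zero (c ∷_))))
      ≡⟨ cong (ℤ._+_ empty) (∑-cong (λ c → headPull-back m n (λ T → F (updateAt T zero (c ∷_))))) ⟩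
    empty ℤ.+ ∑ (λ c → ∑ᵗ A m (suc n) (λ T → F ((c ∷ []) ∷ T)) ℤ.+
      ∑ (λ b → ∑ᵗ A (suc m) n (λ T → F (updateAt (updateAt T zero (_∷ʳ b)) zero (c ∷_)))))
      ≡⟨ swap-∑ empty (λ c → ∑ᵗ A m (suc n) (λ T → F ((c ∷ []) ∷ T)))
           (λ b c → ∑ᵗ A (suc m) n (λ T → F (updateAt (updateAt T zero (_∷ʳ b)) zero (c ∷_)))) ⟩
    empty ℤ.+ (∑ (λ c → ∑ᵗ A m (suc n) (λ T → F ((c ∷ []) ∷ T))) ℤ.+
      ∑ (λ b → ∑ (λ c → ∑ᵗ A (suc m) n (λ T → F (updateAt (updateAt T zero (_∷ʳ b)) zero (c ∷_))))))
      ≡⟨ cong (ℤ._+_ empty) (sym (∑-+ (λ b → ∑ᵗ A m (suc n) (λ T → F ((b ∷ []) ∷ T))) _)) ⟩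
    empty ℤ.+ ∑ (λ b → ∑ᵗ A m (suc n) (λ T → F ((b ∷ []) ∷ T)) ℤ.+
      ∑ (λ c → ∑ᵗ A (suc m) n (λ T → F (updateAt (updateAt T zero (_∷ʳ b)) zero (c ∷_)))))
      ≡⟨ cong (ℤ._+_ empty) (∑-cong (λ b → cong (ℤ._+_ (∑ᵗ A m (suc n) (λ T → F ((b ∷ []) ∷ T))))
           (∑-cong (λ c → ∑ᵗ-cong (suc m) n
             {λ T → F (updateAt (updateAt T zero (_∷ʳ b)) zero (c ∷_))}
             {λ T → F (updateAt (updateAt T zero (c ∷_)) zero (_∷ʳ b))} (λ { (row ∷ T) → refl }))))) ⟩
    empty ℤ.+ ∑ (λ b → ∑ᵗ A (suc m) (suc n) (λ T → F (updateAt T zero (_∷ʳ b))))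
      ∎
    where
    open ≡-Reasoning
    empty = ∑ᵗ A m (suc (suc n)) (λ T → F ([] ∷ T))

  -- The rows before `N` are carried along by induction, and the tables to which no insertion at row
  -- `N` leads are those on which `F` vanishes.
  pullAt : ∀ {add} → HeadPull add → ∀ m n N (F : Table A m → ℤ) →
           (∀ T → lookup T N ≡ [] → F T ≡ 0ℤ) →
           ∑ᵗ A m (suc n) F ≡ ∑ (λ b → ∑ᵗ A m n (λ T → F (updateAt T N (add b))))
  pullAt pull (suc m) n zero F vanish = trans (pull m n F)
    (trans (cong₂ ℤ._+_ (∑ᵗ-≡0 m (suc n) (λ T → vanish ([] ∷ T) refl)) refl) (ℤ.+-identityˡ _))
  pullAt {add} pull (suc m) zero (suc N) F vanish = trans
    (cong₂ ℤ._+_ (pullAt pull m zero N (λ T → F ([] ∷ T)) (λ T → vanish ([] ∷ T)))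
      -- The only entry sits in the head row, so row `N` is empty.
      (∑-≡0 (λ b → trans (∑ᵗ-size-0 m (λ T → F ((b ∷ []) ∷ T)))
        (vanish _ (Vec.lookup-replicate N [])))))
    (ℤ.+-identityʳ _)
  pullAt {add} pull (suc m) (suc n) (suc N) F vanish = trans
    (cong₂ ℤ._+_
      (pullAt pull m (suc n) N (λ T → F ([] ∷ T)) (λ T → vanish ([] ∷ T)))
      (∑-cong (λ c → pullAt pull (suc m) n (suc N) (λ T → F (updateAt T zero (c ∷_)))
        (λ { (row ∷ T) → vanish ((c ∷ row) ∷ T) }))))
    (trans (cong (ℤ._+_ (∑ (λ b → ∑ᵗ A m (suc n) (λ T → F ([] ∷ updateAt T N (add b))))))
        (∑-comm (λ c b → ∑ᵗ A (suc m) n (λ T → F (updateAt (updateAt T (suc N) (add b)) zero (c ∷_))))))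
    (trans (sym (∑-+ (λ b → ∑ᵗ A m (suc n) (λ T → F ([] ∷ updateAt T N (add b)))) _))
      (∑-cong (λ b → cong (ℤ._+_ (∑ᵗ A m (suc n) (λ T → F ([] ∷ updateAt T N (add b)))))
        (∑-cong (λ c → ∑ᵗ-cong (suc m) n
          {λ T → F (updateAt (updateAt T (suc N) (add b)) zero (c ∷_))}
          {λ T → F (updateAt (updateAt T zero (c ∷_)) (suc N) (add b))} (λ { (row ∷ T) → refl })))))))

count : ∀ {A} → Fin A → List (Fin A) → ℕ
count x []       = 0
count x (b ∷ bs) = e x b + count x bs

content : ∀ {A m} → Fin A → Table A m → ℕ
content x T = ∑ⁿ (λ y → count x (lookup T y))

count-∷ʳ : ∀ {A} (x : Fin A) bs b → count x (bs ∷ʳ b) ≡ e x b + count x bs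
count-∷ʳ x []       b = refl
count-∷ʳ x (c ∷ bs) b = begin
  e x c + count x (bs ∷ʳ b) ≡⟨ cong (e x c +_) (count-∷ʳ x bs b) ⟩
  e x c + (e x b + count x bs) ≡⟨ ℕ.+-assoc (e x c) _ _ ⟨
  e x c + e x b + count x bs ≡⟨ cong (_+ count x bs) (ℕ.+-comm (e x c) _) ⟩
  e x b + e x c + count x bs ≡⟨ ℕ.+-assoc (e x b) _ _ ⟩
  e x b + (e x c + count x bs) ∎
  where open ≡-Reasoning

length-∷ʳ : ∀ {a} {X : Set a} (bs : List X) b → length (bs ∷ʳ b) ≡ suc (length bs)
length-∷ʳ bs b = trans (List.length-++ bs) (ℕ.+-comm (length bs) 1)

module _ {A m : ℕ} (x : Fin A) (T : Table A m) where

  below : Fin m → ℕ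
  below y = if does (toℕ x ℕ.<? toℕ y) then count x (lookup T y) else 0

  -- If the entries of row `y` are read as arcs leaving `y`, these are the arcs that come down to
  -- `x`.
  descents : ℕ
  descents = ∑ⁿ below

module _ {A m : ℕ} (T : Table A m) (N : Fin m) {h : List (Fin A) → List (Fin A)} where

  lookup-at : lookup (updateAt T N h) N ≡ h (lookup T N)
  lookup-at = Vec.lookup∘updateAt N T

  lookup-other : ∀ {y} → y ≢ N → lookup (updateAt T N h) y ≡ lookup T y
  lookup-other {y} y≢N = Vec.lookup∘updateAt′ y N y≢N T

  content-updateAt : ∀ x k → count x (h (lookup T N)) ≡ k + count x (lookup T N) →
                     content x (updateAt T N h) ≡ k + content x T
  content-updateAt x k eq = ∑ⁿ-changeAt N k (trans (cong (count x) lookup-at) eq)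
    (λ y y≢N → cong (count x) (lookup-other y≢N))

  descents-updateAt : ∀ x k → count x (h (lookup T N)) ≡ k + count x (lookup T N) →
    descents x (updateAt T N h) ≡ (if does (toℕ x ℕ.<? toℕ N) then k else 0) + descents x T
  descents-updateAt x k eq = ∑ⁿ-changeAt N _ at
    (λ y y≢N → cong (λ l → if does (toℕ x ℕ.<? toℕ y) then count x l else 0) (lookup-other y≢N))
    where
    at : below x (updateAt T N h) N ≡ (if does (toℕ x ℕ.<? toℕ N) then k else 0) + below x T N
    at with does (toℕ x ℕ.<? toℕ N)
    ... | true  = trans (cong (count x) lookup-at) eq
    ... | false = refl

  length-updateAt : length (h (lookup T N)) ≡ suc (length (lookup T N)) →
    ∀ x → length (lookup (updateAt T N h) x) ≡ e N x + length (lookup T x)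
  length-updateAt eq x with N Fin.≟ x
  ... | yes refl = trans (cong length lookup-at) eq
  ... | no  N≢x  = cong length (lookup-other (N≢x ∘ sym))

nonloops : ∀ {A} → Fin A → List (Fin A) → ℕ
nonloops x []       = 0
nonloops x (b ∷ bs) = (if does (x Fin.≟ b) then 0 else 1) + nonloops x bs

nonloops+count : ∀ {A} (x : Fin A) bs → nonloops x bs + count x bs ≡ length bs
nonloops+count x []       = refl
nonloops+count x (b ∷ bs) with does (x Fin.≟ b)
... | true  = trans (ℕ.+-suc _ _) (cong suc (nonloops+count x bs))
... | false = cong suc (nonloops+count x bs)

_≺?_ : ∀ {A} (x y : Fin A) → Dec (toℕ x < toℕ y)
x ≺? y = toℕ x ℕ.<? toℕ y

-- A loop, i.e. an entry x of the row of x, lies beyond its place in the sorted word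
-- iff more than θ non-loops precede it in its row, where θ counts the entries x in
-- the rows of larger letters.
module Weights {A : ℕ} (wd we : Fin A → ℤ) where

  weight : Bool → Fin A → ℤ
  weight ex b = if ex then we b else wd b

  isExc : Fin A → ℕ → ℕ → Fin A → Bool
  isExc x θ D b = if does (x Fin.≟ b) then does (θ ℕ.<? D) else does (x ≺? b)

  next : Fin A → ℕ → Fin A → ℕ
  next x D b = (if does (x Fin.≟ b) then 0 else 1) + D

  rowWeight : Fin A → ℕ → ℕ → List (Fin A) → ℤ
  rowWeight x θ D []       = 1ℤ
  rowWeight x θ D (b ∷ bs) = weight (isExc x θ D b) b ℤ.* rowWeight x θ (next x D b) bs

  -- Only the comparison of `θ` with `D` matters. Hence removing a non-loop from the front of a row
  -- amounts to lowering the threshold of the rest by one.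
  rowWeight-suc : ∀ x θ D bs → rowWeight x (suc θ) (suc D) bs ≡ rowWeight x θ D bs
  rowWeight-suc x θ D []       = refl
  rowWeight-suc x θ D (b ∷ bs) with does (x Fin.≟ b)
  ... | true  = cong (weight (does (θ ℕ.<? D)) b ℤ.*_) (rowWeight-suc x θ D bs)
  ... | false = cong (weight (does (x ≺? b)) b ℤ.*_) (rowWeight-suc x θ (suc D) bs)

  rowWeight-∷ʳ : ∀ x θ D bs b → rowWeight x θ D (bs ∷ʳ b) ≡
    weight (isExc x θ (nonloops x bs + D) b) b ℤ.* rowWeight x θ D bs
  rowWeight-∷ʳ x θ D []       b = refl
  rowWeight-∷ʳ x θ D (c ∷ bs) b = begin
    w ℤ.* rowWeight x θ (next x D c) (bs ∷ʳ b)
      ≡⟨ cong (w ℤ.*_) (rowWeight-∷ʳ x θ (next x D c) bs b) ⟩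
    w ℤ.* (weight (isExc x θ (nonloops x bs + next x D c) b) b ℤ.* rest)
      ≡⟨ swap w (weight (isExc x θ (nonloops x bs + next x D c) b) b) rest ⟩
    weight (isExc x θ (nonloops x bs + next x D c) b) b ℤ.* (w ℤ.* rest)
      ≡⟨ cong (λ n → weight (isExc x θ n b) b ℤ.* (w ℤ.* rest)) (shift (if does (x Fin.≟ c) then 0 else 1) (nonloops x bs) D) ⟩
    weight (isExc x θ (nonloops x (c ∷ bs) + D) b) b ℤ.* (w ℤ.* rest) ∎
    where
    open ≡-Reasoning
    w = weight (isExc x θ D c) c
    rest = rowWeight x θ (next x D c) bs
    swap : ∀ p q r → p ℤ.* (q ℤ.* r) ≡ q ℤ.* (p ℤ.* r)
    swap = solve-∀
    shift : ∀ i j k → j + (i + k) ≡ i + j + k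
    shift i j k = trans (sym (ℕ.+-assoc j i k)) (cong (_+ k) (ℕ.+-comm j i))

  -- No loop is preceded by more than `θ` non-loops, so none is an excedance and a larger threshold
  -- changes nothing. This is applied to the row of the letter 0.
  rowWeight-high : ∀ x θ D bs → nonloops x bs + D ≤ θ → rowWeight x (suc θ) D bs ≡ rowWeight x θ D bs
  rowWeight-high x θ D []       _  = refl
  rowWeight-high x θ D (b ∷ bs) le with does (x Fin.≟ b)
  ... | false = cong (weight (does (x ≺? b)) b ℤ.*_)
                  (rowWeight-high x θ (suc D) bs (subst (_≤ θ) (sym (ℕ.+-suc _ D)) le))
  ... | true  = cong₂ ℤ._*_
                  (cong (λ ex → weight ex b)
                    (trans (dec-false (suc θ ℕ.<? D) (λ 1+θ<D → ℕ.<⇒≱ (ℕ.<-trans (ℕ.n<1+n θ) 1+θ<D) D≤θ))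
                           (sym (dec-false (θ ℕ.<? D) (λ θ<D → ℕ.<⇒≱ θ<D D≤θ)))))
                  (rowWeight-high x θ D bs le)
    where
    D≤θ : D ≤ θ
    D≤θ = ℕ.≤-trans (ℕ.m≤n+m D (nonloops x bs)) le

  tableWeight : (Fin A → ℕ) → Table A A → ℤ
  tableWeight θ T = ∏ (λ x → rowWeight x (θ x) 0 (lookup T x))

  -- In-degree equals out-degree: a letter occurs in the word as often as in its sorted
  -- rearrangement.
  balanced : Table A A → ℤ
  balanced T = ∏ (λ x → δ (content x T) (length (lookup T x)))

  gf : ℕ → ℤ
  gf n = ∑ᵗ A A n (λ T → balanced T ℤ.* tableWeight (λ x → descents x T) T)

-- Tables in which the letter 0 does not occur

if-same : ∀ {a} {X : Set a} (c : Bool) (x : X) → (if c then x else x) ≡ x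
if-same true  x = refl
if-same false x = refl

-- The number of rows is kept apart from the size of the alphabet because row 0 is already split off
-- when this is applied.
∑ᵗ-restrict : ∀ {R} m n (F : Table (suc R) m → ℤ) → (∀ T → content zero T ≢ 0 → F T ≡ 0ℤ) →
              ∑ᵗ (suc R) m n F ≡ ∑ᵗ R m n (λ T → F (Vec.map (map suc) T))
∑ᵗ-restrict zero    zero    F vanish = refl
∑ᵗ-restrict zero    (suc n) F vanish = refl
∑ᵗ-restrict (suc m) zero    F vanish = ∑ᵗ-restrict m zero (λ T → F ([] ∷ T)) (λ T → vanish ([] ∷ T))
∑ᵗ-restrict {R} (suc m) (suc n) F vanish = cong₂ ℤ._+_
  (∑ᵗ-restrict m (suc n) (λ T → F ([] ∷ T)) (λ T → vanish ([] ∷ T)))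
  (trans (cong₂ ℤ._+_
    (∑ᵗ-≡0 (suc m) n {λ T → F (updateAt T zero (zero ∷_))} (λ { (row ∷ T) → vanish ((zero ∷ row) ∷ T) λ () }))
    (∑-cong (λ b → trans
      (∑ᵗ-restrict (suc m) n (λ T → F (updateAt T zero (suc b ∷_))) (λ { (row ∷ T) → vanish ((suc b ∷ row) ∷ T) }))
      (∑ᵗ-cong (suc m) n
        {λ T → F (updateAt (Vec.map (map suc) T) zero (suc b ∷_))}
        {λ T → F (Vec.map (map suc) (updateAt T zero (b ∷_)))}
        λ { (row ∷ T) → refl }))))
    (ℤ.+-identityˡ _))

count-zero-map-suc : ∀ {R} (bs : List (Fin R)) → count zero (map suc bs) ≡ 0
count-zero-map-suc []       = refl
count-zero-map-suc (b ∷ bs) = count-zero-map-suc bs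

count-suc-map-suc : ∀ {R} (x : Fin R) bs → count (suc x) (map suc bs) ≡ count x bs
count-suc-map-suc x []       = refl
count-suc-map-suc x (b ∷ bs) = cong (e x b +_) (count-suc-map-suc x bs)

rowWeight-map-suc : ∀ {R} (wd we : Fin (suc R) → ℤ) x θ D bs →
  Weights.rowWeight wd we (suc x) θ D (map suc bs) ≡ Weights.rowWeight (wd ∘ suc) (we ∘ suc) x θ D bs
rowWeight-map-suc wd we x θ D []       = refl
rowWeight-map-suc wd we x θ D (b ∷ bs) =
  cong (Weights.weight wd we (Weights.isExc wd we (suc x) θ D (suc b)) (suc b) ℤ.*_)
    (rowWeight-map-suc wd we x θ _ bs)

-- A balanced table is traversed by a walker who, standing at N, removes an entry b
-- of row N and moves to b, starting from and returning to the letter 0.  He takes the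
-- first entry of the row if he came down to N and the last one if he came up to it;
-- this choice keeps the set of loops that are excedances unchanged.
module Walk {R : ℕ} (wd we : Fin (suc R) → ℤ) where

  open Weights wd we

  nearlyBalanced : Fin (suc R) → Table (suc R) (suc R) → ℤ
  nearlyBalanced N T = ∏ (λ x → δ (content x T + e N x) (length (lookup T x) + e zero x))

  -- A walker coming down to `N` has removed an entry `N` from a larger row, which lowers `descents`
  -- at `N` by one; this adds it back. It lapses when a non-loop is taken from the front of row `N`,
  -- because that removal makes up for it.
  pending : Bool → Fin (suc R) → Fin (suc R) → ℕ
  pending ex N x = if ex then 0 else e N x

  threshold : Bool → Fin (suc R) → Table (suc R) (suc R) → Fin (suc R) → ℕ
  threshold ex N T x = descents x T + pending ex N x

  walkWeight : Bool → Fin (suc R) → Table (suc R) (suc R) → ℤ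
  walkWeight ex N T = nearlyBalanced N T ℤ.* tableWeight (threshold ex N T) T

  walks : Bool → Fin (suc R) → ℕ → ℤ
  walks ex N n = ∑ᵗ (suc R) (suc R) n (walkWeight ex N)

  nearlyBalanced-updateAt : ∀ N b T {h} →
    (∀ x → count x (h (lookup T N)) ≡ e x b + count x (lookup T N)) →
    length (h (lookup T N)) ≡ suc (length (lookup T N)) →
    nearlyBalanced N (updateAt T N h) ≡ nearlyBalanced b T
  nearlyBalanced-updateAt N b T {h} count-h length-h = ∏-cong λ x → begin
    δ (content x (updateAt T N h) + e N x) (length (lookup (updateAt T N h) x) + e zero x)
      ≡⟨ cong₂ (λ c l → δ (c + e N x) (l + e zero x))
           (content-updateAt T N {h = h} x (e x b) (count-h x)) (length-updateAt T N {h = h} length-h x) ⟩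
    δ (e x b + content x T + e N x) (e N x + length (lookup T x) + e zero x)
      ≡⟨ cong₂ δ (rearrange (e x b) (content x T) (e N x)) (ℕ.+-assoc (e N x) _ _) ⟩
    δ (e N x + (content x T + e x b)) (e N x + (length (lookup T x) + e zero x))
      ≡⟨ δ-+ (e N x) _ _ ⟩
    δ (content x T + e x b) (length (lookup T x) + e zero x)
      ≡⟨ cong (λ k → δ (content x T + k) (length (lookup T x) + e zero x)) (e-sym x b) ⟩
    δ (content x T + e b x) (length (lookup T x) + e zero x) ∎
    where
    open ≡-Reasoning
    rearrange : ∀ i j k → i + j + k ≡ k + (j + i)
    rearrange = ℕSolver.solve-∀

  comes-down : ∀ (N b x : Fin (suc R)) → x ≢ N →
    (if does (x ≺? N) then e x b else 0) ≡ pending (does (N ≺? b)) b x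
  comes-down N b x x≢N with x Fin.≟ b
  ... | no x≢b = trans (if-same (does (x ≺? N)) 0)
          (sym (trans (cong (λ k → if does (N ≺? b) then 0 else k) (e-≢ (x≢b ∘ sym))) (if-same (does (N ≺? b)) 0)))
  ... | yes refl with ℕ.<-cmp (toℕ x) (toℕ N)
  ...   | tri< x<N _ ¬N<x rewrite dec-true (x ≺? N) x<N | dec-false (N ≺? x) ¬N<x = sym (e-refl x)
  ...   | tri≈ _ x≡N _ = contradiction (Fin.toℕ-injective x≡N) x≢N
  ...   | tri> ¬x<N _ N<x rewrite dec-false (x ≺? N) ¬x<N | dec-true (N ≺? x) N<x = refl

  -- In contrast to `comes-down`, there is no exception at `x = N`: a loop taken from the back
  -- leaves the walker in the state `true`, where nothing is pending, whereas one taken from the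
  -- front leaves the state at `false`.
  comes-down′ : ∀ (N b x : Fin (suc R)) → (if does (x ≺? N) then e x b else 0) ≡ pending (not (does (b ≺? N))) b x
  comes-down′ N b x with x Fin.≟ b
  ... | no x≢b = trans (if-same (does (x ≺? N)) 0)
          (sym (trans (cong (λ k → if not (does (b ≺? N)) then 0 else k) (e-≢ (x≢b ∘ sym))) (if-same (not (does (b ≺? N))) 0)))
  ... | yes refl with does (x ≺? N)
  ...   | true  = sym (e-refl x)
  ...   | false = refl

  descents-self : ∀ (N : Fin (suc R)) (T : Table (suc R) (suc R)) b {h} → (∀ x → count x (h (lookup T N)) ≡ e x b + count x (lookup T N)) →
                  descents N (updateAt T N h) ≡ descents N T
  descents-self N T b {h} count-h = trans (descents-updateAt T N {h = h} N (e N b) (count-h N))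
    (cong (λ c → (if c then e N b else 0) + descents N T) (dec-false (N ≺? N) (ℕ.<-irrefl refl)))

  -- Nothing precedes the first entry, so a loop there is not an excedance, and its removal changes
  -- neither the threshold nor the state. A non-loop there precedes every loop of the row, and its
  -- removal cancels the pending one.
  tableWeight-front : ∀ N b T → let T⁺ = updateAt T N (b ∷_); ex = does (N ≺? b) in
    tableWeight (threshold false N T⁺) T⁺ ≡ weight ex b ℤ.* tableWeight (threshold ex b T) T
  tableWeight-front N b T = ∏-changeAt N (weight (does (N ≺? b)) b) at other
    where
    T⁺ = updateAt T N (b ∷_)
    row = lookup T N
    other : ∀ x → x ≢ N → rowWeight x (threshold false N T⁺ x) 0 (lookup T⁺ x) ≡
                           rowWeight x (threshold (does (N ≺? b)) b T x) 0 (lookup T x)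
    other x x≢N = cong₂ (λ θ → rowWeight x θ 0) (begin
      descents x T⁺ + e N x
        ≡⟨ cong₂ _+_ (descents-updateAt T N {h = b ∷_} x (e x b) refl) (e-≢ (x≢N ∘ sym)) ⟩
      (if does (x ≺? N) then e x b else 0) + descents x T + 0
        ≡⟨ ℕ.+-identityʳ _ ⟩
      (if does (x ≺? N) then e x b else 0) + descents x T
        ≡⟨ ℕ.+-comm _ (descents x T) ⟩
      descents x T + (if does (x ≺? N) then e x b else 0)
        ≡⟨ cong (descents x T +_) (comes-down N b x x≢N) ⟩
      descents x T + pending (does (N ≺? b)) b x ∎)
      (lookup-other T N x≢N)
      where open ≡-Reasoning
    at′ : ∀ d → rowWeight N (suc d) 0 (b ∷ row) ≡
                weight (does (N ≺? b)) b ℤ.* rowWeight N (d + pending (does (N ≺? b)) b N) 0 row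
    at′ d with N Fin.≟ b
    ... | yes refl rewrite dec-false (N ≺? N) (ℕ.<-irrefl refl) | e-refl N | ℕ.+-comm d 1 = refl
    ... | no  N≢b = cong (weight (does (N ≺? b)) b ℤ.*_) (trans (rowWeight-suc N d 0 row)
          (cong (λ θ → rowWeight N θ 0 row) (sym (trans (cong (d +_)
            (trans (cong (λ k → if does (N ≺? b) then 0 else k) (e-≢ (N≢b ∘ sym))) (if-same (does (N ≺? b)) 0)))
            (ℕ.+-identityʳ d)))))
    at : rowWeight N (threshold false N T⁺ N) 0 (lookup T⁺ N) ≡
         weight (does (N ≺? b)) b ℤ.* rowWeight N (threshold (does (N ≺? b)) b T N) 0 row
    at = trans (cong₂ (λ θ → rowWeight N θ 0)
      (trans (cong₂ _+_ (descents-self N T b {b ∷_} (λ _ → refl)) (e-refl N)) (ℕ.+-comm _ 1)) (lookup-at T N))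
      (at′ (descents N T))

  -- The last entry precedes nothing, so its removal leaves the rest of its row as it was. A loop
  -- there has to be an excedance to agree with the state `true`, which the hypothesis ensures.
  tableWeight-back : ∀ N b T → (N ≡ b → descents N T < nonloops N (lookup T N)) →
    let T⁺ = updateAt T N (_∷ʳ b); ex = not (does (b ≺? N)) in
    tableWeight (threshold true N T⁺) T⁺ ≡ weight ex b ℤ.* tableWeight (threshold ex b T) T
  tableWeight-back N b T exc = ∏-changeAt N (weight (not (does (b ≺? N))) b) at other
    where
    T⁺ = updateAt T N (_∷ʳ b)
    row = lookup T N
    threshold-x : ∀ x → threshold true N T⁺ x ≡ threshold (not (does (b ≺? N))) b T x
    threshold-x x = begin
      descents x T⁺ + 0
        ≡⟨ ℕ.+-identityʳ _ ⟩
      descents x T⁺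
        ≡⟨ descents-updateAt T N {h = _∷ʳ b} x (e x b) (count-∷ʳ x row b) ⟩
      (if does (x ≺? N) then e x b else 0) + descents x T
        ≡⟨ ℕ.+-comm _ (descents x T) ⟩
      descents x T + (if does (x ≺? N) then e x b else 0)
        ≡⟨ cong (descents x T +_) (comes-down′ N b x) ⟩
      descents x T + pending (not (does (b ≺? N))) b x ∎
      where open ≡-Reasoning
    other : ∀ x → x ≢ N → rowWeight x (threshold true N T⁺ x) 0 (lookup T⁺ x) ≡
                           rowWeight x (threshold (not (does (b ≺? N))) b T x) 0 (lookup T x)
    other x x≢N = cong₂ (λ θ → rowWeight x θ 0) (threshold-x x) (lookup-other T N x≢N)
    isExc-last : isExc N (threshold true N T⁺ N) (nonloops N row + 0) b ≡ not (does (b ≺? N))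
    isExc-last with N Fin.≟ b
    ... | yes refl = trans
          (dec-true (threshold true N T⁺ N ℕ.<? nonloops N row + 0) (subst₂ _<_
            (sym (trans (ℕ.+-identityʳ (descents N T⁺)) (descents-self N T N {_∷ʳ N} (λ x → count-∷ʳ x row N))))
            (sym (ℕ.+-identityʳ (nonloops N row))) (exc refl)))
          (cong not (sym (dec-false (N ≺? N) (ℕ.<-irrefl refl))))
    ... | no  N≢b with ℕ.<-cmp (toℕ N) (toℕ b)
    ...   | tri< N<b _ ¬b<N = trans (dec-true (N ≺? b) N<b) (cong not (sym (dec-false (b ≺? N) ¬b<N)))
    ...   | tri≈ _ N≡b _ = contradiction (Fin.toℕ-injective N≡b) N≢b
    ...   | tri> ¬N<b _ b<N = trans (dec-false (N ≺? b) ¬N<b) (cong not (sym (dec-true (b ≺? N) b<N)))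
    at : rowWeight N (threshold true N T⁺ N) 0 (lookup T⁺ N) ≡
         weight (not (does (b ≺? N))) b ℤ.* rowWeight N (threshold (not (does (b ≺? N))) b T N) 0 row
    at = begin
      rowWeight N (threshold true N T⁺ N) 0 (lookup T⁺ N)
        ≡⟨ cong (rowWeight N (threshold true N T⁺ N) 0) (lookup-at T N) ⟩
      rowWeight N (threshold true N T⁺ N) 0 (row ∷ʳ b)
        ≡⟨ rowWeight-∷ʳ N (threshold true N T⁺ N) 0 row b ⟩
      weight (isExc N (threshold true N T⁺ N) (nonloops N row + 0) b) b ℤ.* rowWeight N (threshold true N T⁺ N) 0 row
        ≡⟨ cong₂ (λ ex θ → weight ex b ℤ.* rowWeight N θ 0 row) isExc-last (threshold-x N) ⟩
      weight (not (does (b ≺? N))) b ℤ.* rowWeight N (threshold (not (does (b ≺? N))) b T N) 0 row ∎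
      where open ≡-Reasoning

  -- The loops at `N` and the arcs coming down to `N` are disjoint sets of arcs into `N`.
  count+descents≤content : ∀ N (T : Table (suc R) (suc R)) → count N (lookup T N) + descents N T ≤ content N T
  count+descents≤content N T = subst₂ _≤_
    (∑ⁿ-changeAt {f = λ y → (if does (N Fin.≟ y) then count N (lookup T y) else 0) + below N T y} {g = below N T} N (count N (lookup T N))
      (cong (λ c → (if c then count N (lookup T N) else 0) + below N T N) (dec-true (N Fin.≟ N) refl))
      (λ y y≢N → cong (λ c → (if c then count N (lookup T y) else 0) + below N T y) (dec-false (N Fin.≟ y) (y≢N ∘ sym))))
    refl
    (∑ⁿ-mono {suc R} {f = λ y → (if does (N Fin.≟ y) then count N (lookup T y) else 0) + below N T y}
      {g = λ y → count N (lookup T y)} le)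
    where
    le : ∀ y → (if does (N Fin.≟ y) then count N (lookup T y) else 0) + below N T y ≤ count N (lookup T y)
    le y with N Fin.≟ y
    ... | yes refl rewrite dec-false (N ≺? N) (ℕ.<-irrefl refl) = ℕ.≤-reflexive (ℕ.+-identityʳ _)
    ... | no  _ with does (N ≺? y)
    ...   | true  = ℕ.≤-refl
    ...   | false = z≤n

  walkWeight-front : ∀ N b T → let ex = does (N ≺? b) in
    walkWeight false N (updateAt T N (b ∷_)) ≡ weight ex b ℤ.* walkWeight ex b T
  walkWeight-front N b T = begin
    nearlyBalanced N T⁺ ℤ.* tableWeight (threshold false N T⁺) T⁺
      ≡⟨ cong₂ ℤ._*_ (nearlyBalanced-updateAt N b T (λ _ → refl) refl) (tableWeight-front N b T) ⟩
    nearlyBalanced b T ℤ.* (weight ex b ℤ.* tableWeight (threshold ex b T) T)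
      ≡⟨ swap (nearlyBalanced b T) (weight ex b) (tableWeight (threshold ex b T) T) ⟩
    weight ex b ℤ.* (nearlyBalanced b T ℤ.* tableWeight (threshold ex b T) T) ∎
    where
    open ≡-Reasoning
    ex = does (N ≺? b)
    T⁺ = updateAt T N (b ∷_)
    swap : ∀ p q r → p ℤ.* (q ℤ.* r) ≡ q ℤ.* (p ℤ.* r)
    swap = solve-∀

  walkWeight-back : ∀ N b T → N ≢ zero → let ex = not (does (b ≺? N)) in
    walkWeight true N (updateAt T N (_∷ʳ b)) ≡ weight ex b ℤ.* walkWeight ex b T
  walkWeight-back N b T N≢0 = begin
    nearlyBalanced N T⁺ ℤ.* tableWeight (threshold true N T⁺) T⁺
      ≡⟨ cong (ℤ._* tableWeight (threshold true N T⁺) T⁺)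
           (nearlyBalanced-updateAt N b T (λ x → count-∷ʳ x (lookup T N) b) (length-∷ʳ (lookup T N) b)) ⟩
    nearlyBalanced b T ℤ.* tableWeight (threshold true N T⁺) T⁺
      ≡⟨ ∏δ-cong (λ x → content x T + e b x) (λ x → length (lookup T x) + e zero x)
           (λ bal → tableWeight-back N b T (λ N≡b → exc N≡b (bal N))) ⟩
    nearlyBalanced b T ℤ.* (weight ex b ℤ.* tableWeight (threshold ex b T) T)
      ≡⟨ swap (nearlyBalanced b T) (weight ex b) (tableWeight (threshold ex b T) T) ⟩
    weight ex b ℤ.* (nearlyBalanced b T ℤ.* tableWeight (threshold ex b T) T) ∎
    where
    open ≡-Reasoning
    ex = not (does (b ≺? N))
    T⁺ = updateAt T N (_∷ʳ b)
    swap : ∀ p q r → p ℤ.* (q ℤ.* r) ≡ q ℤ.* (p ℤ.* r)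
    swap = solve-∀
    -- `T` is what remains after the removal of the loop. Away from 0, near-balance makes row `N`
    -- longer by one than the number of remaining entries `N`. Since the loops and the descents are
    -- among these, the row keeps more than `descents N T` non-loops. At 0 the count would fall
    -- short by one.
    exc : N ≡ b → content N T + e b N ≡ length (lookup T N) + e zero N → descents N T < nonloops N (lookup T N)
    exc refl bal = ℕ.+-cancelˡ-< (count N (lookup T N)) _ _ (ℕ.≤-trans
      (s≤s (count+descents≤content N T)) (ℕ.≤-reflexive (begin
        suc (content N T) ≡⟨ ℕ.+-comm 1 _ ⟩
        content N T + 1 ≡⟨ cong (content N T +_) (e-refl N) ⟨
        content N T + e N N ≡⟨ bal ⟩
        length (lookup T N) + e zero N ≡⟨ cong (length (lookup T N) +_) (e-≢ (N≢0 ∘ sym)) ⟩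
        length (lookup T N) + 0 ≡⟨ ℕ.+-identityʳ _ ⟩
        length (lookup T N) ≡⟨ nonloops+count N (lookup T N) ⟨
        nonloops N (lookup T N) + count N (lookup T N) ≡⟨ ℕ.+-comm (nonloops N (lookup T N)) _ ⟩
        count N (lookup T N) + nonloops N (lookup T N) ∎)))

  -- A trail from `N` to 0 has to leave `N`: near-balance asks for one more arc out of `N` than into
  -- it.
  walkWeight-stuck : ∀ ex N T → N ≢ zero → lookup T N ≡ [] → walkWeight ex N T ≡ 0ℤ
  walkWeight-stuck ex N T N≢0 empty = trans
    (cong (ℤ._* tableWeight (threshold ex N T) T) (∏-≡0 {f = λ x → δ (content x T + e N x) (length (lookup T x) + e zero x)} N
      (trans (cong₂ δ (trans (cong (content N T +_) (e-refl N)) (ℕ.+-comm _ 1)) (cong₂ _+_ (cong length empty) (e-≢ (N≢0 ∘ sym)))) refl)))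
    (ℤ.*-zeroˡ (tableWeight (threshold ex N T) T))

  walks-0 : ∀ ex N → N ≢ zero → walks ex N 0 ≡ 0ℤ
  walks-0 ex N N≢0 = trans (∑ᵗ-size-0 (suc R) (walkWeight ex N))
    (walkWeight-stuck ex N (replicate (suc R) []) N≢0 (Vec.lookup-replicate N []))

  ∑ᵗ-front : ∀ N n → ∑ (λ b → ∑ᵗ (suc R) (suc R) n (λ T → walkWeight false N (updateAt T N (b ∷_)))) ≡
    ∑ (λ b → weight (does (N ≺? b)) b ℤ.* walks (does (N ≺? b)) b n)
  ∑ᵗ-front N n = ∑-cong λ b → trans
    (∑ᵗ-cong (suc R) n (walkWeight-front N b))
    (∑ᵗ-* (suc R) n (weight (does (N ≺? b)) b) (walkWeight (does (N ≺? b)) b))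

  walks-false-suc : ∀ N n → N ≢ zero →
    walks false N (suc n) ≡ ∑ (λ b → weight (does (N ≺? b)) b ℤ.* walks (does (N ≺? b)) b n)
  walks-false-suc N n N≢0 = trans
    (pullAt {add = _∷_} headPull-front (suc R) n N (walkWeight false N) (λ T → walkWeight-stuck false N T N≢0))
    (∑ᵗ-front N n)

  walks-true-suc : ∀ N n → N ≢ zero →
    walks true N (suc n) ≡ ∑ (λ b → weight (not (does (b ≺? N))) b ℤ.* walks (not (does (b ≺? N))) b n)
  walks-true-suc N n N≢0 = trans
    (pullAt {add = λ b row → row ∷ʳ b} headPull-back (suc R) n N (walkWeight true N) (λ T → walkWeight-stuck true N T N≢0))
    (∑-cong λ b → trans
      (∑ᵗ-cong (suc R) n (λ T → walkWeight-back N b T N≢0))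
      (∑ᵗ-* (suc R) n (weight (not (does (b ≺? N))) b) (walkWeight (not (does (b ≺? N))) b)))

  -- The closed walk starts as if it had come down to 0, which raises the threshold of row 0 by one.
  -- This is harmless: by balance the non-loops of row 0 are as many as the entries 0 in other rows,
  -- and these are all descents, so no loop at 0 is an excedance.
  gf-walks : ∀ n → gf n ≡ walks false zero n
  gf-walks n = ∑ᵗ-cong (suc R) n λ T → begin
    balanced T ℤ.* tableWeight (λ x → descents x T) T
      ≡⟨ ∏δ-cong (λ x → content x T) (λ x → length (lookup T x)) (λ bal → ∏-cong (row T (bal zero))) ⟩
    balanced T ℤ.* tableWeight (threshold false zero T) T
      ≡⟨ cong (ℤ._* tableWeight (threshold false zero T) T) (∏-cong (λ x → sym (trans
           (cong₂ δ (ℕ.+-comm (content x T) (e zero x)) (ℕ.+-comm (length (lookup T x)) (e zero x)))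
           (δ-+ (e zero x) (content x T) (length (lookup T x)))))) ⟩
    nearlyBalanced zero T ℤ.* tableWeight (threshold false zero T) T ∎
    where
    open ≡-Reasoning
    row : ∀ T → content zero T ≡ length (lookup T zero) → ∀ x →
          rowWeight x (descents x T) 0 (lookup T x) ≡ rowWeight x (threshold false zero T x) 0 (lookup T x)
    row T         bal (suc x) = cong (λ θ → rowWeight (suc x) θ 0 (lookup T (suc x))) (sym (ℕ.+-identityʳ _))
    row (r₀ ∷ T) bal zero    = trans
      (sym (rowWeight-high zero (descents zero (r₀ ∷ T)) 0 r₀ (ℕ.≤-trans (ℕ.≤-reflexive (ℕ.+-identityʳ _))
        (ℕ.+-cancelˡ-≤ (count zero r₀) _ _ (ℕ.≤-reflexive (trans (ℕ.+-comm (count zero r₀) _)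
          (trans (nonloops+count zero r₀) (sym bal))))))))
      (cong (λ θ → rowWeight zero θ 0 r₀) (ℕ.+-comm 1 (descents zero (r₀ ∷ T))))

  -- The walk ends at 0 when row 0 is empty. By balance no entry 0 is left either, and the arcs that
  -- the walk has missed form a balanced table on the larger letters. This yields the recursion on
  -- the alphabet.
  walks-tail : ∀ n → ∑ᵗ (suc R) R n (λ T → walkWeight false zero ([] ∷ T)) ≡ Weights.gf (wd ∘ suc) (we ∘ suc) n
  walks-tail n = trans
    (∑ᵗ-restrict R n (λ T → walkWeight false zero ([] ∷ T)) λ T c≢0 → trans
      (cong (ℤ._* tableWeight (threshold false zero ([] ∷ T)) ([] ∷ T))
        (∏-≡0 {f = λ x → δ (content x ([] ∷ T) + e zero x) (length (lookup ([] ∷ T) x) + e zero x)} zero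
          (trans (cong (λ k → δ k 1) (ℕ.+-comm (content zero T) 1)) (δ-≢ c≢0))))
      (ℤ.*-zeroˡ (tableWeight (threshold false zero ([] ∷ T)) ([] ∷ T))))
    (∑ᵗ-cong R n eq)
    where
    module W′ = Weights (wd ∘ suc) (we ∘ suc)
    lookup-map = λ (T : Table R R) y → Vec.lookup-map y (map suc) T
    eq : ∀ T → walkWeight false zero ([] ∷ Vec.map (map suc) T) ≡
               W′.balanced T ℤ.* W′.tableWeight (λ x → descents x T) T
    eq T = cong₂ ℤ._*_
      (trans (cong₂ ℤ._*_
        (cong (λ c → δ (c + 1) 1) (trans (∑ⁿ-cong (λ y → trans (cong (count zero) (lookup-map T y)) (count-zero-map-suc (lookup T y)))) (∑ⁿ-zero R)))
        (∏-cong (λ x → cong₂ δ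
          (trans (ℕ.+-identityʳ _) (∑ⁿ-cong (λ y → trans (cong (count (suc x)) (lookup-map T y)) (count-suc-map-suc x (lookup T y)))))
          (trans (ℕ.+-identityʳ _) (trans (cong length (lookup-map T x)) (List.length-map suc (lookup T x)))))))
        (ℤ.*-identityˡ _))
      (trans (ℤ.*-identityˡ _) (∏-cong λ x → trans
        (cong₂ (λ θ → rowWeight (suc x) θ 0)
          (trans (ℕ.+-identityʳ _) (∑ⁿ-cong λ y → cong (λ c → if does (x ≺? y) then c else 0)
            (trans (cong (count (suc x)) (lookup-map T y)) (count-suc-map-suc x (lookup T y)))))
          (lookup-map T x))
        (rowWeight-map-suc wd we x (descents x T) 0 (lookup T x))))

  walks-zero-suc : ∀ n → walks false zero (suc n) ≡
    Weights.gf (wd ∘ suc) (we ∘ suc) (suc n) ℤ.+ ∑ (λ b → weight (does (zero {R} ≺? b)) b ℤ.* walks (does (zero {R} ≺? b)) b n)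
  walks-zero-suc n = cong₂ ℤ._+_ (walks-tail (suc n)) (∑ᵗ-front zero n)

-- Linear recurrences

-- Multiplication of the generating function ∑ f n uⁿ by 1 - w u.
D : ℤ → (ℕ → ℤ) → ℕ → ℤ
D w f zero    = f zero
D w f (suc n) = f (suc n) ℤ.- w ℤ.* f n

_∔_∙_ : (ℕ → ℤ) → ℤ → (ℕ → ℤ) → ℕ → ℤ
(f ∔ k ∙ g) n = f n ℤ.+ k ℤ.* g n

ε : ℕ → ℤ
ε zero    = 1ℤ
ε (suc n) = 0ℤ

D-cong : ∀ w {f g} → f ≗ g → D w f ≗ D w g
D-cong w eq zero    = eq zero
D-cong w eq (suc n) = cong₂ (λ p q → p ℤ.- w ℤ.* q) (eq (suc n)) (eq n)

-- Stands in for division by 1 - w u, a unit among power series.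
D-cancel : ∀ w {f g} → D w f ≗ D w g → f ≗ g
D-cancel w         eq zero    = eq zero
D-cancel w {f} {g} eq (suc n) = begin
  f (suc n) ≡⟨ split (f (suc n)) (w ℤ.* f n) ⟩
  f (suc n) ℤ.- w ℤ.* f n ℤ.+ w ℤ.* f n ≡⟨ cong₂ (λ p q → p ℤ.+ w ℤ.* q) (eq (suc n)) (D-cancel w {f} {g} eq n) ⟩
  g (suc n) ℤ.- w ℤ.* g n ℤ.+ w ℤ.* g n ≡⟨ split (g (suc n)) (w ℤ.* g n) ⟨
  g (suc n) ∎
  where
  open ≡-Reasoning
  split : ∀ p q → p ≡ p ℤ.- q ℤ.+ q
  split = solve-∀

D-comm : ∀ v w f → D v (D w f) ≗ D w (D v f)
D-comm v w f zero          = refl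
D-comm v w f (suc zero)    = lemma v w (f 0) (f 1)
  where
  lemma : ∀ v w p q → q ℤ.- w ℤ.* p ℤ.- v ℤ.* p ≡ q ℤ.- v ℤ.* p ℤ.- w ℤ.* p
  lemma = solve-∀
D-comm v w f (suc (suc n)) = lemma v w (f n) (f (suc n)) (f (suc (suc n)))
  where
  lemma : ∀ v w p q r → r ℤ.- w ℤ.* q ℤ.- v ℤ.* (q ℤ.- w ℤ.* p) ≡ r ℤ.- v ℤ.* q ℤ.- w ℤ.* (q ℤ.- v ℤ.* p)
  lemma = solve-∀

D-lin : ∀ w f k g → D w (f ∔ k ∙ g) ≗ D w f ∔ k ∙ D w g
D-lin w f k g zero    = refl
D-lin w f k g (suc n) = lemma w k (f (suc n)) (g (suc n)) (f n) (g n)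
  where
  lemma : ∀ w k f₁ g₁ f₀ g₀ → f₁ ℤ.+ k ℤ.* g₁ ℤ.- w ℤ.* (f₀ ℤ.+ k ℤ.* g₀) ≡
                              f₁ ℤ.- w ℤ.* f₀ ℤ.+ k ℤ.* (g₁ ℤ.- w ℤ.* g₀)
  lemma = solve-∀

D-scale : ∀ w k f → D w (λ n → k ℤ.* f n) ≗ (λ n → k ℤ.* D w f n)
D-scale w k f zero    = refl
D-scale w k f (suc n) = lemma w k (f (suc n)) (f n)
  where
  lemma : ∀ w k p q → k ℤ.* p ℤ.- w ℤ.* (k ℤ.* q) ≡ k ℤ.* (p ℤ.- w ℤ.* q)
  lemma = solve-∀

lin-cong : ∀ {f f′ g g′} k → f ≗ f′ → g ≗ g′ → f ∔ k ∙ g ≗ f′ ∔ k ∙ g′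
lin-cong k eq eq′ n = cong₂ (λ p q → p ℤ.+ k ℤ.* q) (eq n) (eq′ n)

D∏ : (ℕ → ℤ) → ℕ → (ℕ → ℤ) → ℕ → ℤ
D∏ w zero    f = f
D∏ w (suc R) f = D (w 0) (D∏ (w ∘ suc) R f)

D∏-cong : ∀ w R {f g} → f ≗ g → D∏ w R f ≗ D∏ w R g
D∏-cong w zero    eq = eq
D∏-cong w (suc R) eq = D-cong (w 0) (D∏-cong (w ∘ suc) R eq)

D∏-D : ∀ w R v f → D∏ w R (D v f) ≗ D v (D∏ w R f)
D∏-D w zero    v f n = refl
D∏-D w (suc R) v f n = trans (D-cong (w 0) (D∏-D (w ∘ suc) R v f) n) (D-comm (w 0) v (D∏ (w ∘ suc) R f) n)

D∏-D∏ : ∀ v R w S f → D∏ v R (D∏ w S f) ≗ D∏ w S (D∏ v R f)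
D∏-D∏ v zero    w S f n = refl
D∏-D∏ v (suc R) w S f n = trans (D-cong (v 0) (D∏-D∏ (v ∘ suc) R w S f) n)
  (sym (D∏-D w S (v 0) (D∏ (v ∘ suc) R f) n))

D∏-lin : ∀ w R f k g → D∏ w R (f ∔ k ∙ g) ≗ D∏ w R f ∔ k ∙ D∏ w R g
D∏-lin w zero    f k g n = refl
D∏-lin w (suc R) f k g n = trans (D-cong (w 0) (D∏-lin (w ∘ suc) R f k g) n)
  (D-lin (w 0) (D∏ (w ∘ suc) R f) k (D∏ (w ∘ suc) R g) n)

D∏-scale : ∀ w R k f → D∏ w R (λ n → k ℤ.* f n) ≗ (λ n → k ℤ.* D∏ w R f n)
D∏-scale w zero    k f n = refl
D∏-scale w (suc R) k f n = trans (D-cong (w 0) (D∏-scale (w ∘ suc) R k f) n) (D-scale (w 0) k (D∏ (w ∘ suc) R f) n)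

D∏-last : ∀ w R f → D∏ w (suc R) f ≗ D∏ w R (D (w R) f)
D∏-last w zero    f n = refl
D∏-last w (suc R) f n = D-cong (w 0) (D∏-last (w ∘ suc) R f) n

-- The quotients Z (i+1) / Z i = (1 - β i u) / (1 - α i u) telescope.
D∏-chain : ∀ α β R (Z : ℕ → ℕ → ℤ) → (∀ i → i < R → D (α i) (Z (suc i)) ≗ D (β i) (Z i)) →
           D∏ α R (Z R) ≗ D∏ β R (Z 0)
D∏-chain α β zero    Z link n = refl
D∏-chain α β (suc R) Z link n = begin
  D∏ α (suc R) (Z (suc R)) n ≡⟨ D∏-last α R (Z (suc R)) n ⟩
  D∏ α R (D (α R) (Z (suc R))) n ≡⟨ D∏-cong α R (link R ℕ.≤-refl) n ⟩
  D∏ α R (D (β R) (Z R)) n ≡⟨ D∏-D α R (β R) (Z R) n ⟩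
  D (β R) (D∏ α R (Z R)) n ≡⟨ D-cong (β R) (D∏-chain α β R Z (λ i i<R → link i (ℕ.m≤n⇒m≤1+n i<R))) n ⟩
  D (β R) (D∏ β R (Z 0)) n ≡⟨ D∏-D β R (β R) (Z 0) n ⟨
  D∏ β R (D (β R) (Z 0)) n ≡⟨ D∏-last β R (Z 0) n ⟨
  D∏ β (suc R) (Z 0) n ∎
  where open ≡-Reasoning

-- The recurrence of the balanced tables

∑-shift : ∀ R (f : ℕ → ℤ) → ∑ {R} (f ∘ toℕ) ℤ.+ f R ≡ f 0 ℤ.+ ∑ {R} (f ∘ suc ∘ toℕ)
∑-shift zero    f = ℤ.+-comm 0ℤ (f 0)
∑-shift (suc R) f = trans (ℤ.+-assoc (f 0) (∑ {R} (f ∘ suc ∘ toℕ)) (f (suc R))) (cong (ℤ._+_ (f 0)) (∑-shift R (f ∘ suc)))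

∑-changeAt : ∀ {n} {f g : Fin n → ℤ} i k → f i ≡ k ℤ.+ g i →
             (∀ j → j ≢ i → f j ≡ g j) → ∑ f ≡ k ℤ.+ ∑ g
∑-changeAt = sum-changeAt ℤ.+-0-commutativeMonoid

module Recurrence (y : ℤ) where

  tables : (wd we : ℕ → ℤ) (A : ℕ) → ℕ → ℤ
  tables wd we A = Weights.gf {A} (wd ∘ toℕ) (we ∘ toℕ)

  module _ (wd we : ℕ → ℤ) (R : ℕ) where

    open Walk {R} (wd ∘ toℕ) (we ∘ toℕ)

    G G′ : ℕ → ℤ
    G  = tables wd we (suc R)
    G′ = tables (wd ∘ suc) (we ∘ suc) R

    entry : Bool → ℕ → Fin (suc R) → ℤ
    entry ex n b = Weights.weight (wd ∘ toℕ) (we ∘ toℕ) ex b ℤ.* walks ex b n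

    term : ℕ → ℕ → Fin (suc R) → ℤ
    term M n b = entry (not (does (toℕ b ℕ.<? M))) n b

    -- One step of the walk, with the letters below `M` treated as reached downwards and the others
    -- as reached upwards. From `N` the two states differ only in the treatment of the loop, so they
    -- are `X (suc (toℕ N))` and `X (toℕ N)`. The value at 0 reflects that no walk of length 0 leads
    -- from another letter to 0.
    X : ℕ → ℕ → ℤ
    X M zero    = 0ℤ
    X M (suc n) = ∑ (term M n)

    ≺?-not : ∀ (N b : Fin (suc R)) → does (N ≺? b) ≡ not (does (toℕ b ℕ.<? suc (toℕ N)))
    ≺?-not N b with toℕ N ℕ.<? toℕ b
    ... | yes N<b = trans (dec-true (N ≺? b) N<b) (cong not (sym (dec-false (toℕ b ℕ.<? suc (toℕ N)) (λ b≤N → ℕ.<⇒≱ N<b (ℕ.s≤s⁻¹ b≤N)))))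
    ... | no  N≮b = trans (dec-false (N ≺? b) N≮b) (cong not (sym (dec-true (toℕ b ℕ.<? suc (toℕ N)) (s≤s (ℕ.≮⇒≥ N≮b)))))

    term-false : ∀ N n b → entry (does (N ≺? b)) n b ≡ term (suc (toℕ N)) n b
    term-false N n b = cong (λ ex → entry ex n b) (≺?-not N b)

    <?-suc : ∀ {c M} → c ≢ M → does (c ℕ.<? suc M) ≡ does (c ℕ.<? M)
    <?-suc {c} {M} c≢M with c ℕ.<? M
    ... | yes c<M = trans (dec-true (c ℕ.<? suc M) (ℕ.m≤n⇒m≤1+n c<M)) (sym (dec-true (c ℕ.<? M) c<M))
    ... | no  c≮M = trans (dec-false (c ℕ.<? suc M) (λ c≤M → c≮M (ℕ.≤∧≢⇒< (ℕ.s≤s⁻¹ c≤M) c≢M))) (sym (dec-false (c ℕ.<? M) c≮M))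

    walks-true : ∀ N → N ≢ zero → walks true N ≗ X (toℕ N)
    walks-true N N≢0 zero    = walks-0 true N N≢0
    walks-true N N≢0 (suc n) = walks-true-suc N n N≢0

    walks-false : ∀ N → N ≢ zero → walks false N ≗ X (suc (toℕ N))
    walks-false N N≢0 zero    = walks-0 false N N≢0
    walks-false N N≢0 (suc n) = trans (walks-false-suc N n N≢0) (∑-cong (term-false N n))

    -- Either row 0 is empty, which ends the walk at once, or a first step leaves 0 in the state
    -- `false`.
    G-split : G ≗ G′ ∔ 1ℤ ∙ X 1
    G-split zero    = trans (gf-walks 0) (trans (walks-tail 0) (sym (ℤ.+-identityʳ (G′ 0))))
    G-split (suc n) = trans (gf-walks (suc n)) (trans (walks-zero-suc n)
      (cong (ℤ._+_ (G′ (suc n))) (trans (∑-cong (term-false zero n)) (sym (ℤ.*-identityˡ (X 1 (suc n)))))))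

    -- The two sums differ in the letter `M` alone, and its two contributions are multiples of
    -- `X (suc M)` and `X M` again.
    X-link : ∀ (i : Fin R) → let M = suc (toℕ i) in D (wd M) (X (suc M)) ≗ D (we M) (X M)
    X-link i zero    = refl
    X-link i (suc n) = begin
      X (suc M) (suc n) ℤ.- wd M ℤ.* X (suc M) n
        ≡⟨ cong₂ (λ p q → p ℤ.- wd M ℤ.* q) (∑-changeAt {f = term (suc M) n} {term M n} N (a ℤ.- b) at other)
             (sym (walks-false N (λ ()) n)) ⟩
      a ℤ.- b ℤ.+ X M (suc n) ℤ.- a
        ≡⟨ cancel a b (X M (suc n)) ⟩
      X M (suc n) ℤ.- b
        ≡⟨ cong (λ p → X M (suc n) ℤ.- we M ℤ.* p) (walks-true N (λ ()) n) ⟩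
      X M (suc n) ℤ.- we M ℤ.* X M n ∎
      where
      open ≡-Reasoning
      N = suc i
      M = suc (toℕ i)
      a = wd M ℤ.* walks false N n
      b = we M ℤ.* walks true N n
      cancel : ∀ a b x → a ℤ.- b ℤ.+ x ℤ.- a ≡ x ℤ.- b
      cancel = solve-∀
      restore : ∀ a b → a ≡ a ℤ.- b ℤ.+ b
      restore = solve-∀
      at : term (suc M) n N ≡ a ℤ.- b ℤ.+ term M n N
      at = trans (cong (λ c → entry (not c) n N) (dec-true (M ℕ.<? suc M) ℕ.≤-refl))
        (trans (restore a b) (cong (λ c → a ℤ.- b ℤ.+ entry (not c) n N) (sym (dec-false (M ℕ.<? M) (ℕ.<-irrefl refl)))))
      other : ∀ c → c ≢ N → term (suc M) n c ≡ term M n c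
      other c c≢N = cong (λ d → entry (not d) n c) (<?-suc (c≢N ∘ Fin.toℕ-injective))

    module _ (we-suc : ∀ i → we (suc i) ≡ y ℤ.* wd i) where

      -- By `we-suc`, apart from the letter 0, the sum for `X 1` is `y` times the sum for
      -- `X (suc R)` with its index shifted by one. Only the end terms differ, and the lower one is
      -- known from `X 1 = G - G′`.
      X-ends : ∀ n → X 1 (suc n) ≡
        wd 0 ℤ.* G n ℤ.+ y ℤ.* (X (suc R) (suc n) ℤ.- wd 0 ℤ.* G′ n ℤ.- wd R ℤ.* X (suc R) n)
      X-ends n = begin
        wd 0 ℤ.* walks false zero n ℤ.+ ∑ (λ i → we (suc (toℕ i)) ℤ.* walks true (suc i) n)
          ≡⟨ cong₂ (λ g s → wd 0 ℤ.* g ℤ.+ s) (sym (gf-walks n)) (trans (∑-cong first) (sym (*-distribˡ-∑ {R} y (Y ∘ toℕ)))) ⟩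
        wd 0 ℤ.* G n ℤ.+ y ℤ.* s
          ≡⟨ cong (λ z → wd 0 ℤ.* G n ℤ.+ y ℤ.* z) (begin
            s ≡⟨ add s (Y R) ⟩
            s ℤ.+ Y R ℤ.- Y R ≡⟨ cong (ℤ._- Y R) (∑-shift R Y) ⟩
            wd 0 ℤ.* X 1 n ℤ.+ s′ ℤ.- Y R ≡⟨ rearrange (wd 0) (X 1 n) (G′ n) s′ (Y R) ⟩
            wd 0 ℤ.* (G′ n ℤ.+ 1ℤ ℤ.* X 1 n) ℤ.+ s′ ℤ.- wd 0 ℤ.* G′ n ℤ.- Y R
              ≡⟨ cong (λ g → wd 0 ℤ.* g ℤ.+ s′ ℤ.- wd 0 ℤ.* G′ n ℤ.- Y R) (trans (sym (G-split n)) (gf-walks n)) ⟩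
            wd 0 ℤ.* walks false zero n ℤ.+ s′ ℤ.- wd 0 ℤ.* G′ n ℤ.- Y R
              ≡⟨ cong (λ z → wd 0 ℤ.* walks false zero n ℤ.+ z ℤ.- wd 0 ℤ.* G′ n ℤ.- Y R) (∑-cong last) ⟨
            X (suc R) (suc n) ℤ.- wd 0 ℤ.* G′ n ℤ.- Y R ∎) ⟩
        wd 0 ℤ.* G n ℤ.+ y ℤ.* (X (suc R) (suc n) ℤ.- wd 0 ℤ.* G′ n ℤ.- Y R) ∎
        where
        open ≡-Reasoning
        Y : ℕ → ℤ
        Y i = wd i ℤ.* X (suc i) n
        s  = ∑ {R} (Y ∘ toℕ)
        s′ = ∑ {R} (Y ∘ suc ∘ toℕ)
        first : ∀ (i : Fin R) → we (suc (toℕ i)) ℤ.* walks true (suc i) n ≡ y ℤ.* Y (toℕ i)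
        first i = trans (cong₂ ℤ._*_ (we-suc (toℕ i)) (walks-true (suc i) (λ ()) n)) (ℤ.*-assoc y (wd (toℕ i)) _)
        last : ∀ (i : Fin R) → term (suc R) n (suc i) ≡ Y (suc (toℕ i))
        last i = trans (cong (λ c → entry (not c) n (suc i)) (dec-true (suc (toℕ i) ℕ.<? suc R) (s≤s (Fin.toℕ<n i))))
          (cong (wd (suc (toℕ i)) ℤ.*_) (walks-false (suc i) (λ ()) n))
        add : ∀ p q → p ≡ p ℤ.+ q ℤ.- q
        add = solve-∀
        rearrange : ∀ w x g s z → w ℤ.* x ℤ.+ s ℤ.- z ≡ w ℤ.* (g ℤ.+ 1ℤ ℤ.* x) ℤ.+ s ℤ.- w ℤ.* g ℤ.- z
        rearrange = solve-∀

      G-recurrence : D (wd 0) G ≗ D (y ℤ.* wd 0) G′ ∔ y ∙ D (wd R) (X (suc R))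
      G-recurrence zero    = trans (G-split 0) (cong (ℤ._+_ (G′ 0)) (sym (ℤ.*-zeroʳ y)))
      G-recurrence (suc n) = trans
        (cong (ℤ._- wd 0 ℤ.* G n) (trans (G-split (suc n)) (cong (λ x → G′ (suc n) ℤ.+ 1ℤ ℤ.* x) (X-ends n))))
        (rearrange y (wd 0) (wd R) (G n) (G′ n) (G′ (suc n)) (X (suc R) n) (X (suc R) (suc n)))
        where
        rearrange : ∀ y w v g g′ g″ x x′ →
          g″ ℤ.+ 1ℤ ℤ.* (w ℤ.* g ℤ.+ y ℤ.* (x′ ℤ.- w ℤ.* g′ ℤ.- v ℤ.* x)) ℤ.- w ℤ.* g ≡
          g″ ℤ.- y ℤ.* w ℤ.* g′ ℤ.+ y ℤ.* (x′ ℤ.- v ℤ.* x)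
        rearrange = solve-∀

      X-chain : D∏ (wd ∘ suc) R (X (suc R)) ≗ D∏ (λ i → y ℤ.* wd i) R (X 1)
      X-chain = D∏-chain (wd ∘ suc) (λ i → y ℤ.* wd i) R (X ∘ suc) λ i i<R n →
        trans (subst (λ j → D (wd (suc j)) (X (suc (suc j))) n ≡ D (we (suc j)) (X (suc j)) n)
                (Fin.toℕ-fromℕ< i<R) (X-link (Fin.fromℕ< i<R) n))
              (cong (λ z → D z (X (suc i)) n) (we-suc i))

  -- With w i for `wd i` and products over i < R, the generating function is (1 - y) ∏ (1 - y w i u)
  -- divided by (1 - w R u) (∏ (1 - w i u) - y ∏ (1 - y w i u)). In the induction both products
  -- bring out the same multiple of `X 1`; it cancels, and what is left is 1 - y w 0 u times the
  -- expression for the alphabet without its smallest letter.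
  tables-recurrence : ∀ wd we R → (∀ i → we (suc i) ≡ y ℤ.* wd i) →
    let G = tables wd we (suc R) in
    D (wd R) (D∏ wd R G ∔ ℤ.- y ∙ D∏ (λ i → y ℤ.* wd i) R G) ≗ (λ n → (1ℤ ℤ.- y) ℤ.* D∏ (λ i → y ℤ.* wd i) R ε n)
  tables-recurrence wd we zero we-suc n = begin
    D (wd 0) (g ∔ ℤ.- y ∙ g) n ≡⟨ D-cong (wd 0) {g ∔ ℤ.- y ∙ g} (λ m → factor y (g m)) n ⟩
    D (wd 0) (λ n → (1ℤ ℤ.- y) ℤ.* g n) n ≡⟨ D-scale (wd 0) (1ℤ ℤ.- y) g n ⟩
    (1ℤ ℤ.- y) ℤ.* D (wd 0) g n ≡⟨ cong ((1ℤ ℤ.- y) ℤ.*_) (Dg≗ε n) ⟩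
    (1ℤ ℤ.- y) ℤ.* ε n ∎
    where
    open ≡-Reasoning
    g = tables wd we 1
    factor : ∀ y g → g ℤ.+ ℤ.- y ℤ.* g ≡ (1ℤ ℤ.- y) ℤ.* g
    factor = solve-∀
    cancel : ∀ a b → 0ℤ ℤ.+ 1ℤ ℤ.* (a ℤ.+ 0ℤ) ℤ.- a ≡ 0ℤ
    cancel = solve-∀
    Dg≗ε : D (wd 0) g ≗ ε
    Dg≗ε zero    = refl
    Dg≗ε (suc n) = trans
      (cong (ℤ._- wd 0 ℤ.* g n) (trans (G-split wd we 0 (suc n))
        (cong (λ z → 0ℤ ℤ.+ 1ℤ ℤ.* (wd 0 ℤ.* z ℤ.+ 0ℤ)) (sym (Walk.gf-walks {0} (wd ∘ toℕ) (we ∘ toℕ) n)))))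
      (cancel (wd 0 ℤ.* g n) 0ℤ)
  tables-recurrence wd we (suc R) we-suc n = begin
    D (wd (suc R)) (D∏ wd (suc R) g ∔ ℤ.- y ∙ D∏ v (suc R) g) n
      ≡⟨ D-cong (wd (suc R)) {D∏ wd (suc R) g ∔ ℤ.- y ∙ D∏ v (suc R) g} peel n ⟩
    D (wd (suc R)) (D (v 0) rest) n
      ≡⟨ D-comm (wd (suc R)) (v 0) rest n ⟩
    D (v 0) (D (wd (suc R)) rest) n
      ≡⟨ D-cong (v 0) (tables-recurrence (wd ∘ suc) (we ∘ suc) R (we-suc ∘ suc)) n ⟩
    D (v 0) (λ n → (1ℤ ℤ.- y) ℤ.* D∏ (v ∘ suc) R ε n) n
      ≡⟨ D-scale (v 0) (1ℤ ℤ.- y) (D∏ (v ∘ suc) R ε) n ⟩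
    (1ℤ ℤ.- y) ℤ.* D∏ v (suc R) ε n ∎
    where
    open ≡-Reasoning
    v = λ i → y ℤ.* wd i
    w′ = wd ∘ suc
    g = tables wd we (suc (suc R))
    g′ = tables (wd ∘ suc) (we ∘ suc) (suc R)
    x₁ = X wd we (suc R) 1
    xᴬ = X wd we (suc R) (suc (suc R))
    rest = D∏ w′ R g′ ∔ ℤ.- y ∙ D∏ (v ∘ suc) R g′
    -- `X-chain` trades the last unknown `xᴬ` for the first one `x₁`, which also occurs in `D∏vg`.
    D∏g : D∏ wd (suc R) g ≗ D (v 0) (D∏ w′ R g′) ∔ y ∙ D∏ v (suc R) x₁
    D∏g n = begin
      D (wd 0) (D∏ w′ R g) n ≡⟨ D∏-D w′ R (wd 0) g n ⟨
      D∏ w′ R (D (wd 0) g) n ≡⟨ D∏-cong w′ R (G-recurrence wd we (suc R) we-suc) n ⟩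
      D∏ w′ R (D (v 0) g′ ∔ y ∙ D (w′ R) xᴬ) n ≡⟨ D∏-lin w′ R (D (v 0) g′) y (D (w′ R) xᴬ) n ⟩
      (D∏ w′ R (D (v 0) g′) ∔ y ∙ D∏ w′ R (D (w′ R) xᴬ)) n ≡⟨ lin-cong y (D∏-D w′ R (v 0) g′)
                                                                       (λ m → trans (sym (D∏-last w′ R xᴬ m)) (X-chain wd we (suc R) we-suc m)) n ⟩
      (D (v 0) (D∏ w′ R g′) ∔ y ∙ D∏ v (suc R) x₁) n ∎
    D∏vg : D∏ v (suc R) g ≗ D (v 0) (D∏ (v ∘ suc) R g′) ∔ 1ℤ ∙ D∏ v (suc R) x₁
    D∏vg n = trans (D∏-cong v (suc R) (G-split wd we (suc R)) n) (D∏-lin v (suc R) g′ 1ℤ x₁ n)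
    collect : ∀ y p q x → p ℤ.+ y ℤ.* x ℤ.+ ℤ.- y ℤ.* (q ℤ.+ 1ℤ ℤ.* x) ≡ p ℤ.+ ℤ.- y ℤ.* q
    collect = solve-∀
    peel : D∏ wd (suc R) g ∔ ℤ.- y ∙ D∏ v (suc R) g ≗ D (v 0) rest
    peel n = begin
      D∏ wd (suc R) g n ℤ.+ ℤ.- y ℤ.* D∏ v (suc R) g n
        ≡⟨ cong₂ (λ p q → p ℤ.+ ℤ.- y ℤ.* q) (D∏g n) (D∏vg n) ⟩
      D (v 0) (D∏ w′ R g′) n ℤ.+ y ℤ.* D∏ v (suc R) x₁ n ℤ.+
        ℤ.- y ℤ.* (D (v 0) (D∏ (v ∘ suc) R g′) n ℤ.+ 1ℤ ℤ.* D∏ v (suc R) x₁ n)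
        ≡⟨ collect y (D (v 0) (D∏ w′ R g′) n) (D (v 0) (D∏ (v ∘ suc) R g′) n) (D∏ v (suc R) x₁ n) ⟩
      D (v 0) (D∏ w′ R g′) n ℤ.+ ℤ.- y ℤ.* D (v 0) (D∏ (v ∘ suc) R g′) n
        ≡⟨ D-lin (v 0) (D∏ w′ R g′) (ℤ.- y) (D∏ (v ∘ suc) R g′) n ⟨
      D (v 0) rest n ∎

-- Words as balanced tables

∑ʷ : (A n : ℕ) → (List (Fin A) → ℤ) → ℤ
∑ʷ A zero    F = F []
∑ʷ A (suc n) F = ∑ (λ b → ∑ʷ A n (λ a → F (b ∷ a)))

-- The sum over the compositions of n into m parts, zero parts allowed.
∑ᶜ : (m n : ℕ) → (Vec ℕ m → ℤ) → ℤ
∑ᶜ zero    zero    F = F []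
∑ᶜ zero    (suc n) F = 0ℤ
∑ᶜ (suc m) zero    F = ∑ᶜ m zero (λ ρ → F (0 ∷ ρ))
∑ᶜ (suc m) (suc n) F = ∑ᶜ m (suc n) (λ ρ → F (0 ∷ ρ)) ℤ.+ ∑ᶜ (suc m) n (λ ρ → F (updateAt ρ zero suc))

∑ᶜ-cong : ∀ m n {F G : Vec ℕ m → ℤ} → (∀ ρ → F ρ ≡ G ρ) → ∑ᶜ m n F ≡ ∑ᶜ m n G
∑ᶜ-cong zero    zero    eq = eq []
∑ᶜ-cong zero    (suc n) eq = refl
∑ᶜ-cong (suc m) zero    eq = ∑ᶜ-cong m zero (λ ρ → eq (0 ∷ ρ))
∑ᶜ-cong (suc m) (suc n) eq = cong₂ ℤ._+_ (∑ᶜ-cong m (suc n) (λ ρ → eq (0 ∷ ρ)))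
  (∑ᶜ-cong (suc m) n (λ ρ → eq (updateAt ρ zero suc)))

∑ᶜ-zero : ∀ m n → ∑ᶜ m n (λ _ → 0ℤ) ≡ 0ℤ
∑ᶜ-zero zero    zero    = refl
∑ᶜ-zero zero    (suc n) = refl
∑ᶜ-zero (suc m) zero    = ∑ᶜ-zero m zero
∑ᶜ-zero (suc m) (suc n) = cong₂ ℤ._+_ (∑ᶜ-zero m (suc n)) (∑ᶜ-zero (suc m) n)

∑ᶜ-+ : ∀ m n (F G : Vec ℕ m → ℤ) → ∑ᶜ m n (λ ρ → F ρ ℤ.+ G ρ) ≡ ∑ᶜ m n F ℤ.+ ∑ᶜ m n G
∑ᶜ-+ zero    zero    F G = refl
∑ᶜ-+ zero    (suc n) F G = refl
∑ᶜ-+ (suc m) zero    F G = ∑ᶜ-+ m zero (λ ρ → F (0 ∷ ρ)) (λ ρ → G (0 ∷ ρ))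
∑ᶜ-+ (suc m) (suc n) F G = trans
  (cong₂ ℤ._+_ (∑ᶜ-+ m (suc n) (λ ρ → F (0 ∷ ρ)) (λ ρ → G (0 ∷ ρ)))
               (∑ᶜ-+ (suc m) n (λ ρ → F (updateAt ρ zero suc)) (λ ρ → G (updateAt ρ zero suc))))
  (interchange (∑ᶜ m (suc n) (λ ρ → F (0 ∷ ρ))) (∑ᶜ m (suc n) (λ ρ → G (0 ∷ ρ)))
    (∑ᶜ (suc m) n (λ ρ → F (updateAt ρ zero suc))) (∑ᶜ (suc m) n (λ ρ → G (updateAt ρ zero suc))))
  where
  interchange : ∀ p q r s → p ℤ.+ q ℤ.+ (r ℤ.+ s) ≡ p ℤ.+ r ℤ.+ (q ℤ.+ s)
  interchange = solve-∀

∑ᶜ-* : ∀ m n (F : Vec ℕ m → ℤ) k → ∑ᶜ m n (λ ρ → F ρ ℤ.* k) ≡ ∑ᶜ m n F ℤ.* k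
∑ᶜ-* zero    zero    F k = refl
∑ᶜ-* zero    (suc n) F k = sym (ℤ.*-zeroˡ k)
∑ᶜ-* (suc m) zero    F k = ∑ᶜ-* m zero (λ ρ → F (0 ∷ ρ)) k
∑ᶜ-* (suc m) (suc n) F k = trans
  (cong₂ ℤ._+_ (∑ᶜ-* m (suc n) (λ ρ → F (0 ∷ ρ)) k) (∑ᶜ-* (suc m) n (λ ρ → F (updateAt ρ zero suc)) k))
  (sym (ℤ.*-distribʳ-+ k (∑ᶜ m (suc n) (λ ρ → F (0 ∷ ρ))) (∑ᶜ (suc m) n (λ ρ → F (updateAt ρ zero suc)))))

∑ᶜ-∑ : ∀ m n {A} (f : Vec ℕ m → Fin A → ℤ) → ∑ᶜ m n (λ ρ → ∑ (f ρ)) ≡ ∑ (λ b → ∑ᶜ m n (λ ρ → f ρ b))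
∑ᶜ-∑ m n {zero}  f = ∑ᶜ-zero m n
∑ᶜ-∑ m n {suc A} f = trans (∑ᶜ-+ m n (λ ρ → f ρ zero) (λ ρ → ∑ (f ρ ∘ suc)))
  (cong (ℤ._+_ (∑ᶜ m n (λ ρ → f ρ zero))) (∑ᶜ-∑ m n (λ ρ → f ρ ∘ suc)))

-- Makes the balanced cutting of a word unique: its row lengths are forced to be the letter counts.
∑ᶜ-δ : ∀ m n (κ : Fin m → ℕ) → ∑ᶜ m n (λ ρ → ∏ (λ x → δ (κ x) (lookup ρ x))) ≡ δ (∑ⁿ κ) n
∑ᶜ-δ-suc : ∀ m n k (κ : Fin m → ℕ) →
  ∑ᶜ (suc m) n (λ ρ → δ k (lookup ρ zero) ℤ.* ∏ (λ x → δ (κ x) (lookup ρ (suc x)))) ≡ δ (k + ∑ⁿ κ) n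

∑ᶜ-δ zero    zero    κ = refl
∑ᶜ-δ zero    (suc n) κ = refl
∑ᶜ-δ (suc m) n       κ = ∑ᶜ-δ-suc m n (κ zero) (κ ∘ suc)

∑ᶜ-δ-suc m zero    zero    κ = trans
  (∑ᶜ-cong m zero (λ ρ → ℤ.*-identityˡ (∏ (λ x → δ (κ x) (lookup ρ x)))))
  (∑ᶜ-δ m zero κ)
∑ᶜ-δ-suc m zero    (suc k) κ = trans
  (∑ᶜ-cong m zero (λ ρ → ℤ.*-zeroˡ (∏ (λ x → δ (κ x) (lookup ρ x)))))
  (∑ᶜ-zero m zero)
∑ᶜ-δ-suc m (suc n) zero    κ = trans (cong₂ ℤ._+_
  (trans (∑ᶜ-cong m (suc n) (λ ρ → ℤ.*-identityˡ (∏ (λ x → δ (κ x) (lookup ρ x))))) (∑ᶜ-δ m (suc n) κ))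
  (trans (∑ᶜ-cong (suc m) n {G = λ _ → 0ℤ} (λ { (i ∷ ρ) → ℤ.*-zeroˡ (∏ (λ x → δ (κ x) (lookup ρ x))) }))
    (∑ᶜ-zero (suc m) n)))
  (ℤ.+-identityʳ _)
∑ᶜ-δ-suc m (suc n) (suc k) κ = trans (cong₂ ℤ._+_
  (trans (∑ᶜ-cong m (suc n) (λ ρ → ℤ.*-zeroˡ (∏ (λ x → δ (κ x) (lookup ρ x))))) (∑ᶜ-zero m (suc n)))
  (trans (∑ᶜ-cong (suc m) n {G = λ ρ → δ k (lookup ρ zero) ℤ.* ∏ (λ x → δ (κ x) (lookup ρ (suc x)))}
    (λ { (i ∷ ρ) → refl }))
    (∑ᶜ-δ-suc m n k κ)))
  (ℤ.+-identityˡ _)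

-- Rows of larger letters come first, since the sorted rearrangement is decreasing.
flatten : ∀ {A m} → Table A m → List (Fin A)
flatten []        = []
flatten (row ∷ T) = flatten T ++ row

module _ {A : ℕ} where

  ∑ʷ-cong : ∀ n {F G : List (Fin A) → ℤ} → (∀ a → length a ≡ n → F a ≡ G a) → ∑ʷ A n F ≡ ∑ʷ A n G
  ∑ʷ-cong zero    eq = eq [] refl
  ∑ʷ-cong (suc n) eq = ∑-cong (λ b → ∑ʷ-cong n (λ a len → eq (b ∷ a) (cong suc len)))

  ∑ʷ-back : ∀ n (F : List (Fin A) → ℤ) → ∑ʷ A (suc n) F ≡ ∑ (λ b → ∑ʷ A n (λ a → F (a ∷ʳ b)))
  ∑ʷ-back zero    F = refl
  ∑ʷ-back (suc n) F = trans
    (∑-cong (λ c → ∑ʷ-back n (λ a → F (c ∷ a))))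
    (∑-comm (λ c b → ∑ʷ A n (λ a → F (c ∷ a ∷ʳ b))))

  ∑ᶜ-∑ʷ : ∀ m k n (f : Vec ℕ m → List (Fin A) → ℤ) →
          ∑ᶜ m k (λ ρ → ∑ʷ A n (f ρ)) ≡ ∑ʷ A n (λ a → ∑ᶜ m k (λ ρ → f ρ a))
  ∑ᶜ-∑ʷ m k zero    f = refl
  ∑ᶜ-∑ʷ m k (suc n) f = trans (∑ᶜ-∑ m k (λ ρ b → ∑ʷ A n (λ a → f ρ (b ∷ a))))
    (∑-cong (λ b → ∑ᶜ-∑ʷ m k n (λ ρ a → f ρ (b ∷ a))))

  -- A table is a word together with a composition of its length. The head row ends the flattened
  -- word, so both sides are peeled from the back.
  ∑ᵗ-flatten : ∀ m n (F : Vec ℕ m → List (Fin A) → ℤ) →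
    ∑ᵗ A m n (λ T → F (Vec.map length T) (flatten T)) ≡ ∑ᶜ m n (λ ρ → ∑ʷ A n (F ρ))
  ∑ᵗ-flatten zero    zero    F = refl
  ∑ᵗ-flatten zero    (suc n) F = refl
  ∑ᵗ-flatten (suc m) zero    F = trans
    (∑ᵗ-cong m zero (λ T → cong (F (0 ∷ Vec.map length T)) (List.++-identityʳ (flatten T))))
    (∑ᵗ-flatten m zero (λ ρ → F (0 ∷ ρ)))
  ∑ᵗ-flatten (suc m) (suc n) F = trans
    (headPull-back m n (λ T → F (Vec.map length T) (flatten T)))
    (cong₂ ℤ._+_
      (trans (∑ᵗ-cong m (suc n) (λ T → cong (F (0 ∷ Vec.map length T)) (List.++-identityʳ (flatten T))))
             (∑ᵗ-flatten m (suc n) (λ ρ → F (0 ∷ ρ))))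
      (begin
        ∑ (λ b → ∑ᵗ A (suc m) n (λ T → F (Vec.map length (updateAt T zero (_∷ʳ b))) (flatten (updateAt T zero (_∷ʳ b)))))
          ≡⟨ ∑-cong (λ b → ∑ᵗ-cong (suc m) n
               {λ T → F (Vec.map length (updateAt T zero (_∷ʳ b))) (flatten (updateAt T zero (_∷ʳ b)))}
               {λ T → F (updateAt (Vec.map length T) zero suc) (flatten T ∷ʳ b)}
               (λ { (row ∷ T) → cong₂ (λ l a → F (l ∷ Vec.map length T) a) (length-∷ʳ row b)
                    (sym (List.++-assoc (flatten T) row (b ∷ []))) })) ⟩
        ∑ (λ b → ∑ᵗ A (suc m) n (λ T → F (updateAt (Vec.map length T) zero suc) (flatten T ∷ʳ b)))
          ≡⟨ ∑-cong (λ b → ∑ᵗ-flatten (suc m) n (λ ρ a → F (updateAt ρ zero suc) (a ∷ʳ b))) ⟩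
        ∑ (λ b → ∑ᶜ (suc m) n (λ ρ → ∑ʷ A n (λ a → F (updateAt ρ zero suc) (a ∷ʳ b))))
          ≡⟨ ∑ᶜ-∑ (suc m) n (λ ρ b → ∑ʷ A n (λ a → F (updateAt ρ zero suc) (a ∷ʳ b))) ⟨
        ∑ᶜ (suc m) n (λ ρ → ∑ (λ b → ∑ʷ A n (λ a → F (updateAt ρ zero suc) (a ∷ʳ b))))
          ≡⟨ ∑ᶜ-cong (suc m) n (λ ρ → sym (∑ʷ-back n (F (updateAt ρ zero suc)))) ⟩
        ∑ᶜ (suc m) n (λ ρ → ∑ʷ A (suc n) (F (updateAt ρ zero suc))) ∎))
    where open ≡-Reasoning

  ∑-count : ∀ (a : List (Fin A)) → ∑ⁿ (λ x → count x a) ≡ length a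
  ∑-count []      = ∑ⁿ-zero A
  ∑-count (b ∷ a) = trans (∑ⁿ-changeAt b 1 (cong (_+ count b a) (e-refl b)) (λ x x≢b → cong (_+ count x a) (e-≢ x≢b)))
    (cong suc (∑-count a))

  count-++ : ∀ (x : Fin A) as bs → count x (as ++ bs) ≡ count x as + count x bs
  count-++ x []       bs = refl
  count-++ x (a ∷ as) bs = trans (cong (e x a +_) (count-++ x as bs)) (sym (ℕ.+-assoc (e x a) _ _))

  flatAbove : ∀ {m} → Table A m → Fin m → List (Fin A)
  flatAbove (row ∷ T) zero    = flatten T
  flatAbove (row ∷ T) (suc x) = flatAbove T x

  module Additive (f : List (Fin A) → ℕ) (f-[] : f [] ≡ 0) (f-++ : ∀ as bs → f (as ++ bs) ≡ f as + f bs) where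

    f-flatten : ∀ {m} (T : Table A m) → ∑ⁿ (λ y → f (lookup T y)) ≡ f (flatten T)
    f-flatten []        = sym f-[]
    f-flatten (row ∷ T) = trans (ℕ.+-comm (f row) _) (trans (cong (_+ f row) (f-flatten T)) (sym (f-++ (flatten T) row)))

    f-flatAbove : ∀ {m} (T : Table A m) x →
      ∑ⁿ (λ y → if does (toℕ x ℕ.<? toℕ y) then f (lookup T y) else 0) ≡ f (flatAbove T x)
    f-flatAbove (row ∷ T) zero    = f-flatten T
    f-flatAbove (row ∷ T) (suc x) = f-flatAbove T x

    f-flatAbove-≤ : ∀ {m} (T : Table A m) x → f (flatAbove T x) + f (lookup T x) ≤ f (flatten T)
    f-flatAbove-≤ (row ∷ T) zero    = ℕ.≤-reflexive (sym (f-++ (flatten T) row))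
    f-flatAbove-≤ (row ∷ T) (suc x) = ℕ.≤-trans (f-flatAbove-≤ T x)
      (ℕ.≤-trans (ℕ.m≤m+n (f (flatten T)) (f row)) (ℕ.≤-reflexive (sym (f-++ (flatten T) row))))

  module Count (x : Fin A) = Additive (count x) refl (count-++ x)
  module Length = Additive length refl (λ as bs → List.length-++ as)

  -- The place, counted from 0, at which the block of `x` begins in the sorted word.
  above : List (Fin A) → Fin A → ℕ
  above a x = ∑ⁿ (λ y → if does (x ≺? y) then count y a else 0)

  above-antitone : ∀ a (x y : Fin A) → toℕ x < toℕ y → above a y + count y a ≤ above a x
  above-antitone a x y x<y = subst (_≤ above a x)
    (trans (∑ⁿ-changeAt {f = λ z → (if does (y Fin.≟ z) then count y a else 0) + above-y z} {above-y} y (count y a)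
        (cong (λ c → (if c then count y a else 0) + above-y y) (dec-true (y Fin.≟ y) refl))
        (λ z z≢y → cong (λ c → (if c then count y a else 0) + above-y z) (dec-false (y Fin.≟ z) (z≢y ∘ sym))))
      (ℕ.+-comm (count y a) _))
    (∑ⁿ-mono le)
    where
    above-y : Fin A → ℕ
    above-y z = if does (y ≺? z) then count z a else 0
    le : ∀ z → (if does (y Fin.≟ z) then count y a else 0) + above-y z ≤ (if does (x ≺? z) then count z a else 0)
    le z with y Fin.≟ z
    ... | yes refl rewrite dec-false (y ≺? y) (ℕ.<-irrefl refl) | dec-true (x ≺? y) x<y = ℕ.≤-reflexive (ℕ.+-identityʳ _)
    ... | no  _ with y ≺? z
    ...   | yes y<z rewrite dec-true (y ≺? z) y<z | dec-true (x ≺? z) (ℕ.<-trans x<y y<z) = ℕ.≤-refl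
    ...   | no  y≮z rewrite dec-false (y ≺? z) y≮z = z≤n

module WordWeight {A : ℕ} (wd we : Fin A → ℤ) where

  open Weights wd we

  -- s b + count b P is the rank (from the top, ties broken from left to right) of
  -- an entry b preceded by the entries P.
  scan : (Fin A → ℕ) → List (Fin A) → List (Fin A) → ℤ
  scan s P []       = 1ℤ
  scan s P (b ∷ bs) = weight (does (s b + count b P ℕ.<? length P)) b ℤ.* scan s (P ∷ʳ b) bs

  wordWeight : List (Fin A) → ℤ
  wordWeight a = scan (above a) [] a

  scan-++ : ∀ s P as bs → scan s P (as ++ bs) ≡ scan s P as ℤ.* scan s (P ++ as) bs
  scan-++ s P []       bs = trans (cong (λ Q → scan s Q bs) (sym (List.++-identityʳ P))) (sym (ℤ.*-identityˡ _))
  scan-++ s P (a ∷ as) bs = trans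
    (cong (w ℤ.*_) (trans (scan-++ s (P ∷ʳ a) as bs)
      (cong (λ Q → scan s (P ∷ʳ a) as ℤ.* scan s Q bs) (List.++-assoc P (a ∷ []) as))))
    (sym (ℤ.*-assoc w (scan s (P ∷ʳ a) as) (scan s (P ++ a ∷ as) bs)))
    where w = weight (does (s a + count a P ℕ.<? length P)) a

  scan-flatten : ∀ s {m} (T : Table A m) →
                 scan s [] (flatten T) ≡ ∏ (λ x → scan s (flatAbove T x) (lookup T x))
  scan-flatten s []        = refl
  scan-flatten s (row ∷ T) = trans (scan-++ s [] (flatten T) row)
    (trans (ℤ.*-comm (scan s [] (flatten T)) (scan s (flatten T) row))
      (cong (scan s (flatten T) row ℤ.*_) (scan-flatten s T)))

  module _ (a : List (Fin A)) (x : Fin A) (d : ℕ) where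

    private s = above a

    does-cong : ∀ {p q} {P : Set p} {Q : Set q} (P? : Dec P) (Q? : Dec Q) → (P → Q) → (Q → P) → does P? ≡ does Q?
    does-cong (yes p) Q? P→Q Q→P = sym (dec-true Q? (P→Q p))
    does-cong (no ¬p) Q? P→Q Q→P = sym (dec-false Q? (¬p ∘ Q→P))

    -- u counts the loops among the entries of row x scanned so far.
    scan-row : ∀ P bs D u → length P ≡ s x + (D + u) → count x P ≡ d + u →
      D + u + length bs ≡ count x a → (∀ b → count b P + count b bs ≤ count b a) →
      scan s P bs ≡ rowWeight x d D bs
    scan-row P []       D u lenP cntP rest fits = refl
    scan-row P (b ∷ bs) D u lenP cntP rest fits = cong₂ ℤ._*_
      (cong (λ ex → weight ex b) isExc-b) step
      where
      fits′ : ∀ c → count c (P ∷ʳ b) + count c bs ≤ count c a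
      fits′ c = ℕ.≤-trans (ℕ.≤-reflexive (trans (cong (_+ count c bs) (trans (count-∷ʳ c P b) (ℕ.+-comm (e c b) _)))
        (ℕ.+-assoc (count c P) (e c b) (count c bs)))) (fits c)
      len+ : length (P ∷ʳ b) ≡ suc (s x + (D + u))
      len+ = trans (length-∷ʳ P b) (cong suc lenP)
      step : scan s (P ∷ʳ b) bs ≡ rowWeight x d (next x D b) bs
      step with x Fin.≟ b
      ... | yes refl = scan-row (P ∷ʳ b) bs D (suc u)
              (trans len+ (trans (sym (ℕ.+-suc (s x) (D + u))) (cong (s x +_) (sym (ℕ.+-suc D u)))))
              (trans (count-∷ʳ x P x) (trans (cong₂ _+_ (e-refl x) cntP) (sym (ℕ.+-suc d u))))
              (trans (cong (_+ length bs) (ℕ.+-suc D u)) (trans (sym (ℕ.+-suc (D + u) (length bs))) rest))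
              fits′
      ... | no  x≢b = scan-row (P ∷ʳ b) bs (suc D) u
              (trans len+ (sym (ℕ.+-suc (s x) (D + u))))
              (trans (count-∷ʳ x P b) (trans (cong (_+ count x P) (e-≢ x≢b)) cntP))
              (trans (sym (ℕ.+-suc (D + u) (length bs))) rest)
              fits′
      countP<count : suc (count b P) ≤ count b a
      countP<count = ℕ.≤-trans (ℕ.≤-reflexive (ℕ.+-comm 1 (count b P)))
        (ℕ.≤-trans (ℕ.+-monoʳ-≤ (count b P) (ℕ.≤-trans (ℕ.≤-reflexive (sym (e-refl b))) (ℕ.m≤m+n (e b b) (count b bs)))) (fits b))
      isExc-b : does (s b + count b P ℕ.<? length P) ≡ isExc x d D b
      isExc-b with x Fin.≟ b
      -- Rank and position are `s x + (d + u)` and `s x + (D + u)`, which leaves the comparison of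
      -- `d` with `D`.
      ... | yes refl = does-cong (s x + count x P ℕ.<? length P) (d ℕ.<? D)
              (λ lt → ℕ.+-cancelʳ-< u d D (ℕ.+-cancelˡ-< (s x) (d + u) (D + u) (subst₂ (λ p q → s x + p < q) cntP lenP lt)))
              (λ lt → subst₂ (λ p q → s x + p < q) (sym cntP) (sym lenP) (ℕ.+-monoʳ-< (s x) (ℕ.+-monoˡ-< u lt)))
      ... | no  x≢b with ℕ.<-cmp (toℕ x) (toℕ b)
      -- The rank of `b` lies within the block of `b`, because `fits` leaves room for this entry,
      -- and that block ends before the block of `x` begins.
      ...   | tri< x<b _ _ = trans
                (dec-true (s b + count b P ℕ.<? length P) (begin-strict
                  s b + count b P <⟨ ℕ.+-monoʳ-< (s b) countP<count ⟩
                  s b + count b a ≤⟨ above-antitone a x b x<b ⟩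
                  s x ≤⟨ ℕ.m≤m+n (s x) (D + u) ⟩
                  s x + (D + u) ≡⟨ lenP ⟨
                  length P ∎))
                (sym (dec-true (x ≺? b) x<b))
        where open ℕ.≤-Reasoning
      ...   | tri≈ _ x≡b _ = contradiction (Fin.toℕ-injective x≡b) x≢b
      ...   | tri> ¬x<b _ b<x = trans
                (dec-false (s b + count b P ℕ.<? length P) (ℕ.≤⇒≯ (begin
                  length P ≡⟨ lenP ⟩
                  s x + (D + u) ≤⟨ ℕ.+-monoʳ-≤ (s x) (ℕ.≤-trans (ℕ.m≤m+n (D + u) _) (ℕ.≤-reflexive rest)) ⟩
                  s x + count x a ≤⟨ above-antitone a b x b<x ⟩
                  s b ≤⟨ ℕ.m≤m+n (s b) (count b P) ⟩
                  s b + count b P ∎)))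
                (sym (dec-false (x ≺? b) ¬x<b))
        where open ℕ.≤-Reasoning

  tableWeight-flatten : ∀ (T : Table A A) → (∀ x → content x T ≡ length (lookup T x)) →
                        wordWeight (flatten T) ≡ tableWeight (λ x → descents x T) T
  tableWeight-flatten T bal = trans (scan-flatten s T) (∏-cong λ x →
    scan-row a x (descents x T) (flatAbove T x) (lookup T x) 0 0
      (trans (sym (Length.f-flatAbove T x)) (trans (∑ⁿ-cong (λ y → cong (λ l → if does (x ≺? y) then l else 0)
        (trans (sym (bal y)) (Count.f-flatten y T)))) (sym (ℕ.+-identityʳ (s x)))))
      (trans (sym (Count.f-flatAbove x T x)) (sym (ℕ.+-identityʳ (descents x T))))
      (trans (sym (bal x)) (Count.f-flatten x T))
      (λ b → Count.f-flatAbove-≤ b T x))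
    where
    a = flatten T
    s = above a

  -- Each word is multiplied by 1, written as the sum of the balance condition over all
  -- compositions; exchanging the sums then gives a sum over tables.
  ∑ʷ-wordWeight : ∀ n → ∑ʷ A n wordWeight ≡ gf n
  ∑ʷ-wordWeight n = begin
    ∑ʷ A n wordWeight
      ≡⟨ ∑ʷ-cong n (λ a len → sym (trans (∑ᶜ-* A n (λ ρ → ∏ (λ x → δ (count x a) (lookup ρ x))) (wordWeight a))
           (trans (cong (ℤ._* wordWeight a) (trans (∑ᶜ-δ A n (λ x → count x a))
             (trans (cong (λ k → δ k n) (trans (∑-count a) len)) (δ-refl n)))) (ℤ.*-identityˡ _)))) ⟩
    ∑ʷ A n (λ a → ∑ᶜ A n (λ ρ → ∏ (λ x → δ (count x a) (lookup ρ x)) ℤ.* wordWeight a))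
      ≡⟨ ∑ᶜ-∑ʷ A n n (λ ρ a → ∏ (λ x → δ (count x a) (lookup ρ x)) ℤ.* wordWeight a) ⟨
    ∑ᶜ A n (λ ρ → ∑ʷ A n (λ a → ∏ (λ x → δ (count x a) (lookup ρ x)) ℤ.* wordWeight a))
      ≡⟨ ∑ᵗ-flatten A n (λ ρ a → ∏ (λ x → δ (count x a) (lookup ρ x)) ℤ.* wordWeight a) ⟨
    ∑ᵗ A A n (λ T → ∏ (λ x → δ (count x (flatten T)) (lookup (Vec.map length T) x)) ℤ.* wordWeight (flatten T))
      ≡⟨ ∑ᵗ-cong A n (λ T → trans
           (cong (ℤ._* wordWeight (flatten T)) (∏-cong (λ x → cong₂ δ (sym (Count.f-flatten x T)) (Vec.lookup-map x length T))))
           (∏δ-cong (λ x → content x T) (λ x → length (lookup T x)) (tableWeight-flatten T))) ⟩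
    gf n ∎
    where open ≡-Reasoning

-- The distribution of ⌊(Σ v ∸ 1) / t⌋ over the words v

module _ {A : ℕ} where

  ∑ʷ-lin : ∀ n (F : List (Fin A) → ℤ) k G → ∑ʷ A n (λ a → F a ℤ.+ k ℤ.* G a) ≡ ∑ʷ A n F ℤ.+ k ℤ.* ∑ʷ A n G
  ∑ʷ-lin zero    F k G = refl
  ∑ʷ-lin (suc n) F k G = trans
    (∑-cong (λ b → ∑ʷ-lin n (λ a → F (b ∷ a)) k (λ a → G (b ∷ a))))
    (trans (∑-+ (λ b → ∑ʷ A n (λ a → F (b ∷ a))) (λ b → k ℤ.* ∑ʷ A n (λ a → G (b ∷ a))))
      (cong (ℤ._+_ (∑ʷ A (suc n) F)) (sym (*-distribˡ-∑ k (λ b → ∑ʷ A n (λ a → G (b ∷ a)))))))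

  ∑ʷ-* : ∀ n k (F : List (Fin A) → ℤ) → ∑ʷ A n (λ a → k ℤ.* F a) ≡ k ℤ.* ∑ʷ A n F
  ∑ʷ-* zero    k F = refl
  ∑ʷ-* (suc n) k F = trans (∑-cong (λ b → ∑ʷ-* n k (λ a → F (b ∷ a))))
    (sym (*-distribˡ-∑ k (λ b → ∑ʷ A n (λ a → F (b ∷ a)))))

  ∑-∑ʷ : ∀ n {B} (f : Fin B → List (Fin A) → ℤ) → ∑ (λ b → ∑ʷ A n (f b)) ≡ ∑ʷ A n (λ a → ∑ (λ b → f b a))
  ∑-∑ʷ zero    f = refl
  ∑-∑ʷ (suc n) f = trans (∑-comm (λ b c → ∑ʷ A n (λ a → f b (c ∷ a))))
    (∑-cong (λ c → ∑-∑ʷ n (λ b a → f b (c ∷ a))))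

total : ∀ {A} → List (Fin A) → ℕ
total []      = 0
total (b ∷ a) = toℕ b + total a

D∏-+ : ∀ w m k f → D∏ w (m + k) f ≗ D∏ w m (D∏ (λ i → w (m + i)) k f)
D∏-+ w zero    k f n = refl
D∏-+ w (suc m) k f n = D-cong (w 0) (D∏-+ (w ∘ suc) m k f) n

D∏-≗ : ∀ {v w} R f → (∀ i → i < R → v i ≡ w i) → D∏ v R f ≗ D∏ w R f
D∏-≗         zero    f eq n = refl
D∏-≗ {v} {w} (suc R) f eq n = trans (cong (λ z → D z (D∏ (v ∘ suc) R f) n) (eq 0 (s≤s z≤n)))
  (D-cong (w 0) (D∏-≗ R f (λ i i<R → eq (suc i) (s≤s i<R))) n)

module _ (n : ℕ) {f : ℕ → ℤ} (below-n : ∀ m → m < n → f m ≡ 0ℤ) where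

  D-leading : ∀ w → (∀ m → m < n → D w f m ≡ 0ℤ) × D w f n ≡ f n
  D-leading w = zeros , leading n below-n
    where
    zeros : ∀ m → m < n → D w f m ≡ 0ℤ
    zeros zero    m<n = below-n 0 m<n
    zeros (suc m) m<n = trans (cong₂ (λ p q → p ℤ.- w ℤ.* q) (below-n (suc m) m<n) (below-n m (ℕ.<-trans (ℕ.n<1+n m) m<n)))
      (cong (λ z → 0ℤ ℤ.- z) (ℤ.*-zeroʳ w))
    leading : ∀ n → (∀ m → m < n → f m ≡ 0ℤ) → D w f n ≡ f n
    leading zero    _  = refl
    leading (suc n) eq = trans (cong (λ z → f (suc n) ℤ.- w ℤ.* z) (eq n ℕ.≤-refl))
      (trans (cong (λ z → f (suc n) ℤ.- z) (ℤ.*-zeroʳ w)) (ℤ.+-identityʳ (f (suc n))))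

-- The factors 1 - w u have constant term 1, so they preserve the lowest coefficient.
D∏-leading : ∀ w R n {f} → (∀ m → m < n → f m ≡ 0ℤ) →
             (∀ m → m < n → D∏ w R f m ≡ 0ℤ) × D∏ w R f n ≡ f n
D∏-leading w zero    n     eq = eq , refl
D∏-leading w (suc R) n {f} eq with D∏-leading (w ∘ suc) R n {f} eq
... | zeros , leading with D-leading n {D∏ (w ∘ suc) R f} zeros (w 0)
...   | zeros′ , leading′ = zeros′ , trans leading′ leading

-- The coefficient of f n in the n-th entry is 1 - y.
D∏-difference-cancel : ∀ y v w R {f g} → y ≢ 1ℤ →
  D∏ v R f ∔ ℤ.- y ∙ D∏ w R f ≗ D∏ v R g ∔ ℤ.- y ∙ D∏ w R g → f ≗ g
D∏-difference-cancel y v w R {f} {g} y≢1 eq n = trans (restore (f n) (g n))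
  (trans (cong (ℤ._+ g n) (h≡0 n n ℕ.≤-refl)) (ℤ.+-identityˡ (g n)))
  where
  open ≡-Reasoning
  h : ℕ → ℤ
  h = f ∔ ℤ.- 1ℤ ∙ g
  restore : ∀ p q → p ≡ p ℤ.+ ℤ.- 1ℤ ℤ.* q ℤ.+ q
  restore = solve-∀
  kernel : D∏ v R h ∔ ℤ.- y ∙ D∏ w R h ≗ λ _ → 0ℤ
  kernel n = begin
    D∏ v R h n ℤ.+ ℤ.- y ℤ.* D∏ w R h n
      ≡⟨ cong₂ (λ p q → p ℤ.+ ℤ.- y ℤ.* q) (D∏-lin v R f (ℤ.- 1ℤ) g n) (D∏-lin w R f (ℤ.- 1ℤ) g n) ⟩
    (D∏ v R f n ℤ.+ ℤ.- 1ℤ ℤ.* D∏ v R g n) ℤ.+ ℤ.- y ℤ.* (D∏ w R f n ℤ.+ ℤ.- 1ℤ ℤ.* D∏ w R g n)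
      ≡⟨ regroup y (D∏ v R f n) (D∏ v R g n) (D∏ w R f n) (D∏ w R g n) ⟩
    D∏ v R f n ℤ.+ ℤ.- y ℤ.* D∏ w R f n ℤ.- (D∏ v R g n ℤ.+ ℤ.- y ℤ.* D∏ w R g n)
      ≡⟨ ℤ.i≡j⇒i-j≡0 (eq n) ⟩
    0ℤ ∎
    where
    regroup : ∀ y a b c d → (a ℤ.+ ℤ.- 1ℤ ℤ.* b) ℤ.+ ℤ.- y ℤ.* (c ℤ.+ ℤ.- 1ℤ ℤ.* d) ≡
                            a ℤ.+ ℤ.- y ℤ.* c ℤ.- (b ℤ.+ ℤ.- y ℤ.* d)
    regroup = solve-∀
  h≡0-at : ∀ n → (∀ m → m < n → h m ≡ 0ℤ) → h n ≡ 0ℤ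
  h≡0-at n zeros with ℤ.i*j≡0⇒i≡0∨j≡0 (1ℤ ℤ.- y) {h n} (begin
      (1ℤ ℤ.- y) ℤ.* h n ≡⟨ expand y (h n) ⟩
      h n ℤ.+ ℤ.- y ℤ.* h n ≡⟨ cong₂ (λ p q → p ℤ.+ ℤ.- y ℤ.* q)
                                                 (proj₂ (D∏-leading v R n {h} zeros)) (proj₂ (D∏-leading w R n {h} zeros)) ⟨
      D∏ v R h n ℤ.+ ℤ.- y ℤ.* D∏ w R h n ≡⟨ kernel n ⟩
      0ℤ ∎)
    where
    expand : ∀ y h → (1ℤ ℤ.- y) ℤ.* h ≡ h ℤ.+ ℤ.- y ℤ.* h
    expand = solve-∀
  ... | inj₁ 1-y≡0 = contradiction (sym (ℤ.i-j≡0⇒i≡j 1ℤ y 1-y≡0)) y≢1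
  ... | inj₂ hn≡0  = hn≡0
  h≡0 : ∀ n m → m ≤ n → h m ≡ 0ℤ
  h≡0 zero    zero z≤n = h≡0-at 0 (λ _ ())
  h≡0 (suc n) m    m≤n with ℕ.m≤n⇒m<n∨m≡n m≤n
  ... | inj₁ m<1+n = h≡0 n m (ℕ.s≤s⁻¹ m<1+n)
  ... | inj₂ refl  = h≡0-at (suc n) (λ m m<n → h≡0 n m (ℕ.s≤s⁻¹ m<n))

module Flag (y : ℤ) (r′ t′ : ℕ) where

  r t : ℕ
  r = suc r′
  t = suc t′

  wd we : ℕ → ℤ
  wd i = y ℤ.^ (i ℕ.% r)
  we i = y ℤ.^ (if does (i ℕ.% r ℕ.≟ 0) then r else i ℕ.% r)

  -- The exponent `r` of an excedance with residue 0 makes this hold also at the wrap from residue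
  -- `r - 1` to 0. The elimination in the table recurrence rests on it.
  we-suc : ∀ i → we (suc i) ≡ y ℤ.* wd i
  we-suc i with ℕ.m≤n⇒m<n∨m≡n (ℕ.m%n<n i r)
  ... | inj₁ lt = cong (y ℤ.^_) (trans (cong (λ k → if does (k ℕ.≟ 0) then r else k) suc%) refl)
    where
    suc% : suc i ℕ.% r ≡ suc (i ℕ.% r)
    suc% = trans (cong (λ k → suc k ℕ.% r) (ℕ.m≡m%n+[m/n]*n i r))
      (trans (ℕ.[m+kn]%n≡m%n (suc (i ℕ.% r)) (i ℕ./ r) r) (ℕ.m<n⇒m%n≡m lt))
  ... | inj₂ eq = trans (cong (λ k → y ℤ.^ (if does (k ℕ.≟ 0) then r else k)) suc%) (cong (y ℤ.^_) (sym eq))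
    where
    suc% : suc i ℕ.% r ≡ 0
    suc% = trans (cong (λ k → suc k ℕ.% r) (ℕ.m≡m%n+[m/n]*n i r))
      (trans (ℕ.[m+kn]%n≡m%n (suc (i ℕ.% r)) (i ℕ./ r) r) (trans (cong (ℕ._% r) eq) (ℕ.n%n≡0 r)))

  v : ℕ → ℤ
  v i = y ℤ.* wd i

  wd-periodic : ∀ i → wd (r + i) ≡ wd i
  wd-periodic i = cong (y ℤ.^_) (trans (cong (ℕ._% r) (ℕ.+-comm r i)) (ℕ.[m+n]%n≡m%n i r))

  wd-small : ∀ {i} → i < r → wd i ≡ y ℤ.^ i
  wd-small i<r = cong (y ℤ.^_) (ℕ.m<n⇒m%n≡m i<r)

  Blocks Blocksʸ : ℕ → (ℕ → ℤ) → ℕ → ℤ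
  Blocks  k = D∏ wd (k * r)
  Blocksʸ k = D∏ v (k * r)

  Blocks-suc : ∀ k f → Blocks (suc k) f ≗ D∏ wd r (Blocks k f)
  Blocks-suc k f n = trans (D∏-+ wd r (k * r) f n)
    (D∏-cong wd r (D∏-≗ {λ i → wd (r + i)} {wd} (k * r) f (λ i _ → wd-periodic i)) n)

  Blocksʸ-suc : ∀ k f → Blocksʸ (suc k) f ≗ D∏ v r (Blocksʸ k f)
  Blocksʸ-suc k f n = trans (D∏-+ v r (k * r) f n)
    (D∏-cong v r (D∏-≗ {λ i → v (r + i)} {v} (k * r) f (λ i _ → cong (y ℤ.*_) (wd-periodic i))) n)

  c : ℤ
  c = y ℤ.^ r

  -- Over one period the factors belong to y, ..., y^r on the left and to 1, ..., y^(r-1) on the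
  -- right, so they differ only in y^r against 1.
  block-link : ∀ {f g} → D c g ≗ D 1ℤ f → D∏ v r g ≗ D∏ wd r f
  block-link {f} {g} eq n = begin
    D∏ v r g n ≡⟨ D∏-last v r′ g n ⟩
    D∏ v r′ (D (v r′) g) n ≡⟨ cong (λ z → D∏ v r′ (D z g) n) (cong (y ℤ.*_) (wd-small (ℕ.n<1+n r′))) ⟩
    D∏ v r′ (D c g) n ≡⟨ D∏-cong v r′ eq n ⟩
    D∏ v r′ (D 1ℤ f) n ≡⟨ D∏-≗ r′ (D 1ℤ f) (λ i i<r′ → trans
                                           (cong (y ℤ.*_) (wd-small (ℕ.m≤n⇒m≤1+n i<r′))) (sym (wd-small (s≤s i<r′)))) n ⟩
    D∏ (wd ∘ suc) r′ (D 1ℤ f) n ≡⟨ D∏-D (wd ∘ suc) r′ 1ℤ f n ⟩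
    D 1ℤ (D∏ (wd ∘ suc) r′ f) n ≡⟨ cong (λ z → D z (D∏ (wd ∘ suc) r′ f) n) (wd-small {0} (s≤s z≤n)) ⟨
    D∏ wd r f n ∎
    where open ≡-Reasoning

  φ : ℕ → ℤ
  φ m = y ℤ.^ ((m ∸ 1) ℕ./ t)

  -- The shifts a = 0, …, t + 1 interpolate between the distribution and y times itself.
  F : ℕ → ℕ → ℤ
  F a n = ∑ʷ (suc (t * r)) n (λ u → φ (a + total u))

  -- The argument has to be positive because of the truncated `∸ 1`: `φ 0` is 1 like `φ 1`, while
  -- `φ (t * r)` is only y^(r-1).
  φ-period : ∀ m → φ (suc m + t * r) ≡ c ℤ.* φ (suc m)
  φ-period m = trans (cong (y ℤ.^_) (begin
    (m + t * r) ℕ./ t ≡⟨ ℕ./-congˡ (cong (m +_) (ℕ.*-comm t r)) ⟩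
    (m + r * t) ℕ./ t ≡⟨ ℕ.+-distrib-/-∣ʳ m (ℕ.divides r refl) ⟩
    m ℕ./ t + r * t ℕ./ t ≡⟨ cong (m ℕ./ t +_) (ℕ.m*n/n≡m r t) ⟩
    m ℕ./ t + r ≡⟨ ℕ.+-comm (m ℕ./ t) r ⟩
    r + m ℕ./ t ∎)) (ℤ.^-distribˡ-+-* y r (m ℕ./ t))
    where open ≡-Reasoning

  -- Raising the shift drops the first of `t * r + 1` consecutive values and appends the next one,
  -- which lies one period after the second.
  ∑-φ : ∀ a s → ∑ {suc (t * r)} (λ b → φ (suc a + (toℕ b + s))) ℤ.+ φ (a + s) ≡
                 ∑ {suc (t * r)} (λ b → φ (a + (toℕ b + s))) ℤ.+ c ℤ.* φ (suc a + s)
  ∑-φ a s = begin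
    ∑ {suc (t * r)} (λ b → φ (suc a + (toℕ b + s))) ℤ.+ φ (a + s)
      ≡⟨ cong (ℤ._+ φ (a + s)) (∑-cong {suc (t * r)} (λ b → cong φ (cong suc (swap a (toℕ b) s)))) ⟩
    ∑ {suc (t * r)} (λ b → φ (suc (toℕ b) + (a + s))) ℤ.+ φ (a + s)
      ≡⟨ ℤ.+-comm (∑ {suc (t * r)} (λ b → φ (suc (toℕ b) + (a + s)))) (φ (a + s)) ⟩
    φ (a + s) ℤ.+ ∑ {suc (t * r)} (λ b → φ (suc (toℕ b) + (a + s)))
      ≡⟨ ∑-shift (suc (t * r)) (λ b → φ (b + (a + s))) ⟨
    ∑ {suc (t * r)} (λ b → φ (toℕ b + (a + s))) ℤ.+ φ (suc (t * r) + (a + s))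
      ≡⟨ cong₂ ℤ._+_ (∑-cong {suc (t * r)} (λ b → cong φ (sym (swap a (toℕ b) s))))
           (trans (cong (φ ∘ suc) (ℕ.+-comm (t * r) (a + s))) (φ-period (a + s))) ⟩
    ∑ {suc (t * r)} (λ b → φ (a + (toℕ b + s))) ℤ.+ c ℤ.* φ (suc a + s) ∎
    where
    open ≡-Reasoning
    swap : ∀ a b s → a + (b + s) ≡ b + (a + s)
    swap = ℕSolver.solve-∀

  F-suc : ∀ a n → F (suc a) (suc n) ≡ F a (suc n) ℤ.+ c ℤ.* F (suc a) n ℤ.- 1ℤ ℤ.* F a n
  F-suc a n = trans (split (F (suc a) (suc n)) (F a n)) (cong (λ z → z ℤ.- 1ℤ ℤ.* F a n) (begin
    F (suc a) (suc n) ℤ.+ 1ℤ ℤ.* F a n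
      ≡⟨ cong (ℤ._+ 1ℤ ℤ.* F a n) (∑-∑ʷ n {A} (λ b u → φ (suc a + (toℕ b + total u)))) ⟩
    ∑ʷ A n (λ u → ∑ {A} (λ b → φ (suc a + (toℕ b + total u)))) ℤ.+ 1ℤ ℤ.* F a n
      ≡⟨ ∑ʷ-lin n (λ u → ∑ {A} (λ b → φ (suc a + (toℕ b + total u)))) 1ℤ (λ u → φ (a + total u)) ⟨
    ∑ʷ A n (λ u → ∑ {A} (λ b → φ (suc a + (toℕ b + total u))) ℤ.+ 1ℤ ℤ.* φ (a + total u))
      ≡⟨ ∑ʷ-cong n (λ u _ → trans (cong (ℤ._+_ (∑ {A} (λ b → φ (suc a + (toℕ b + total u))))) (ℤ.*-identityˡ (φ (a + total u))))
           (∑-φ a (total u))) ⟩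
    ∑ʷ A n (λ u → ∑ {A} (λ b → φ (a + (toℕ b + total u))) ℤ.+ c ℤ.* φ (suc a + total u))
      ≡⟨ ∑ʷ-lin n (λ u → ∑ {A} (λ b → φ (a + (toℕ b + total u)))) c (λ u → φ (suc a + total u)) ⟩
    ∑ʷ A n (λ u → ∑ {A} (λ b → φ (a + (toℕ b + total u)))) ℤ.+ c ℤ.* F (suc a) n
      ≡⟨ cong (ℤ._+ c ℤ.* F (suc a) n) (∑-∑ʷ n {A} (λ b u → φ (a + (toℕ b + total u)))) ⟨
    F a (suc n) ℤ.+ c ℤ.* F (suc a) n ∎))
    where
    open ≡-Reasoning
    A = suc (t * r)
    split : ∀ p q → p ≡ p ℤ.+ 1ℤ ℤ.* q ℤ.- 1ℤ ℤ.* q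
    split = solve-∀

  D-F-suc : ∀ a n → D c (F (suc a)) (suc n) ≡ D 1ℤ (F a) (suc n)
  D-F-suc a n = trans (cong (ℤ._- c ℤ.* F (suc a) n) (F-suc a n))
    (cancel (F a (suc n)) (c ℤ.* F (suc a) n) (1ℤ ℤ.* F a n))
    where
    cancel : ∀ p q s → p ℤ.+ q ℤ.- s ℤ.- q ≡ p ℤ.- s
    cancel = solve-∀

  φ-small : ∀ {a} → a ≤ t → φ (a + 0) ≡ 1ℤ
  φ-small {zero}  _   = cong (y ℤ.^_) (ℕ.0/n≡0 t)
  φ-small {suc a} a≤t = cong (y ℤ.^_) (ℕ.m<n⇒m/n≡0 (subst (_< t) (sym (ℕ.+-identityʳ a)) a≤t))

  F-link : ∀ {a} → a < t → D c (F (suc a)) ≗ D 1ℤ (F a)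
  F-link {a} a<t zero    = trans (φ-small {suc a} a<t) (sym (φ-small {a} (ℕ.<⇒≤ a<t)))
  F-link {a} a<t (suc n) = D-F-suc a n

  F-wrap : ∀ n → F (suc t) n ≡ y ℤ.* F 1 n
  F-wrap n = trans (∑ʷ-cong n (λ u _ → wrap (total u))) (∑ʷ-* n y (λ u → φ (suc (total u))))
    where
    wrap : ∀ s → φ (suc t + s) ≡ y ℤ.* φ (1 + s)
    wrap s = cong (y ℤ.^_) (trans (ℕ.+-distrib-/-∣ˡ s (ℕ.divides 1 (sym (ℕ.*-identityˡ t)))) (cong (_+ s ℕ./ t) (ℕ.n/n≡1 t)))

  -- Shift `t + 1` is `y` times shift 1, which closes the cycle of links. The usual link fails for
  -- the empty word alone, where `φ t` is 1 but `φ (t + 1)` is `y`; `ε` carries the difference.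
  F-link-last : D 1ℤ (F t) ≗ (λ n → y ℤ.* D c (F 1) n) ∔ 1ℤ ℤ.- y ∙ ε
  F-link-last zero    = trans (φ-small {t} ℕ.≤-refl) (trans (expand y) (cong (λ z → y ℤ.* z ℤ.+ (1ℤ ℤ.- y) ℤ.* 1ℤ) (sym (φ-small {1} (s≤s z≤n)))))
    where
    expand : ∀ y → 1ℤ ≡ y ℤ.* 1ℤ ℤ.+ (1ℤ ℤ.- y) ℤ.* 1ℤ
    expand = solve-∀
  F-link-last (suc n) = begin
    D 1ℤ (F t) (suc n) ≡⟨ D-F-suc t n ⟨
    D c (F (suc t)) (suc n) ≡⟨ D-cong c F-wrap (suc n) ⟩
    D c (λ m → y ℤ.* F 1 m) (suc n) ≡⟨ D-scale c y (F 1) (suc n) ⟩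
    y ℤ.* D c (F 1) (suc n) ≡⟨ pad (y ℤ.* D c (F 1) (suc n)) (1ℤ ℤ.- y) ⟩
    y ℤ.* D c (F 1) (suc n) ℤ.+ (1ℤ ℤ.- y) ℤ.* 0ℤ ∎
    where
    open ≡-Reasoning
    pad : ∀ p k → p ≡ p ℤ.+ k ℤ.* 0ℤ
    pad = solve-∀

  F-chain : ∀ k → k ≤ t → Blocksʸ k (F k) ≗ Blocks k (F 0)
  F-chain zero    _   n = refl
  F-chain (suc k) k<t n = begin
    Blocksʸ (suc k) (F (suc k)) n ≡⟨ Blocksʸ-suc k (F (suc k)) n ⟩
    D∏ v r (Blocksʸ k (F (suc k))) n ≡⟨ D∏-D∏ v r v (k * r) (F (suc k)) n ⟩
    Blocksʸ k (D∏ v r (F (suc k))) n ≡⟨ D∏-cong v (k * r) (block-link {F k} {F (suc k)} (F-link {k} k<t)) n ⟩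
    Blocksʸ k (D∏ wd r (F k)) n ≡⟨ D∏-D∏ v (k * r) wd r (F k) n ⟩
    D∏ wd r (Blocksʸ k (F k)) n ≡⟨ D∏-cong wd r (F-chain k (ℕ.<⇒≤ k<t)) n ⟩
    D∏ wd r (Blocks k (F 0)) n ≡⟨ Blocks-suc k (F 0) n ⟨
    Blocks (suc k) (F 0) n ∎
    where open ≡-Reasoning

  -- Both terms are reduced to `F 1`, the first by the chain up to `F t` and `F-link-last`, the
  -- second by the link from 0 to 1; then `F 1` cancels. As `wd (t * r)` is 1, this is the
  -- recurrence of the tables.
  F-recurrence : D 1ℤ (Blocks t (F 0) ∔ ℤ.- y ∙ Blocksʸ t (F 0)) ≗ (λ n → (1ℤ ℤ.- y) ℤ.* Blocksʸ t ε n)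
  F-recurrence n = begin
    D 1ℤ (Blocks t (F 0) ∔ ℤ.- y ∙ N (F 0)) n
      ≡⟨ D-lin 1ℤ (Blocks t (F 0)) (ℤ.- y) (N (F 0)) n ⟩
    D 1ℤ (Blocks t (F 0)) n ℤ.+ ℤ.- y ℤ.* D 1ℤ (N (F 0)) n
      ≡⟨ cong₂ (λ p q → p ℤ.+ ℤ.- y ℤ.* q) (trans (D-cong 1ℤ (λ m → sym (F-chain t ℕ.≤-refl m)) n) (sym (D∏-D v (t * r) 1ℤ (F t) n)))
           (trans (sym (D∏-D v (t * r) 1ℤ (F 0) n)) (D∏-cong v (t * r) (λ m → sym (F-link {0} (s≤s z≤n) m)) n)) ⟩
    N (D 1ℤ (F t)) n ℤ.+ ℤ.- y ℤ.* N (D c (F 1)) n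
      ≡⟨ cong (ℤ._+ ℤ.- y ℤ.* N (D c (F 1)) n) (begin
           N (D 1ℤ (F t)) n ≡⟨ D∏-cong v (t * r) F-link-last n ⟩
           N ((λ n → y ℤ.* D c (F 1) n) ∔ 1ℤ ℤ.- y ∙ ε) n ≡⟨ D∏-lin v (t * r) (λ n → y ℤ.* D c (F 1) n) (1ℤ ℤ.- y) ε n ⟩
           N (λ n → y ℤ.* D c (F 1) n) n ℤ.+ (1ℤ ℤ.- y) ℤ.* N ε n ≡⟨ cong (ℤ._+ (1ℤ ℤ.- y) ℤ.* N ε n) (D∏-scale v (t * r) y (D c (F 1)) n) ⟩
           y ℤ.* N (D c (F 1)) n ℤ.+ (1ℤ ℤ.- y) ℤ.* N ε n ∎) ⟩
    y ℤ.* N (D c (F 1)) n ℤ.+ (1ℤ ℤ.- y) ℤ.* N ε n ℤ.+ ℤ.- y ℤ.* N (D c (F 1)) n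
      ≡⟨ cancel y (N (D c (F 1)) n) ((1ℤ ℤ.- y) ℤ.* N ε n) ⟩
    (1ℤ ℤ.- y) ℤ.* N ε n ∎
    where
    open ≡-Reasoning
    N = Blocksʸ t
    cancel : ∀ y p q → y ℤ.* p ℤ.+ q ℤ.+ ℤ.- y ℤ.* p ≡ q
    cancel = solve-∀

  wordWeight : List (Fin (suc (t * r))) → ℤ
  wordWeight = WordWeight.wordWeight (wd ∘ toℕ) (we ∘ toℕ)

  -- Both sequences satisfy one recurrence, and it determines them when y is not 1.
  equidistribution : y ≢ 1ℤ → ∀ n → ∑ʷ (suc (t * r)) n wordWeight ≡ ∑ʷ (suc (t * r)) n (λ u → φ (total u))
  equidistribution y≢1 n = trans (WordWeight.∑ʷ-wordWeight (wd ∘ toℕ) (we ∘ toℕ) n)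
    (D∏-difference-cancel y wd v (t * r) {G} {F 0} y≢1
      (D-cancel 1ℤ {Blocks t G ∔ ℤ.- y ∙ Blocksʸ t G} {Blocks t (F 0) ∔ ℤ.- y ∙ Blocksʸ t (F 0)} (λ m → begin
        D 1ℤ (Blocks t G ∔ ℤ.- y ∙ Blocksʸ t G) m
          ≡⟨ cong (λ z → D z (Blocks t G ∔ ℤ.- y ∙ Blocksʸ t G) m) (cong (y ℤ.^_) (ℕ.m*n%n≡0 t r)) ⟨
        D (wd (t * r)) (Blocks t G ∔ ℤ.- y ∙ Blocksʸ t G) m
          ≡⟨ Recurrence.tables-recurrence y wd we (t * r) we-suc m ⟩
        (1ℤ ℤ.- y) ℤ.* Blocksʸ t ε m
          ≡⟨ F-recurrence m ⟨
        D 1ℤ (Blocks t (F 0) ∔ ℤ.- y ∙ Blocksʸ t (F 0)) m ∎)) n)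
    where
    open ≡-Reasoning
    G = Recurrence.tables y wd we (suc (t * r))

-- Sorting words

∑ˡ : ∀ {a} {X : Set a} → (X → ℤ) → List X → ℤ
∑ˡ f []       = 0ℤ
∑ˡ f (x ∷ xs) = f x ℤ.+ ∑ˡ f xs

∑ˡ-cong : ∀ {a} {X : Set a} {f g : X → ℤ} (xs : List X) → (∀ x → x ∈ xs → f x ≡ g x) → ∑ˡ f xs ≡ ∑ˡ g xs
∑ˡ-cong []       eq = refl
∑ˡ-cong (x ∷ xs) eq = cong₂ ℤ._+_ (eq x (here refl)) (∑ˡ-cong xs (λ z z∈xs → eq z (there z∈xs)))

∑ˡ-++ : ∀ {a} {X : Set a} (f : X → ℤ) xs ys → ∑ˡ f (xs ++ ys) ≡ ∑ˡ f xs ℤ.+ ∑ˡ f ys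
∑ˡ-++ f []       ys = sym (ℤ.+-identityˡ _)
∑ˡ-++ f (x ∷ xs) ys = trans (cong (ℤ._+_ (f x)) (∑ˡ-++ f xs ys)) (sym (ℤ.+-assoc (f x) (∑ˡ f xs) (∑ˡ f ys)))

∑ˡ-map : ∀ {a b} {X : Set a} {Y : Set b} (f : Y → ℤ) (g : X → Y) xs → ∑ˡ f (map g xs) ≡ ∑ˡ (f ∘ g) xs
∑ˡ-map f g []       = refl
∑ˡ-map f g (x ∷ xs) = cong (ℤ._+_ (f (g x))) (∑ˡ-map f g xs)

∑ˡ-↭ : ∀ {a} {X : Set a} (f : X → ℤ) {xs ys} → xs ↭ ys → ∑ˡ f xs ≡ ∑ˡ f ys
∑ˡ-↭ f ↭.refl = refl
∑ˡ-↭ f (↭.prep x p) = cong (ℤ._+_ (f x)) (∑ˡ-↭ f p)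
∑ˡ-↭ f {_ ∷ _ ∷ xs} {_ ∷ _ ∷ ys} (↭.swap x y p) = trans (cong (λ s → f x ℤ.+ (f y ℤ.+ s)) (∑ˡ-↭ f p)) (exchange (f x) (f y) (∑ˡ f ys))
  where
  exchange : ∀ p q s → p ℤ.+ (q ℤ.+ s) ≡ q ℤ.+ (p ℤ.+ s)
  exchange = solve-∀
∑ˡ-↭ f (↭.trans p q) = trans (∑ˡ-↭ f p) (∑ˡ-↭ f q)

∑ˡ-cartesianProductWith : ∀ {a b c} {X : Set a} {Y : Set b} {Z : Set c} (f : Z → ℤ) (g : X → Y → Z) xs ys →
  ∑ˡ f (List.cartesianProductWith g xs ys) ≡ ∑ˡ (λ x → ∑ˡ (λ y → f (g x y)) ys) xs
∑ˡ-cartesianProductWith f g []       ys = refl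
∑ˡ-cartesianProductWith f g (x ∷ xs) ys = trans (∑ˡ-++ f (map (g x) ys) (List.cartesianProductWith g xs ys))
  (cong₂ ℤ._+_ (∑ˡ-map f (g x) ys) (∑ˡ-cartesianProductWith f g xs ys))

∑ˡ-filter : ∀ {a p} {X : Set a} {P : X → Set p} (P? : ∀ x → Dec (P x)) (f : X → ℤ) xs →
  ∑ˡ f (List.filter P? xs) ≡ ∑ˡ (λ x → if does (P? x) then f x else 0ℤ) xs
∑ˡ-filter P? f []       = refl
∑ˡ-filter P? f (x ∷ xs) with does (P? x)
... | true  = cong (ℤ._+_ (f x)) (∑ˡ-filter P? f xs)
... | false = trans (∑ˡ-filter P? f xs) (sym (ℤ.+-identityˡ _))

∑ˡ-tabulate : ∀ {a} {X : Set a} {n} (f : X → ℤ) (g : Fin n → X) → ∑ˡ f (List.tabulate g) ≡ ∑ (f ∘ g)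
∑ˡ-tabulate {n = zero}  f g = refl
∑ˡ-tabulate {n = suc n} f g = cong (ℤ._+_ (f (g zero))) (∑ˡ-tabulate f (g ∘ suc))

∑ˡ-words-suc : ∀ A n (f : Vec (Fin A) (suc n) → ℤ) →
  ∑ˡ f (words A (suc n)) ≡ ∑ (λ b → ∑ˡ (λ u → f (b ∷ u)) (words A n))
∑ˡ-words-suc A n f = trans (∑ˡ-cartesianProductWith f _∷_ (List.allFin A) (words A n))
  (∑ˡ-tabulate (λ b → ∑ˡ (λ u → f (b ∷ u)) (words A n)) id)

∑ˡ-words : ∀ A n (F : List (Fin A) → ℤ) → ∑ˡ (F ∘ Vec.toList) (words A n) ≡ ∑ʷ A n F
∑ˡ-words A zero    F = ℤ.+-identityʳ (F [])
∑ˡ-words A (suc n) F = trans (∑ˡ-words-suc A n (F ∘ Vec.toList)) (∑-cong (λ b → ∑ˡ-words A n (λ a → F (b ∷ a))))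

permutations : ∀ n → List (Vec (Fin n) n)
permutations n = List.filter isPermutation? (words n n)

words-unique : ∀ A n → Unique (words A n)
words-unique A zero    = [] ∷ []
words-unique A (suc n) = Unique.cartesianProductWith⁺ _∷_ Vec.∷-injective (Unique.allFin⁺ A) (words-unique A n)

words-complete : ∀ {A n} (u : Vec (Fin A) n) → u ∈ words A n
words-complete []      = here refl
words-complete (b ∷ u) = ∈.∈-cartesianProductWith⁺ _∷_ (∈.∈-allFin b) (words-complete u)

ind : ∀ {p} {P : Set p} → Dec P → ℕ
ind P? = if does P? then 1 else 0

ind-mono : ∀ {p q} {P : Set p} {Q : Set q} (P? : Dec P) (Q? : Dec Q) → (P → Q) → ind P? ≤ ind Q?
ind-mono (no _)  _       P→Q = z≤n
ind-mono (yes p) (yes _) P→Q = ℕ.≤-refl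
ind-mono (yes p) (no ¬q) P→Q = contradiction (P→Q p) ¬q

ind-cong : ∀ {p q} {P : Set p} {Q : Set q} (P? : Dec P) (Q? : Dec Q) → (P → Q) → (Q → P) → ind P? ≡ ind Q?
ind-cong P? Q? P→Q Q→P = ℕ.≤-antisym (ind-mono P? Q? P→Q) (ind-mono Q? P? Q→P)

∑-ind-< : ∀ {n} (i : Fin n) → ∑ⁿ {n} (λ j → ind (toℕ j ℕ.<? toℕ i)) ≡ toℕ i
∑-ind-< {suc n} zero    = ∑ⁿ-zero n
∑-ind-< {suc n} (suc i) = cong suc (∑-ind-< i)

∑-ones : ∀ n → ∑ⁿ {n} (λ _ → 1) ≡ n
∑-ones zero    = refl
∑-ones (suc n) = cong suc (∑-ones n)

injective⇒surjective : ∀ {n} {f : Fin n → Fin n} → (∀ {i j} → f i ≡ f j → i ≡ j) → ∀ p → ∃[ i ] f i ≡ p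
injective⇒surjective {suc n} {f} f-inj p with Fin.any? (λ i → f i Fin.≟ p)
... | yes hit  = hit
... | no  miss = contradiction
  (Fin.injective⇒≤ {f = λ i → Fin.punchOut {i = p} {j = f i} (λ eq → miss (i , sym eq))}
    (λ {i} {j} eq → f-inj (Fin.punchOut-injective (λ eq → miss (i , sym eq)) (λ eq → miss (j , sym eq)) eq)))
  ℕ.1+n≰n

toPermutation : ∀ {n} {f : Fin n → Fin n} → (∀ {i j} → f i ≡ f j → i ≡ j) → Permutation n n
toPermutation {f = f} f-inj = permutation f (λ p → proj₁ (injective⇒surjective f-inj p))
  (λ p → proj₂ (injective⇒surjective f-inj p))
  (λ i → f-inj (proj₂ (injective⇒surjective f-inj (f i))))

-- Places in the sorted order are numbers of predecessors, so that ranks and positions can be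
-- compared directly without a sorting algorithm.
module Ranking {n : ℕ} {_≺_ : Fin n → Fin n → Set} (_≺ᵈ_ : ∀ p q → Dec (p ≺ q))
  (irrefl : ∀ {p} → ¬ (p ≺ p)) (≺-trans : ∀ {p q s} → p ≺ q → q ≺ s → p ≺ s)
  (connected : ∀ {p q} → p ≢ q → p ≺ q ⊎ q ≺ p) where

  rank : Fin n → ℕ
  rank p = ∑ⁿ (λ q → ind (q ≺ᵈ p))

  suc-rank : ∀ p → ∑ⁿ (λ q → e p q + ind (q ≺ᵈ p)) ≡ suc (rank p)
  suc-rank p = ∑ⁿ-changeAt p 1 (cong (_+ ind (p ≺ᵈ p)) (e-refl p)) (λ q q≢p → cong (_+ ind (q ≺ᵈ p)) (e-≢ (q≢p ∘ sym)))

  rank-mono : ∀ {p q} → p ≺ q → rank p < rank q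
  rank-mono {p} {q} p≺q = subst (_≤ rank q) (suc-rank p) (∑ⁿ-mono le)
    where
    le : ∀ z → e p z + ind (z ≺ᵈ p) ≤ ind (z ≺ᵈ q)
    le z with p Fin.≟ z
    ... | no  _    = ind-mono (z ≺ᵈ p) (z ≺ᵈ q) (λ z≺p → ≺-trans z≺p p≺q)
    ... | yes refl rewrite dec-false (p ≺ᵈ p) irrefl | dec-true (p ≺ᵈ q) p≺q = ℕ.≤-refl

  rank<n : ∀ p → rank p < n
  rank<n p = subst₂ _≤_ (suc-rank p) (∑-ones n) (∑ⁿ-mono le)
    where
    le : ∀ z → e p z + ind (z ≺ᵈ p) ≤ 1
    le z with p Fin.≟ z
    ... | yes refl rewrite dec-false (p ≺ᵈ p) irrefl = ℕ.≤-refl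
    ... | no  _ with does (z ≺ᵈ p)
    ...   | true  = ℕ.≤-refl
    ...   | false = z≤n

  position : Fin n → Fin n
  position p = Fin.fromℕ< (rank<n p)

  rank-≡ : ∀ {p q} → position p ≡ position q → rank p ≡ rank q
  rank-≡ {p} {q} eq = trans (sym (Fin.toℕ-fromℕ< (rank<n p))) (trans (cong toℕ eq) (Fin.toℕ-fromℕ< (rank<n q)))

  position-injective : ∀ {p q} → position p ≡ position q → p ≡ q
  position-injective {p} {q} eq with p Fin.≟ q
  ... | yes p≡q = p≡q
  ... | no  p≢q with connected p≢q
  ...   | inj₁ p≺q = contradiction (rank-mono p≺q) (ℕ.<-irrefl (rank-≡ eq))
  ...   | inj₂ q≺p = contradiction (rank-mono q≺p) (ℕ.<-irrefl (rank-≡ (sym eq)))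

  sorting : Permutation n n
  sorting = toPermutation position-injective

  -- Reindexing along `π` turns the predecessors of the `i`-th element into the indices below `i`.
  sorted⇒rank : (π : Permutation n n) → (∀ {i j} → toℕ i < toℕ j → (π ⟨$⟩ʳ i) ≺ (π ⟨$⟩ʳ j)) →
                ∀ i → rank (π ⟨$⟩ʳ i) ≡ toℕ i
  sorted⇒rank π sorted i = trans (∑ⁿ-permute (λ q → ind (q ≺ᵈ (π ⟨$⟩ʳ i))) π)
    (trans (∑ⁿ-cong (λ j → ind-cong ((π ⟨$⟩ʳ j) ≺ᵈ (π ⟨$⟩ʳ i)) (toℕ j ℕ.<? toℕ i) (back j) sorted)) (∑-ind-< i))
    where
    back : ∀ j → (π ⟨$⟩ʳ j) ≺ (π ⟨$⟩ʳ i) → toℕ j < toℕ i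
    back j j≺i with ℕ.<-cmp (toℕ j) (toℕ i)
    ... | tri< j<i _ _ = j<i
    ... | tri≈ _ j≡i _ = contradiction (subst (λ k → (π ⟨$⟩ʳ k) ≺ (π ⟨$⟩ʳ i)) (Fin.toℕ-injective j≡i) j≺i) irrefl
    ... | tri> _ _ i<j = contradiction (≺-trans (sorted i<j) j≺i) irrefl

Before : ∀ {A n} → Vec (Fin A) n → Fin n → Fin n → Set
Before a q p = toℕ (lookup a p) < toℕ (lookup a q) ⊎ (lookup a p ≡ lookup a q × toℕ q < toℕ p)

Sorted : ∀ {A m n} → Vec (Fin m) n → Vec (Fin A) n → Set
Sorted σ N = ∀ {i j} → toℕ i < toℕ j →
  toℕ (lookup N j) < toℕ (lookup N i) ⊎ (lookup N j ≡ lookup N i × toℕ (lookup σ i) < toℕ (lookup σ j))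

module _ {A n : ℕ} (a : Vec (Fin A) n) where

  before? : ∀ q p → Dec (Before a q p)
  before? q p = (lookup a p ≺? lookup a q) ⊎-dec ((lookup a p Fin.≟ lookup a q) ×-dec (q ≺? p))

  before-irrefl : ∀ {p} → ¬ Before a p p
  before-irrefl (inj₁ lt)       = ℕ.<-irrefl refl lt
  before-irrefl (inj₂ (_ , lt)) = ℕ.<-irrefl refl lt

  before-trans : ∀ {p q s} → Before a p q → Before a q s → Before a p s
  before-trans         (inj₁ lt)        (inj₁ lt′)        = inj₁ (ℕ.<-trans lt′ lt)
  before-trans {p}     (inj₁ lt)        (inj₂ (eq , _))   = inj₁ (subst (λ z → toℕ z < toℕ (lookup a p)) (sym eq) lt)
  before-trans {s = s} (inj₂ (eq , _))  (inj₁ lt)         = inj₁ (subst (λ z → toℕ (lookup a s) < toℕ z) eq lt)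
  before-trans         (inj₂ (eq , lt)) (inj₂ (eq′ , lt′)) = inj₂ (trans eq′ eq , ℕ.<-trans lt lt′)

  before-connected : ∀ {p q} → p ≢ q → Before a p q ⊎ Before a q p
  before-connected {p} {q} p≢q with ℕ.<-cmp (toℕ (lookup a p)) (toℕ (lookup a q))
  ... | tri< lt _ _ = inj₂ (inj₁ lt)
  ... | tri> _ _ gt = inj₁ (inj₁ gt)
  ... | tri≈ _ eq _ with ℕ.<-cmp (toℕ p) (toℕ q)
  ...   | tri< lt _ _ = inj₁ (inj₂ (sym (Fin.toℕ-injective eq) , lt))
  ...   | tri≈ _ p≡q _ = contradiction (Fin.toℕ-injective p≡q) p≢q
  ...   | tri> _ _ gt = inj₂ (inj₂ (Fin.toℕ-injective eq , gt))

  open Ranking before? before-irrefl before-trans before-connected public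

  sortingWord : Fin n → Fin n
  sortingWord i = sorting ⟨$⟩ˡ i

  -- The `i`-th letter in sorted order, preceded by its position in the word as the value σ i.
  encode : Vec (Fin n) n × Vec (Fin A) n
  encode = Vec.tabulate sortingWord , Vec.tabulate (λ i → lookup a (sortingWord i))

  rank-sortingWord : ∀ i → rank (sortingWord i) ≡ toℕ i
  rank-sortingWord i = trans (sym (Fin.toℕ-fromℕ< (rank<n (sortingWord i)))) (cong toℕ (inverseʳ sorting))

  sortingWord-rank : ∀ p → sortingWord (position p) ≡ p
  sortingWord-rank p = inverseˡ sorting

  encode-permutation : IsPermutation (proj₁ encode)
  encode-permutation = VecUnique.tabulate⁺ λ {i} {j} eq →
    Fin.toℕ-injective (trans (sym (rank-sortingWord i)) (trans (cong rank eq) (rank-sortingWord j)))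

  encode-sorted : Sorted (proj₁ encode) (proj₂ encode)
  encode-sorted {i} {j} i<j
    rewrite Vec.lookup∘tabulate sortingWord i | Vec.lookup∘tabulate sortingWord j
          | Vec.lookup∘tabulate (λ i → lookup a (sortingWord i)) i | Vec.lookup∘tabulate (λ i → lookup a (sortingWord i)) j
    with before-connected {sortingWord i} {sortingWord j}
           (λ eq → ℕ.<-irrefl (trans (sym (rank-sortingWord i)) (trans (cong rank eq) (rank-sortingWord j))) i<j)
  ... | inj₁ i≺j = i≺j
  ... | inj₂ j≺i = contradiction (subst₂ _<_ (rank-sortingWord j) (rank-sortingWord i) (rank-mono j≺i)) (ℕ.<-asym i<j)

module _ {A n : ℕ} where

  encode-injective : ∀ {a b : Vec (Fin A) n} → encode a ≡ encode b → a ≡ b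
  encode-injective {a} {b} eq = trans (sym (Vec.tabulate∘lookup a))
    (trans (Vec.tabulate-cong (λ p → subst (λ q → lookup a q ≡ lookup b q) (sortingWord-rank a p) (same (position a p))))
      (Vec.tabulate∘lookup b))
    where
    σ-eq : ∀ i → sortingWord a i ≡ sortingWord b i
    σ-eq i = trans (sym (Vec.lookup∘tabulate (sortingWord a) i))
      (trans (cong (λ w → lookup (proj₁ w) i) eq) (Vec.lookup∘tabulate (sortingWord b) i))
    same : ∀ i → lookup a (sortingWord a i) ≡ lookup b (sortingWord a i)
    same i = trans (sym (Vec.lookup∘tabulate (λ i → lookup a (sortingWord a i)) i))
      (trans (cong (λ w → lookup (proj₂ w) i) eq)
        (trans (Vec.lookup∘tabulate (λ i → lookup b (sortingWord b i)) i) (cong (lookup b) (sym (σ-eq i)))))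

  -- With N i put at position σ i, sortedness says that σ lists the positions in the order `Before`.
  -- Such a list is unique by `sorted⇒rank`.
  encode-surjective : ∀ (σ : Vec (Fin n) n) (N : Vec (Fin A) n) → IsPermutation σ → Sorted σ N →
                      ∃[ a ] encode a ≡ (σ , N)
  encode-surjective σ N σ-perm sorted = a , cong₂ _,_
    (trans (Vec.tabulate-cong σ-eq) (Vec.tabulate∘lookup σ))
    (trans (Vec.tabulate-cong (λ i → trans (cong (lookup a) (σ-eq i)) (a-σ i))) (Vec.tabulate∘lookup N))
    where
    π : Permutation n n
    π = toPermutation {f = lookup σ} (λ {i} {j} → VecUnique.lookup-injective σ-perm i j)
    a = Vec.tabulate (λ p → lookup N (π ⟨$⟩ˡ p))
    a-σ : ∀ i → lookup a (lookup σ i) ≡ lookup N i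
    a-σ i = trans (Vec.lookup∘tabulate (λ p → lookup N (π ⟨$⟩ˡ p)) (lookup σ i)) (cong (lookup N) (inverseˡ π {i}))
    rank-σ : ∀ i → rank a (lookup σ i) ≡ toℕ i
    rank-σ = sorted⇒rank a π (λ {i} {j} i<j → subst₂ (λ x y → toℕ x < toℕ y ⊎ (x ≡ y × toℕ (lookup σ i) < toℕ (lookup σ j)))
      (sym (a-σ j)) (sym (a-σ i)) (sorted i<j))
    σ-eq : ∀ i → sortingWord a i ≡ lookup σ i
    σ-eq i = trans (cong (sortingWord a) (Fin.toℕ-injective (trans (sym (rank-σ i)) (sym (Fin.toℕ-fromℕ< (rank<n a (lookup σ i)))))))
      (sortingWord-rank a (lookup σ i))

-- Excedances of the sorting permutation

module ExcedanceWeight {A : ℕ} (wd we : Fin A → ℤ) where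

  open Weights wd we using (weight)
  open WordWeight wd we

  pairWeight : ∀ {n} → Vec (Fin n) n × Vec (Fin A) n → ℤ
  pairWeight (σ , N) = ∏ (λ i → weight (does (i ≺? lookup σ i)) (lookup N i))

  earlier : ∀ {n} → Vec (Fin A) n → Fin n → ℕ
  earlier a p = ∑ⁿ (λ q → if does (q ≺? p) then e (lookup a p) (lookup a q) else 0)

  scan-toList : ∀ {n} s P (a : Vec (Fin A) n) → scan s P (Vec.toList a) ≡
    ∏ (λ p → weight (does (s (lookup a p) + (count (lookup a p) P + earlier a p) ℕ.<? length P + toℕ p)) (lookup a p))
  scan-toList s P []      = refl
  scan-toList {suc n} s P (b ∷ a) = cong₂ ℤ._*_
    (cong₂ (λ i j → weight (does (s b + i ℕ.<? j)) b)
      (sym (trans (cong (count b P +_) (∑ⁿ-zero n)) (ℕ.+-identityʳ _))) (sym (ℕ.+-identityʳ (length P))))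
    (trans (scan-toList s (P ∷ʳ b) a) (∏-cong (λ p → cong₂ (λ i j → weight (does (s (lookup a p) + i ℕ.<? j)) (lookup a p))
      (trans (cong (_+ earlier a p) (trans (count-∷ʳ (lookup a p) P b) (ℕ.+-comm (e (lookup a p) b) _)))
        (ℕ.+-assoc (count (lookup a p) P) (e (lookup a p) b) (earlier a p)))
      (trans (cong (_+ toℕ p) (length-∷ʳ P b)) (sym (ℕ.+-suc (length P) (toℕ p)))))))

  above-toList : ∀ {n} (a : Vec (Fin A) n) x → above (Vec.toList a) x ≡ ∑ⁿ (λ q → ind (x ≺? lookup a q))
  above-toList []      x = trans (∑ⁿ-cong (λ y → if-same (does (x ≺? y)) 0)) (∑ⁿ-zero A)
  above-toList (b ∷ a) x = trans (∑ⁿ-changeAt b (ind (x ≺? b)) at other) (cong (ind (x ≺? b) +_) (above-toList a x))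
    where
    at : (if does (x ≺? b) then count b (b ∷ Vec.toList a) else 0) ≡
         ind (x ≺? b) + (if does (x ≺? b) then count b (Vec.toList a) else 0)
    at with does (x ≺? b)
    ... | true  = cong (_+ count b (Vec.toList a)) (e-refl b)
    ... | false = refl
    other : ∀ y → y ≢ b → (if does (x ≺? y) then count y (b ∷ Vec.toList a) else 0) ≡
                           (if does (x ≺? y) then count y (Vec.toList a) else 0)
    other y y≢b = cong (λ k → if does (x ≺? y) then k + count y (Vec.toList a) else 0) (e-≢ y≢b)

  -- The predecessors of `p` are the larger letters anywhere and the equal letters to its left, two
  -- disjoint sets.
  above+earlier : ∀ {n} (a : Vec (Fin A) n) p → above (Vec.toList a) (lookup a p) + earlier a p ≡ rank a p
  above+earlier a p = trans (cong (_+ earlier a p) (above-toList a (lookup a p)))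
    (trans (sym (∑ⁿ-+ (λ q → ind (lookup a p ≺? lookup a q)) (λ q → if does (q ≺? p) then e (lookup a p) (lookup a q) else 0)))
      (∑ⁿ-cong (λ q → disjoint (does (lookup a p ≺? lookup a q)) (does (q ≺? p)) (lookup a p Fin.≟ lookup a q)
        (λ eq → dec-false (lookup a p ≺? lookup a q) (ℕ.<-irrefl (cong toℕ eq))))))
    where
    disjoint : ∀ {X : Set} b c (d : Dec X) → (X → b ≡ false) →
      (if b then 1 else 0) + (if c then (if does d then 1 else 0) else 0) ≡ (if b ∨ does d ∧ c then 1 else 0)
    disjoint false true  (yes x) _    = refl
    disjoint false false (yes x) _    = refl
    disjoint true  c     (yes x) excl = contradiction (excl x) λ ()
    disjoint true  true  (no _)  _    = refl
    disjoint true  false (no _)  _    = refl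
    disjoint false true  (no _)  _    = refl
    disjoint false false (no _)  _    = refl

  -- The position σ i has rank `i`. Reindexing by it turns "rank below position" into `i < σ i`.
  wordWeight-encode : ∀ {n} (a : Vec (Fin A) n) → wordWeight (Vec.toList a) ≡ pairWeight (encode a)
  wordWeight-encode a = begin
    wordWeight (Vec.toList a)
      ≡⟨ scan-toList (above (Vec.toList a)) [] a ⟩
    ∏ (λ p → weight (does (above (Vec.toList a) (lookup a p) + earlier a p ℕ.<? toℕ p)) (lookup a p))
      ≡⟨ ∏-cong (λ p → cong (λ k → weight (does (k ℕ.<? toℕ p)) (lookup a p)) (above+earlier a p)) ⟩
    ∏ (λ p → weight (does (rank a p ℕ.<? toℕ p)) (lookup a p))
      ≡⟨ ∏-permute (λ p → weight (does (rank a p ℕ.<? toℕ p)) (lookup a p)) (flip (sorting a)) ⟩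
    ∏ (λ i → weight (does (rank a (sortingWord a i) ℕ.<? toℕ (sortingWord a i))) (lookup a (sortingWord a i)))
      ≡⟨ ∏-cong (λ i → cong (λ b → weight b (lookup a (sortingWord a i)))
           (cong₂ (λ k z → does (k ℕ.<? toℕ z)) (rank-sortingWord a i) (sym (Vec.lookup∘tabulate (sortingWord a) i)))) ⟩
    ∏ (λ i → weight (does (i ≺? lookup (proj₁ (encode a)) i)) (lookup a (sortingWord a i)))
      ≡⟨ ∏-cong (λ i → cong (weight (does (i ≺? lookup (proj₁ (encode a)) i)))
           (sym (Vec.lookup∘tabulate (λ i → lookup a (sortingWord a i)) i))) ⟩
    pairWeight (encode a) ∎
    where open ≡-Reasoning

  ∑-pairs : ∀ n (sorted? : ∀ w → Dec (Sorted {A} {n} {n} (proj₁ w) (proj₂ w))) →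
    ∑ˡ pairWeight (List.filter sorted? (List.cartesianProduct (permutations n) (words A n))) ≡
    ∑ʷ A n wordWeight
  ∑-pairs n sorted? = begin
    ∑ˡ pairWeight pairs ≡⟨ ∑ˡ-↭ pairWeight pairs↭ ⟩
    ∑ˡ pairWeight (map encode (words A n)) ≡⟨ ∑ˡ-map pairWeight encode (words A n) ⟩
    ∑ˡ (pairWeight ∘ encode) (words A n) ≡⟨ ∑ˡ-cong (words A n) (λ a _ → sym (wordWeight-encode a)) ⟩
    ∑ˡ (wordWeight ∘ Vec.toList) (words A n) ≡⟨ ∑ˡ-words A n wordWeight ⟩
    ∑ʷ A n wordWeight ∎
    where
    open ≡-Reasoning
    pairs = List.filter sorted? (List.cartesianProduct (permutations n) (words A n))
    member : ∀ {w} → w ∈ pairs ⇔ w ∈ map encode (words A n)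
    member {σ , N} = mk⇔ to from
      where
      to : (σ , N) ∈ pairs → (σ , N) ∈ map encode (words A n)
      to w∈ with ∈.∈-filter⁻ sorted? {xs = List.cartesianProduct (permutations n) (words A n)} w∈
      ... | w∈prod , sorted with ∈.∈-cartesianProduct⁻ (permutations n) (words A n) w∈prod
      ...   | σ∈ , _ with encode-surjective σ N (proj₂ (∈.∈-filter⁻ isPermutation? {xs = words n n} σ∈)) sorted
      ...     | a , eq = subst (_∈ map encode (words A n)) eq (∈.∈-map⁺ encode (words-complete a))
      from : (σ , N) ∈ map encode (words A n) → (σ , N) ∈ pairs
      from w∈ with ∈.∈-map⁻ encode w∈
      ... | a , _ , refl = ∈.∈-filter⁺ sorted?
            (∈.∈-cartesianProduct⁺ (∈.∈-filter⁺ isPermutation? (words-complete (proj₁ (encode a))) (encode-permutation a)) (words-complete (proj₂ (encode a))))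
            (encode-sorted a)
    pairs↭ : pairs ↭ map encode (words A n)
    pairs↭ = ∼bag⇒↭ (unique∧set⇒bag
      (Unique.filter⁺ sorted? (Unique.cartesianProduct⁺ (Unique.filter⁺ isPermutation? (words-unique n n)) (words-unique A n)))
      (Unique.map⁺ encode-injective (words-unique A n))
      member)

-- Sorted sequences with prescribed residues

∑-++ : ∀ k m (f : ℕ → ℤ) → ∑ {k + m} (f ∘ toℕ) ≡ ∑ {k} (f ∘ toℕ) ℤ.+ ∑ {m} (λ i → f (k + toℕ i))
∑-++ zero    m f = sym (ℤ.+-identityˡ _)
∑-++ (suc k) m f = trans (cong (ℤ._+_ (f 0)) (∑-++ k m (f ∘ suc)))
  (sym (ℤ.+-assoc (f 0) (∑ {k} (f ∘ suc ∘ toℕ)) (∑ {m} (λ i → f (suc (k + toℕ i))))))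

∑-blocks : ∀ q r (f : ℕ → ℤ) → ∑ {q * r} (f ∘ toℕ) ≡ ∑ {q} (λ i → ∑ {r} (λ c → f (toℕ c + toℕ i * r)))
∑-blocks zero    r f = refl
∑-blocks (suc q) r f = trans (∑-++ r (q * r) f) (cong₂ ℤ._+_
  (∑-cong {r} (λ c → cong f (sym (ℕ.+-identityʳ (toℕ c)))))
  (trans (∑-blocks q r (λ j → f (r + j)))
    (∑-cong {q} (λ i → ∑-cong {r} (λ c → cong f (exchange r (toℕ c) (toℕ i * r)))))))
  where
  exchange : ∀ a b c → a + (b + c) ≡ b + (a + c)
  exchange = ℕSolver.solve-∀

∑-restrict : ∀ {k K} (f : ℕ → ℤ) → k ≤ K →
             ∑ {K} (λ i → if does (toℕ i ℕ.<? k) then f (toℕ i) else 0ℤ) ≡ ∑ {k} (f ∘ toℕ)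
∑-restrict {zero}  {K}     f _         = ∑-≡0 {K} (λ i → refl)
∑-restrict {suc k} {suc K} f (s≤s k≤K) = cong (ℤ._+_ (f 0)) (∑-restrict (f ∘ suc) k≤K)

∑ˡ-zero : ∀ {a} {X : Set a} (xs : List X) → ∑ˡ (λ _ → 0ℤ) xs ≡ 0ℤ
∑ˡ-zero []       = refl
∑ˡ-zero (x ∷ xs) = trans (ℤ.+-identityˡ _) (∑ˡ-zero xs)

∑ˡ-∑ : ∀ {a} {X : Set a} {k} (f : X → Fin k → ℤ) xs → ∑ˡ (λ x → ∑ (f x)) xs ≡ ∑ (λ i → ∑ˡ (λ x → f x i) xs)
∑ˡ-∑ {k = k} f []       = sym (∑-zero k)
∑ˡ-∑         f (x ∷ xs) = trans (cong (ℤ._+_ (∑ (f x))) (∑ˡ-∑ f xs)) (sym (∑-+ (f x) (λ i → ∑ˡ (λ x → f x i) xs)))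

pos-∑ : ∀ {n} (f : Fin n → ℕ) → pos (∑ⁿ f) ≡ ∑ (pos ∘ f)
pos-∑ {zero}  f = refl
pos-∑ {suc n} f = trans (ℤ.pos-+ (f zero) (∑ⁿ (f ∘ suc))) (cong (ℤ._+_ (pos (f zero))) (pos-∑ (f ∘ suc)))

Step : ℕ → ℕ → ℕ → ℕ → Set
Step N₀ s₀ N s = N < N₀ ⊎ (N ≡ N₀ × s₀ < s)

step? : ∀ N₀ s₀ N s → Dec (Step N₀ s₀ N s)
step? N₀ s₀ N s = (N ℕ.<? N₀) ⊎-dec ((N ℕ.≟ N₀) ×-dec (s₀ ℕ.<? s))

step-trans : ∀ {N s N′ s′ N″ s″} → Step N s N′ s′ → Step N′ s′ N″ s″ → Step N s N″ s″
step-trans (inj₁ lt)          (inj₁ lt′)          = inj₁ (ℕ.<-trans lt′ lt)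
step-trans (inj₁ lt)          (inj₂ (refl , _))   = inj₁ lt
step-trans (inj₂ (refl , _))  (inj₁ lt)           = inj₁ lt
step-trans (inj₂ (refl , lt)) (inj₂ (refl , lt′)) = inj₂ (refl , ℕ.<-trans lt lt′)

-- The letters are shifted by one, so that 0 can precede all of them.
Chain : ∀ {A m n} → ℕ → ℕ → Vec (Fin m) n → Vec (Fin A) n → Set
Chain N₀ s₀ []      []       = ⊤
Chain N₀ s₀ (s ∷ σ) (N ∷ Ns) = Step N₀ s₀ (toℕ N) (suc (toℕ s)) × Chain (toℕ N) (suc (toℕ s)) σ Ns

chain? : ∀ {A m n} N₀ s₀ (σ : Vec (Fin m) n) (N : Vec (Fin A) n) → Dec (Chain N₀ s₀ σ N)
chain? N₀ s₀ []      []       = yes tt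
chain? N₀ s₀ (s ∷ σ) (N ∷ Ns) = step? N₀ s₀ (toℕ N) (suc (toℕ s)) ×-dec chain? (toℕ N) (suc (toℕ s)) σ Ns

chain⇒steps : ∀ {A m n N₀ s₀} (σ : Vec (Fin m) n) (N : Vec (Fin A) n) → Chain N₀ s₀ σ N →
              ∀ i → Step N₀ s₀ (toℕ (lookup N i)) (suc (toℕ (lookup σ i)))
chain⇒steps (s ∷ σ) (N ∷ Ns) (st , ch) zero    = st
chain⇒steps (s ∷ σ) (N ∷ Ns) (st , ch) (suc i) = step-trans st (chain⇒steps σ Ns ch i)

chain⇒sorted : ∀ {A m n N₀ s₀} (σ : Vec (Fin m) n) (N : Vec (Fin A) n) → Chain N₀ s₀ σ N → Sorted σ N
chain⇒sorted (s ∷ σ) (N ∷ Ns) (st , ch) {zero}  {suc j} _ with chain⇒steps σ Ns ch j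
... | inj₁ lt        = inj₁ lt
... | inj₂ (eq , lt) = inj₂ (Fin.toℕ-injective eq , ℕ.s≤s⁻¹ lt)
chain⇒sorted (s ∷ σ) (N ∷ Ns) (st , ch) {suc i} {suc j} (s≤s i<j) = chain⇒sorted σ Ns ch i<j

sorted⇒chain : ∀ {A m n N₀ s₀} (σ : Vec (Fin m) n) (N : Vec (Fin A) n) → Sorted σ N →
               (∀ i → Step N₀ s₀ (toℕ (lookup N i)) (suc (toℕ (lookup σ i)))) → Chain N₀ s₀ σ N
sorted⇒chain []      []       sorted st = tt
sorted⇒chain (s ∷ σ) (N ∷ Ns) sorted st = st zero ,
  sorted⇒chain σ Ns (λ {i} {j} i<j → sorted {suc i} {suc j} (s≤s i<j)) next
  where
  next : ∀ i → Step (toℕ N) (suc (toℕ s)) (toℕ (lookup Ns i)) (suc (toℕ (lookup σ i)))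
  next i with sorted {zero} {suc i} (s≤s z≤n)
  ... | inj₁ lt        = inj₁ lt
  ... | inj₂ (eq , lt) = inj₂ (cong toℕ eq , s≤s lt)

-- The case in which a step between these residues forces the quotient by `r` to drop. The tie is
-- stated as the negation of that in `Step`.
Descent : ℕ → ℕ → ℕ → ℕ → Set
Descent c₀ s₀ c s = c₀ < c ⊎ (c₀ ≡ c × ¬ (s₀ < s))

descent? : ∀ c₀ s₀ c s → Dec (Descent c₀ s₀ c s)
descent? c₀ s₀ c s = (c₀ ℕ.<? c) ⊎-dec ((c₀ ℕ.≟ c) ×-dec ¬? (s₀ ℕ.<? s))

descends : ∀ {r m} → ℕ → ℕ → Fin r → Fin m → Bool
descends c₀ s₀ c s = does (descent? c₀ s₀ (toℕ c) (suc (toℕ s)))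

bound : Bool → ℕ → ℕ
bound b q = if b then q else suc q

-- The number of chains N starting below c₀ + q r whose residues modulo r are c.
ways : ∀ {r m n} → ℕ → ℕ → Vec (Fin m) n → Vec (Fin r) n → ℕ → ℕ
ways c₀ s₀ []      []       q = 1
ways c₀ s₀ (s ∷ σ) (c ∷ cs) q =
  ∑ⁿ {bound (descends c₀ s₀ c s) q} (λ i → ways (toℕ c) (suc (toℕ s)) σ cs (toℕ i))

chains : ∀ {r n} → ℕ → Vec (Fin n) n × Vec (Fin r) n → ℕ
chains t w = ways 0 0 (proj₁ w) (proj₂ w) t

module Chains (r′ t : ℕ) where

  r : ℕ
  r = suc r′

  colour : ∀ {A} → Fin A → Fin r
  colour N = toℕ N ℕ.mod r

  toℕ-mod : ∀ m → toℕ (m ℕ.mod r) ≡ m ℕ.% r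
  toℕ-mod m = Fin.toℕ-fromℕ< (ℕ.m%n<n m r)

  %-block : ∀ (c : Fin r) i → (toℕ c + i * r) ℕ.% r ≡ toℕ c
  %-block c i = trans (ℕ.[m+kn]%n≡m%n (toℕ c) i r) (ℕ.m<n⇒m%n≡m (Fin.toℕ<n c))

  mod-block : ∀ (c : Fin r) i → (toℕ c + i * r) ℕ.mod r ≡ c
  mod-block c i = Fin.toℕ-injective (trans (toℕ-mod (toℕ c + i * r)) (%-block c i))

  /-block : ∀ (c : Fin r) i → (toℕ c + i * r) ℕ./ r ≡ i
  /-block c i = trans (ℕ.+-distrib-/-∣ʳ (toℕ c) (ℕ.divides i refl))
    (cong₂ _+_ (ℕ.m<n⇒m/n≡0 (Fin.toℕ<n c)) (ℕ.m*n/n≡m i r))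

  step-block : ∀ {c₀ q₀ s₀ c i s} → c₀ < r → c < r →
    does (step? (c₀ + q₀ * r) s₀ (c + i * r) s) ≡ does (i ℕ.<? bound (does (descent? c₀ s₀ c s)) q₀)
  step-block {c₀} {q₀} {s₀} {c} {i} {s} c₀<r c<r with descent? c₀ s₀ c s
  ... | yes desc = trans (does-⇔ (mk⇔ to from) (step? (c₀ + q₀ * r) s₀ (c + i * r) s) (i ℕ.<? q₀))
    (cong (λ b → does (i ℕ.<? bound b q₀)) (sym (dec-true (descent? c₀ s₀ c s) desc)))
    where
    excluded : q₀ ≤ i → Descent c₀ s₀ c s → ¬ Step (c₀ + q₀ * r) s₀ (c + i * r) s
    excluded q₀≤i (inj₁ c₀<c)         (inj₁ lt)       = ℕ.<-asym lt (ℕ.+-mono-<-≤ c₀<c (ℕ.*-monoˡ-≤ r q₀≤i))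
    excluded q₀≤i (inj₁ c₀<c)         (inj₂ (eq , _)) = ℕ.<-irrefl (sym eq) (ℕ.+-mono-<-≤ c₀<c (ℕ.*-monoˡ-≤ r q₀≤i))
    excluded q₀≤i (inj₂ (refl , ¬lt)) (inj₁ lt)       = ℕ.<⇒≱ lt (ℕ.+-monoʳ-≤ c₀ (ℕ.*-monoˡ-≤ r q₀≤i))
    excluded q₀≤i (inj₂ (refl , ¬lt)) (inj₂ (_ , lt)) = ¬lt lt
    to : Step (c₀ + q₀ * r) s₀ (c + i * r) s → i < q₀
    to st = ℕ.≰⇒> (λ q₀≤i → excluded q₀≤i desc st)
    from : i < q₀ → Step (c₀ + q₀ * r) s₀ (c + i * r) s
    from i<q₀ = inj₁ (ℕ.≤-trans (ℕ.+-monoˡ-< (i * r) c<r) (ℕ.≤-trans (ℕ.*-monoˡ-≤ r i<q₀) (ℕ.m≤n+m (q₀ * r) c₀)))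
  ... | no ¬desc = trans (does-⇔ (mk⇔ to from) (step? (c₀ + q₀ * r) s₀ (c + i * r) s) (i ℕ.<? suc q₀))
    (cong (λ b → does (i ℕ.<? bound b q₀)) (sym (dec-false (descent? c₀ s₀ c s) ¬desc)))
    where
    excluded : q₀ < i → ¬ Step (c₀ + q₀ * r) s₀ (c + i * r) s
    excluded q₀<i st = not-above st (ℕ.≤-trans (ℕ.+-monoˡ-< (q₀ * r) c₀<r)
      (ℕ.≤-trans (ℕ.*-monoˡ-≤ r q₀<i) (ℕ.m≤n+m (i * r) c)))
      where
      not-above : Step (c₀ + q₀ * r) s₀ (c + i * r) s → ¬ (c₀ + q₀ * r < c + i * r)
      not-above (inj₁ lt)       gt = ℕ.<-asym lt gt
      not-above (inj₂ (eq , _)) gt = ℕ.<-irrefl (sym eq) gt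
    to : Step (c₀ + q₀ * r) s₀ (c + i * r) s → i < suc q₀
    to st = s≤s (ℕ.≮⇒≥ (λ q₀<i → excluded q₀<i st))
    c≤c₀ : c ≤ c₀
    c≤c₀ = ℕ.≮⇒≥ (¬desc ∘ inj₁)
    from : i < suc q₀ → Step (c₀ + q₀ * r) s₀ (c + i * r) s
    from (s≤s i≤q₀) with ℕ.m≤n⇒m<n∨m≡n (ℕ.+-mono-≤ c≤c₀ (ℕ.*-monoˡ-≤ r i≤q₀))
    ... | inj₁ lt = inj₁ lt
    ... | inj₂ eq with s₀ ℕ.<? s
    ...   | yes s₀<s = inj₂ (eq , s₀<s)
    ...   | no  s₀≮s = contradiction (inj₂ (ℕ.≤-antisym c₀≤c c≤c₀ , s₀≮s)) ¬desc
      where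
      c₀≤c : c₀ ≤ c
      c₀≤c = ℕ.+-cancelʳ-≤ (i * r) c₀ c
        (ℕ.≤-trans (ℕ.+-monoʳ-≤ c₀ (ℕ.*-monoˡ-≤ r i≤q₀)) (ℕ.≤-reflexive (sym eq)))

  if-∧ : ∀ b d (z : ℤ) → (if b ∧ d then z else 0ℤ) ≡ (if b then (if d then z else 0ℤ) else 0ℤ)
  if-∧ true  d z = refl
  if-∧ false d z = refl

  if-∑ˡ : ∀ {a} {X : Set a} b (f : X → ℤ) xs → ∑ˡ (λ x → if b then f x else 0ℤ) xs ≡ (if b then ∑ˡ f xs else 0ℤ)
  if-∑ˡ true  f xs = refl
  if-∑ˡ false f xs = ∑ˡ-zero xs

  -- The letters 0, ..., t r fill `t` blocks and begin another. Padding by `r′` letters that no step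
  -- reaches completes it, so that quotient and residue can be summed independently.
  ∑-letters : ∀ {c₀ q₀ s₀ s} (g : Fin r → ℕ → ℤ) → c₀ < r → c₀ + q₀ * r ≤ t * r →
    ∑ {suc (t * r)} (λ N → if does (step? (c₀ + q₀ * r) s₀ (toℕ N) s) then g (colour N) (toℕ N ℕ./ r) else 0ℤ) ≡
    ∑ (λ c → ∑ {bound (does (descent? c₀ s₀ (toℕ c) s)) q₀} (λ i → g c (toℕ i)))
  ∑-letters {c₀} {q₀} {s₀} {s} g c₀<r N₀≤ = begin
    ∑ {suc (t * r)} (h ∘ toℕ)
      ≡⟨ ℤ.+-identityʳ _ ⟨
    ∑ {suc (t * r)} (h ∘ toℕ) ℤ.+ 0ℤ
      ≡⟨ cong (ℤ._+_ (∑ {suc (t * r)} (h ∘ toℕ))) (∑-≡0 {r′} (λ i → h-large (suc (t * r) + toℕ i) (s≤s (ℕ.m≤m+n (t * r) (toℕ i))))) ⟨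
    ∑ {suc (t * r)} (h ∘ toℕ) ℤ.+ ∑ {r′} (λ i → h (suc (t * r) + toℕ i))
      ≡⟨ ∑-++ (suc (t * r)) r′ h ⟨
    ∑ {suc (t * r) + r′} (h ∘ toℕ)
      ≡⟨ cong (λ k → ∑ {k} (h ∘ toℕ)) (cong suc (ℕ.+-comm (t * r) r′)) ⟩
    ∑ {suc t * r} (h ∘ toℕ)
      ≡⟨ ∑-blocks (suc t) r h ⟩
    ∑ {suc t} (λ i → ∑ {r} (λ c → h (toℕ c + toℕ i * r)))
      ≡⟨ ∑-comm {suc t} {r} (λ i c → h (toℕ c + toℕ i * r)) ⟩
    ∑ {r} (λ c → ∑ {suc t} (λ i → h (toℕ c + toℕ i * r)))
      ≡⟨ ∑-cong {r} (λ c → trans (∑-cong {suc t} (λ i → h-block c (toℕ i))) (∑-restrict (g c) (bound≤ c))) ⟩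
    ∑ (λ c → ∑ {bound (does (descent? c₀ s₀ (toℕ c) s)) q₀} (λ i → g c (toℕ i))) ∎
    where
    open ≡-Reasoning
    h : ℕ → ℤ
    h N = if does (step? (c₀ + q₀ * r) s₀ N s) then g (N ℕ.mod r) (N ℕ./ r) else 0ℤ
    h-large : ∀ N → t * r < N → h N ≡ 0ℤ
    h-large N big = cong (λ b → if b then g (N ℕ.mod r) (N ℕ./ r) else 0ℤ)
      (dec-false (step? (c₀ + q₀ * r) s₀ N s) λ where
        (inj₁ lt)         → ℕ.<-asym lt (ℕ.≤-<-trans N₀≤ big)
        (inj₂ (refl , _)) → ℕ.<⇒≱ big N₀≤)
    h-block : ∀ c i → h (toℕ c + i * r) ≡ (if does (i ℕ.<? bound (does (descent? c₀ s₀ (toℕ c) s)) q₀) then g c i else 0ℤ)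
    h-block c i = trans
      (cong₂ (λ c′ i′ → if does (step? (c₀ + q₀ * r) s₀ (toℕ c + i * r) s) then g c′ i′ else 0ℤ) (mod-block c i) (/-block c i))
      (cong (λ b → if b then g c i else 0ℤ) (step-block {c₀} {q₀} {s₀} {toℕ c} {i} {s} c₀<r (Fin.toℕ<n c)))
    q₀≤t : q₀ ≤ t
    q₀≤t = ℕ.*-cancelʳ-≤ q₀ t r (ℕ.≤-trans (ℕ.m≤n+m (q₀ * r) c₀) N₀≤)
    bound≤ : ∀ c → bound (does (descent? c₀ s₀ (toℕ c) s)) q₀ ≤ suc t
    bound≤ c with does (descent? c₀ s₀ (toℕ c) s)
    ... | true  = ℕ.m≤n⇒m≤1+n q₀≤t
    ... | false = s≤s q₀≤t

  -- The weight `φ` is arbitrary because the induction absorbs the first colour into it.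
  ∑-chains : ∀ {m n} (σ : Vec (Fin m) n) {c₀ q₀} s₀ (φ : Vec (Fin r) n → ℤ) → c₀ < r → c₀ + q₀ * r ≤ t * r →
    ∑ˡ (λ N → if does (chain? (c₀ + q₀ * r) s₀ σ N) then φ (Vec.map colour N) else 0ℤ) (words (suc (t * r)) n) ≡
    ∑ˡ (λ c → φ c ℤ.* pos (ways c₀ s₀ σ c q₀)) (words r n)
  ∑-chains []      s₀ φ c₀<r N₀≤ = cong (ℤ._+ 0ℤ) (sym (ℤ.*-identityʳ (φ [])))
  ∑-chains {n = suc n} (s ∷ σ) {c₀} {q₀} s₀ φ c₀<r N₀≤ = begin
    ∑ˡ (λ N → if does (chain? N₀ s₀ (s ∷ σ) N) then φ (Vec.map colour N) else 0ℤ) (words A (suc n))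
      ≡⟨ ∑ˡ-words-suc A n (λ N → if does (chain? N₀ s₀ (s ∷ σ) N) then φ (Vec.map colour N) else 0ℤ) ⟩
    ∑ {A} (λ N → ∑ˡ (λ Ns → if does (step? N₀ s₀ (toℕ N) s⁺) ∧ does (chain? (toℕ N) s⁺ σ Ns)
                             then φ (colour N ∷ Vec.map colour Ns) else 0ℤ) (words A n))
      ≡⟨ ∑-cong {A} first-letter ⟩
    ∑ {A} (λ N → if does (step? N₀ s₀ (toℕ N) s⁺) then g (colour N) (toℕ N ℕ./ r) else 0ℤ)
      ≡⟨ ∑-letters {c₀} {q₀} {s₀} {s⁺} g c₀<r N₀≤ ⟩
    ∑ (λ c → ∑ {K c} (λ i → g c (toℕ i)))
      ≡⟨ ∑-cong {r} (λ c → sym (first-colour c)) ⟩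
    ∑ (λ c → ∑ˡ (λ cs → φ (c ∷ cs) ℤ.* pos (ways c₀ s₀ (s ∷ σ) (c ∷ cs) q₀)) (words r n))
      ≡⟨ ∑ˡ-words-suc r n (λ c → φ c ℤ.* pos (ways c₀ s₀ (s ∷ σ) c q₀)) ⟨
    ∑ˡ (λ c → φ c ℤ.* pos (ways c₀ s₀ (s ∷ σ) c q₀)) (words r (suc n)) ∎
    where
    open ≡-Reasoning
    A = suc (t * r)
    N₀ = c₀ + q₀ * r
    s⁺ = suc (toℕ s)
    K : Fin r → ℕ
    K c = bound (does (descent? c₀ s₀ (toℕ c) s⁺)) q₀
    g : Fin r → ℕ → ℤ
    g c q = ∑ˡ (λ cs → φ (c ∷ cs) ℤ.* pos (ways (toℕ c) s⁺ σ cs q)) (words r n)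
    N-split : ∀ (N : Fin A) → toℕ (colour N) + toℕ N ℕ./ r * r ≡ toℕ N
    N-split N = trans (cong (_+ toℕ N ℕ./ r * r) (toℕ-mod (toℕ N))) (sym (ℕ.m≡m%n+[m/n]*n (toℕ N) r))
    first-letter : ∀ (N : Fin A) → ∑ˡ (λ Ns → if does (step? N₀ s₀ (toℕ N) s⁺) ∧ does (chain? (toℕ N) s⁺ σ Ns)
        then φ (colour N ∷ Vec.map colour Ns) else 0ℤ) (words A n) ≡
      (if does (step? N₀ s₀ (toℕ N) s⁺) then g (colour N) (toℕ N ℕ./ r) else 0ℤ)
    first-letter N = trans
      (∑ˡ-cong (words A n) (λ Ns _ → if-∧ (does (step? N₀ s₀ (toℕ N) s⁺)) (does (chain? (toℕ N) s⁺ σ Ns)) (φ (colour N ∷ Vec.map colour Ns))))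
      (trans (if-∑ˡ (does (step? N₀ s₀ (toℕ N) s⁺)) (λ Ns → if does (chain? (toℕ N) s⁺ σ Ns) then φ (colour N ∷ Vec.map colour Ns) else 0ℤ) (words A n))
        (cong (λ z → if does (step? N₀ s₀ (toℕ N) s⁺) then z else 0ℤ)
          (trans (cong (λ k → ∑ˡ (λ Ns → if does (chain? k s⁺ σ Ns) then φ (colour N ∷ Vec.map colour Ns) else 0ℤ) (words A n)) (sym (N-split N)))
            (∑-chains σ {toℕ (colour N)} {toℕ N ℕ./ r} s⁺ (λ cs → φ (colour N ∷ cs)) (Fin.toℕ<n (colour N))
              (ℕ.≤-trans (ℕ.≤-reflexive (N-split N)) (ℕ.s≤s⁻¹ (Fin.toℕ<n N)))))))
    first-colour : ∀ c → ∑ˡ (λ cs → φ (c ∷ cs) ℤ.* pos (ways c₀ s₀ (s ∷ σ) (c ∷ cs) q₀)) (words r n) ≡ ∑ {K c} (λ i → g c (toℕ i))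
    first-colour c = trans
      (∑ˡ-cong (words r n) (λ cs _ → trans
        (cong (φ (c ∷ cs) ℤ.*_) (pos-∑ {K c} (λ i → ways (toℕ c) s⁺ σ cs (toℕ i))))
        (*-distribˡ-∑ {K c} (φ (c ∷ cs)) (λ i → pos (ways (toℕ c) s⁺ σ cs (toℕ i))))))
      (∑ˡ-∑ {k = K c} (λ cs i → φ (c ∷ cs) ℤ.* pos (ways (toℕ c) s⁺ σ cs (toℕ i))) (words r n))

-- The flag excedance statistic as an exponent

count-tabulate : ∀ {a p} {X : Set a} {P : X → Set p} (P? : ∀ x → Dec (P x)) {n} (f : Fin n → X) →
                 Vec.count P? (Vec.tabulate f) ≡ ∑ⁿ (λ i → ind (P? (f i)))
count-tabulate P? {zero}  f = refl
count-tabulate P? {suc n} f with does (P? (f zero))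
... | true  = cong suc (count-tabulate P? (f ∘ suc))
... | false = count-tabulate P? (f ∘ suc)

sum-toℕ : ∀ {r n} (c : Vec (Fin r) n) → Vec.sum (Vec.map toℕ c) ≡ ∑ⁿ (λ i → toℕ (lookup c i))
sum-toℕ []      = refl
sum-toℕ (b ∷ c) = cong (toℕ b +_) (sum-toℕ c)

-- An uncoloured excedance contributes `r` in place of its colour 0, as in the exponent of `we`.
fexc-∑ : ∀ {r n} (σ : Vec (Fin n) n) (c : Vec (Fin r) n) → fexc (σ , c) ≡
  ∑ⁿ (λ i → if does (i ≺? lookup σ i) then (if does (toℕ (lookup c i) ℕ.≟ 0) then r else toℕ (lookup c i)) else toℕ (lookup c i))
fexc-∑ {r} {n} σ c = begin
  r * Vec.count (isUncoloredExcedance? σ c) (Vec.allFin n) + Vec.sum (Vec.map toℕ c)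
    ≡⟨ cong₂ (λ k s → r * k + s) (count-tabulate (isUncoloredExcedance? σ c) id) (sum-toℕ c) ⟩
  r * ∑ⁿ (λ i → ind (isUncoloredExcedance? σ c i)) + ∑ⁿ (λ i → toℕ (lookup c i))
    ≡⟨ cong (_+ ∑ⁿ (λ i → toℕ (lookup c i))) (*-distribˡ-∑ⁿ {n} r (λ i → ind (isUncoloredExcedance? σ c i))) ⟩
  ∑ⁿ (λ i → r * ind (isUncoloredExcedance? σ c i)) + ∑ⁿ (λ i → toℕ (lookup c i))
    ≡⟨ ∑ⁿ-+ (λ i → r * ind (isUncoloredExcedance? σ c i)) (λ i → toℕ (lookup c i)) ⟨
  ∑ⁿ (λ i → r * ind (isUncoloredExcedance? σ c i) + toℕ (lookup c i))
    ≡⟨ ∑ⁿ-cong (λ i → per-letter (does (i ≺? lookup σ i)) (toℕ (lookup c i))) ⟩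
  ∑ⁿ (λ i → if does (i ≺? lookup σ i) then (if does (toℕ (lookup c i) ℕ.≟ 0) then r else toℕ (lookup c i)) else toℕ (lookup c i)) ∎
  where
  open ≡-Reasoning
  per-letter : ∀ b c → r * (if b ∧ does (c ℕ.≟ 0) then 1 else 0) + c ≡ (if b then (if does (c ℕ.≟ 0) then r else c) else c)
  per-letter true  zero    = trans (ℕ.+-identityʳ (r * 1)) (ℕ.*-identityʳ r)
  per-letter true  (suc c) = cong (_+ suc c) (ℕ.*-zeroʳ r)
  per-letter false c       = cong (_+ c) (ℕ.*-zeroʳ r)

∏-^ : ∀ y {n} (k : Fin n → ℕ) → ∏ (λ i → y ℤ.^ k i) ≡ y ℤ.^ ∑ⁿ k
∏-^ y {zero}  k = refl
∏-^ y {suc n} k = trans (cong (y ℤ.^ k zero ℤ.*_) (∏-^ y (k ∘ suc))) (sym (ℤ.^-distribˡ-+-* y (k zero) (∑ⁿ (k ∘ suc))))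

module _ (y : ℤ) (r′ t′ n : ℕ) where

  open Flag y r′ t′ hiding (v; c; F)
  open Chains r′ t using (colour; toℕ-mod; ∑-chains)
  open ExcedanceWeight {suc (t * r)} (wd ∘ toℕ) (we ∘ toℕ) using (pairWeight; ∑-pairs)

  pairWeight-fexc : ∀ σ (N : Vec (Fin (suc (t * r))) n) → pairWeight (σ , N) ≡ y ℤ.^ fexc (σ , Vec.map colour N)
  pairWeight-fexc σ N = trans
    (∏-cong (λ i → trans (letter (does (i ≺? lookup σ i)) (lookup N i))
      (cong (λ c → y ℤ.^ (if does (i ≺? lookup σ i) then (if does (toℕ c ℕ.≟ 0) then r else toℕ c) else toℕ c)) (sym (Vec.lookup-map i colour N)))))
    (trans (∏-^ y (λ i → if does (i ≺? lookup σ i) then (if does (toℕ (lookup c i) ℕ.≟ 0) then r else toℕ (lookup c i)) else toℕ (lookup c i)))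
      (cong (y ℤ.^_) (sym (fexc-∑ σ c))))
    where
    c = Vec.map colour N
    letter : ∀ ex (N : Fin (suc (t * r))) → Weights.weight (wd ∘ toℕ) (we ∘ toℕ) ex N ≡
      y ℤ.^ (if ex then (if does (toℕ (colour N) ℕ.≟ 0) then r else toℕ (colour N)) else toℕ (colour N))
    letter true  N = cong (λ k → y ℤ.^ (if does (k ℕ.≟ 0) then r else k)) (sym (toℕ-mod (toℕ N)))
    letter false N = cong (y ℤ.^_) (sym (toℕ-mod (toℕ N)))

  -- Obtained from `chain?` by `map′`, so that both have the same `does` by definition;
  -- `∑-coloredPermutations` relies on this.
  sorted? : ∀ (w : Vec (Fin n) n × Vec (Fin (suc (t * r))) n) → Dec (Sorted (proj₁ w) (proj₂ w))
  sorted? (σ , N) = map′ (chain⇒sorted σ N) (λ sorted → sorted⇒chain σ N sorted start) (chain? (t * r) 0 σ N)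
    where
    -- The shifted positions are positive, so the largest letter `t * r` may itself follow the
    -- start.
    start : ∀ i → Step (t * r) 0 (toℕ (lookup N i)) (suc (toℕ (lookup σ i)))
    start i with ℕ.m≤n⇒m<n∨m≡n (ℕ.s≤s⁻¹ (Fin.toℕ<n (lookup N i)))
    ... | inj₁ lt = inj₁ lt
    ... | inj₂ eq = inj₂ (eq , s≤s z≤n)

  ∑-coloredPermutations :
    ∑ˡ (λ w → y ℤ.^ fexc w ℤ.* pos (chains t w)) (coloredPermutations r n) ≡
    ∑ʷ (suc (t * r)) n wordWeight
  ∑-coloredPermutations = begin
    ∑ˡ (λ w → y ℤ.^ fexc w ℤ.* pos (chains t w)) (coloredPermutations r n)
      ≡⟨ ∑ˡ-cartesianProductWith (λ w → y ℤ.^ fexc w ℤ.* pos (chains t w)) _,_ (permutations n) (words r n) ⟩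
    ∑ˡ (λ σ → ∑ˡ (λ c → y ℤ.^ fexc (σ , c) ℤ.* pos (ways 0 0 σ c t)) (words r n)) (permutations n)
      ≡⟨ ∑ˡ-cong (permutations n) (λ σ _ → ∑-chains σ {0} {t} 0 (λ c → y ℤ.^ fexc (σ , c)) (s≤s z≤n) ℕ.≤-refl) ⟨
    ∑ˡ (λ σ → ∑ˡ (λ N → if does (chain? (t * r) 0 σ N) then y ℤ.^ fexc (σ , Vec.map colour N) else 0ℤ) (words A n)) (permutations n)
      ≡⟨ ∑ˡ-cong (permutations n) (λ σ _ → ∑ˡ-cong (words A n) (λ N _ →
           cong (λ z → if does (chain? (t * r) 0 σ N) then z else 0ℤ) (sym (pairWeight-fexc σ N)))) ⟩
    ∑ˡ (λ σ → ∑ˡ (λ N → if does (sorted? (σ , N)) then pairWeight (σ , N) else 0ℤ) (words A n)) (permutations n)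
      ≡⟨ ∑ˡ-cartesianProductWith (λ w → if does (sorted? w) then pairWeight w else 0ℤ) _,_ (permutations n) (words A n) ⟨
    ∑ˡ (λ w → if does (sorted? w) then pairWeight w else 0ℤ) (List.cartesianProduct (permutations n) (words A n))
      ≡⟨ ∑ˡ-filter sorted? pairWeight (List.cartesianProduct (permutations n) (words A n)) ⟨
    ∑ˡ pairWeight (List.filter sorted? (List.cartesianProduct (permutations n) (words A n)))
      ≡⟨ ∑-pairs n sorted? ⟩
    ∑ʷ A n wordWeight ∎
    where
    open ≡-Reasoning
    A = suc (t * r)

  fexc-total : y ≢ 1ℤ →
    ∑ˡ (λ w → y ℤ.^ fexc w ℤ.* pos (chains t w)) (coloredPermutations r n) ≡
    ∑ˡ (λ u → y ℤ.^ ((total (Vec.toList u) ∸ 1) ℕ./ t)) (words (suc (t * r)) n)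
  fexc-total y≢1 = trans ∑-coloredPermutations (trans (equidistribution y≢1 n)
    (sym (∑ˡ-words (suc (t * r)) n (λ u → φ (total u)))))

-- Comparison of coefficients

-- A polynomial as a list of monomials (exponent , coefficient).
evaluate : ℕ → List (ℕ × ℕ) → ℕ
evaluate y []            = 0
evaluate y ((e , m) ∷ L) = m * y ℕ.^ e + evaluate y L

coefficient : ℕ → List (ℕ × ℕ) → ℕ
coefficient j []            = 0
coefficient j ((e , m) ∷ L) = (if does (e ℕ.≟ j) then m else 0) + coefficient j L

mass : List (ℕ × ℕ) → ℕ
mass []            = 0
mass ((e , m) ∷ L) = m + mass L

lower : List (ℕ × ℕ) → List (ℕ × ℕ)
lower []                = []
lower ((zero  , m) ∷ L) = lower L
lower ((suc e , m) ∷ L) = (e , m) ∷ lower L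

coefficient-lower : ∀ j L → coefficient j (lower L) ≡ coefficient (suc j) L
coefficient-lower j []                = refl
coefficient-lower j ((zero  , m) ∷ L) = coefficient-lower j L
coefficient-lower j ((suc e , m) ∷ L) = cong ((if does (e ℕ.≟ j) then m else 0) +_) (coefficient-lower j L)

mass-lower : ∀ L → mass (lower L) ≤ mass L
mass-lower []                = z≤n
mass-lower ((zero  , m) ∷ L) = ℕ.≤-trans (mass-lower L) (ℕ.m≤n+m (mass L) m)
mass-lower ((suc e , m) ∷ L) = ℕ.+-monoʳ-≤ m (mass-lower L)

coefficient≤mass : ∀ j L → coefficient j L ≤ mass L
coefficient≤mass j []            = z≤n
coefficient≤mass j ((e , m) ∷ L) with does (e ℕ.≟ j)
... | true  = ℕ.+-monoʳ-≤ m (coefficient≤mass j L)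
... | false = ℕ.≤-trans (coefficient≤mass j L) (ℕ.m≤n+m (mass L) m)

evaluate-lower : ∀ y L → evaluate y L ≡ coefficient 0 L + evaluate y (lower L) * y
evaluate-lower y []                = refl
evaluate-lower y ((zero  , m) ∷ L) = trans (cong₂ _+_ (ℕ.*-identityʳ m) (evaluate-lower y L))
  (sym (ℕ.+-assoc m (coefficient 0 L) (evaluate y (lower L) * y)))
evaluate-lower y ((suc e , m) ∷ L) = trans (cong (m * (y * y ℕ.^ e) +_) (evaluate-lower y L))
  (regroup m y (y ℕ.^ e) (coefficient 0 L) (evaluate y (lower L)))
  where
  regroup : ∀ m y p c v → m * (y * p) + (c + v * y) ≡ c + (m * p + v) * y
  regroup = ℕSolver.solve-∀

digits : ∀ y {c d v w} .{{_ : NonZero y}} → c < y → d < y → c + v * y ≡ d + w * y → c ≡ d × v ≡ w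
digits y {c} {d} {v} {w} c<y d<y eq = c≡d ,
  ℕ.*-cancelʳ-≡ v w y (ℕ.+-cancelˡ-≡ d (v * y) (w * y) (trans (cong (_+ v * y) (sym c≡d)) eq))
  where
  c≡d : c ≡ d
  c≡d = trans (sym (ℕ.m<n⇒m%n≡m c<y)) (trans (sym (ℕ.[m+kn]%n≡m%n c v y))
    (trans (cong (ℕ._% y) eq) (trans (ℕ.[m+kn]%n≡m%n d w y) (ℕ.m<n⇒m%n≡m d<y))))

-- At a point y exceeding all coefficients, these are the digits of the value in base y.
evaluate⇒coefficient : ∀ y .{{_ : NonZero y}} L L′ → mass L < y → mass L′ < y →
  evaluate y L ≡ evaluate y L′ → ∀ j → coefficient j L ≡ coefficient j L′
evaluate⇒coefficient y L L′ big big′ eq j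
  with digits y {coefficient 0 L} {coefficient 0 L′} {evaluate y (lower L)} {evaluate y (lower L′)}
         (ℕ.≤-<-trans (coefficient≤mass 0 L) big) (ℕ.≤-<-trans (coefficient≤mass 0 L′) big′)
         (trans (sym (evaluate-lower y L)) (trans eq (evaluate-lower y L′)))
evaluate⇒coefficient y L L′ big big′ eq zero    | c≡ , _  = c≡
evaluate⇒coefficient y L L′ big big′ eq (suc j) | _  , v≡ = trans (sym (coefficient-lower j L))
  (trans (evaluate⇒coefficient y (lower L) (lower L′) (ℕ.≤-<-trans (mass-lower L) big) (ℕ.≤-<-trans (mass-lower L′) big′) v≡ j)
    (coefficient-lower j L′))

pos-^ : ∀ y k → pos (y ℕ.^ k) ≡ pos y ℤ.^ k
pos-^ y zero    = refl
pos-^ y (suc k) = trans (ℤ.pos-* y (y ℕ.^ k)) (cong (pos y ℤ.*_) (pos-^ y k))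

pos-evaluate : ∀ {a} {X : Set a} y (e m : X → ℕ) xs →
  pos (evaluate y (map (λ x → e x , m x) xs)) ≡ ∑ˡ (λ x → pos y ℤ.^ e x ℤ.* pos (m x)) xs
pos-evaluate y e m []       = refl
pos-evaluate y e m (x ∷ xs) = trans (ℤ.pos-+ (m x * y ℕ.^ e x) (evaluate y (map (λ x → e x , m x) xs)))
  (cong₂ ℤ._+_ (trans (ℤ.pos-* (m x) (y ℕ.^ e x)) (trans (ℤ.*-comm (pos (m x)) (pos (y ℕ.^ e x))) (cong (ℤ._* pos (m x)) (pos-^ y (e x)))))
    (pos-evaluate y e m xs))

∑ˡⁿ : ∀ {a} {X : Set a} → (X → ℕ) → List X → ℕ
∑ˡⁿ f []       = 0
∑ˡⁿ f (x ∷ xs) = f x + ∑ˡⁿ f xs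

coefficient-map : ∀ {a} {X : Set a} j (e m : X → ℕ) xs →
  coefficient j (map (λ x → e x , m x) xs) ≡ ∑ˡⁿ m (List.filter (λ x → e x ℕ.≟ j) xs)
coefficient-map j e m []       = refl
coefficient-map j e m (x ∷ xs) with does (e x ℕ.≟ j)
... | true  = cong (m x +_) (coefficient-map j e m xs)
... | false = coefficient-map j e m xs

∑ˡⁿ-ones : ∀ {a} {X : Set a} (xs : List X) → ∑ˡⁿ (λ _ → 1) xs ≡ length xs
∑ˡⁿ-ones []       = refl
∑ˡⁿ-ones (x ∷ xs) = cong suc (∑ˡⁿ-ones xs)

wordLevel : ∀ {A n} (t : ℕ) .{{_ : NonZero t}} → Vec (Fin A) n → ℕ
wordLevel t u = (total (Vec.toList u) ∸ 1) ℕ./ t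

fexc-level : ∀ r t n j .{{_ : NonZero r}} .{{_ : NonZero t}} →
  ∑ˡⁿ (chains t) (coloredPermutationsWithFexc r n j) ≡
  length (List.filter (λ u → wordLevel t u ℕ.≟ j) (words (suc (t * r)) n))
fexc-level r@(suc r′) t@(suc t′) n j = begin
  ∑ˡⁿ m (coloredPermutationsWithFexc r n j)
    ≡⟨ coefficient-map j fexc m (coloredPermutations r n) ⟨
  coefficient j L
    ≡⟨ evaluate⇒coefficient y L L′
         (s≤s (ℕ.m≤n⇒m≤1+n (ℕ.m≤m+n (mass L) (mass L′)))) (s≤s (ℕ.m≤n⇒m≤1+n (ℕ.m≤n+m (mass L′) (mass L)))) values j ⟩
  coefficient j L′
    ≡⟨ coefficient-map j (wordLevel t) (λ _ → 1) (words (suc (t * r)) n) ⟩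
  ∑ˡⁿ (λ _ → 1) (List.filter (λ u → wordLevel t u ℕ.≟ j) (words (suc (t * r)) n))
    ≡⟨ ∑ˡⁿ-ones (List.filter (λ u → wordLevel t u ℕ.≟ j) (words (suc (t * r)) n)) ⟩
  length (List.filter (λ u → wordLevel t u ℕ.≟ j) (words (suc (t * r)) n)) ∎
  where
  open ≡-Reasoning
  m : Vec (Fin n) n × Vec (Fin r) n → ℕ
  m = chains t
  L  = map (λ w → fexc w , m w) (coloredPermutations r n)
  L′ = map (λ u → wordLevel t u , 1) (words (suc (t * r)) n)
  -- Exceeds both masses, hence all coefficients, and is at least 2, as the equidistribution
  -- excludes 1.
  y = suc (suc (mass L + mass L′))
  values : evaluate y L ≡ evaluate y L′
  values = ℤ.+-injective (begin
    pos (evaluate y L)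
      ≡⟨ pos-evaluate y fexc m (coloredPermutations r n) ⟩
    ∑ˡ (λ w → pos y ℤ.^ fexc w ℤ.* pos (m w)) (coloredPermutations r n)
      ≡⟨ fexc-total (pos y) r′ t′ n (λ ()) ⟩
    ∑ˡ (λ u → pos y ℤ.^ wordLevel t u) (words (suc (t * r)) n)
      ≡⟨ ∑ˡ-cong (words (suc (t * r)) n) (λ u _ → ℤ.*-identityʳ (pos y ℤ.^ wordLevel t u)) ⟨
    ∑ˡ (λ u → pos y ℤ.^ wordLevel t u ℤ.* pos 1) (words (suc (t * r)) n)
      ≡⟨ pos-evaluate y (wordLevel t) (λ _ → 1) (words (suc (t * r)) n) ⟨
    pos (evaluate y L′) ∎)

-- Power series and finite differences

toℚᵘ-fromℤ : ∀ i → ℚ.toℚᵘ (fromℤ i) ℚᵘ.≃ ℚᵘ.mkℚᵘ i 0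
toℚᵘ-fromℤ i = ℚ.toℚᵘ-fromℚᵘ (ℚᵘ.mkℚᵘ i 0)

fromℤ-+ : ∀ i j → fromℤ (i ℤ.+ j) ≡ fromℤ i ℚ.+ fromℤ j
fromℤ-+ i j = ℚ.toℚᵘ-injective (begin
  ℚ.toℚᵘ (fromℤ (i ℤ.+ j)) ≈⟨ toℚᵘ-fromℤ (i ℤ.+ j) ⟩
  ℚᵘ.mkℚᵘ (i ℤ.+ j) 0 ≈⟨ ℚᵘ.*≡* (cross i j) ⟩
  ℚᵘ.mkℚᵘ i 0 ℚᵘ.+ ℚᵘ.mkℚᵘ j 0 ≈⟨ ℚᵘ.+-cong (toℚᵘ-fromℤ i) (toℚᵘ-fromℤ j) ⟨
  ℚ.toℚᵘ (fromℤ i) ℚᵘ.+ ℚ.toℚᵘ (fromℤ j) ≈⟨ ℚ.toℚᵘ-homo-+ (fromℤ i) (fromℤ j) ⟨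
  ℚ.toℚᵘ (fromℤ i ℚ.+ fromℤ j) ∎)
  where
  open ℚᵘ.≃-Reasoning
  cross : ∀ i j → (i ℤ.+ j) ℤ.* 1ℤ ≡ (i ℤ.* 1ℤ ℤ.+ j ℤ.* 1ℤ) ℤ.* 1ℤ
  cross = solve-∀

fromℤ-* : ∀ i j → fromℤ (i ℤ.* j) ≡ fromℤ i ℚ.* fromℤ j
fromℤ-* i j = ℚ.toℚᵘ-injective (begin
  ℚ.toℚᵘ (fromℤ (i ℤ.* j)) ≈⟨ toℚᵘ-fromℤ (i ℤ.* j) ⟩
  ℚᵘ.mkℚᵘ i 0 ℚᵘ.* ℚᵘ.mkℚᵘ j 0 ≈⟨ ℚᵘ.*-cong (toℚᵘ-fromℤ i) (toℚᵘ-fromℤ j) ⟨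
  ℚ.toℚᵘ (fromℤ i) ℚᵘ.* ℚ.toℚᵘ (fromℤ j) ≈⟨ ℚ.toℚᵘ-homo-* (fromℤ i) (fromℤ j) ⟨
  ℚ.toℚᵘ (fromℤ i ℚ.* fromℤ j) ∎)
  where open ℚᵘ.≃-Reasoning

fromℕ-+ : ∀ a b → fromℕ (a + b) ≡ fromℕ a ℚ.+ fromℕ b
fromℕ-+ a b = trans (cong fromℤ (ℤ.pos-+ a b)) (fromℤ-+ (pos a) (pos b))

fromℕ-* : ∀ a b → fromℕ (a * b) ≡ fromℕ a ℚ.* fromℕ b
fromℕ-* a b = trans (cong fromℤ (ℤ.pos-* a b)) (fromℤ-* (pos a) (pos b))

p-p≡0 : ∀ p → p ℚ.- p ≡ 0ℚ
p-p≡0 = ℚ.+-inverseʳ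

p-0≡p : ∀ p → p ℚ.- 0ℚ ≡ p
p-0≡p p = ℚ.+-identityʳ p

[p+q]-p≡q : ∀ p q → p ℚ.+ q ℚ.- p ≡ q
[p+q]-p≡q = solve 2 (λ p q → p :+ q :- p := q) refl
  where open ℚSolver.+-*-Solver

p-q≡0⇒p≡q : ∀ p q → p ℚ.- q ≡ 0ℚ → p ≡ q
p-q≡0⇒p≡q p q eq = trans (restore p q) (trans (cong (ℚ._+ q) eq) (ℚ.+-identityˡ q))
  where
  open ℚSolver.+-*-Solver
  restore : ∀ p q → p ≡ p ℚ.- q ℚ.+ q
  restore = solve 2 (λ p q → p := p :- q :+ q) refl

-- On power series `∇` and `U` are multiplication by 1 - z and by z. The forward difference `Δ`
-- forgets the constant term instead of keeping it, so its powers annihilate polynomials.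
∇ Δ U : (ℕ → ℚ) → ℕ → ℚ
∇ f zero    = f zero
∇ f (suc n) = f (suc n) ℚ.- f n
Δ f n = f (suc n) ℚ.- f n
U f zero    = 0ℚ
U f (suc n) = f n

∇^ Δ^ : ℕ → (ℕ → ℚ) → ℕ → ℚ
∇^ zero    f = f
∇^ (suc d) f = ∇ (∇^ d f)
Δ^ zero    f = f
Δ^ (suc d) f = Δ^ d (Δ f)

∇-cong : ∀ {f g} → f ≗ g → ∇ f ≗ ∇ g
∇-cong eq zero    = eq zero
∇-cong eq (suc n) = cong₂ ℚ._-_ (eq (suc n)) (eq n)

∇^-cong : ∀ d {f g} → f ≗ g → ∇^ d f ≗ ∇^ d g
∇^-cong zero    eq = eq
∇^-cong (suc d) eq = ∇-cong (∇^-cong d eq)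

∇^-∇ : ∀ d f → ∇ (∇^ d f) ≗ ∇^ d (∇ f)
∇^-∇ zero    f n = refl
∇^-∇ (suc d) f n = ∇-cong (∇^-∇ d f) n

·-suc : ∀ f g m → (f · g) (suc m) ≡ f 0 ℚ.* g (suc m) ℚ.+ ((f ∘ suc) · g) m
·-suc f g m = cong (λ xs → f 0 ℚ.* g (suc m) ℚ.+ sumℚ xs)
  (trans (List.map-applyUpTo suc (λ i → f i ℚ.* g (suc m ∸ i)) (suc m))
    (sym (List.map-applyUpTo id (λ i → f (suc i) ℚ.* g (m ∸ i)) (suc m))))

·-0 : ∀ f g → (f · g) 0 ≡ f 0 ℚ.* g 0
·-0 f g = ℚ.+-identityʳ _

·-cong : ∀ {f f′} g → f ≗ f′ → f · g ≗ f′ · g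
·-cong         g eq zero    = cong (λ p → p ℚ.* g 0 ℚ.+ 0ℚ) (eq 0)
·-cong {f} {f′} g eq (suc m) = trans (·-suc f g m)
  (trans (cong₂ (λ p q → p ℚ.* g (suc m) ℚ.+ q) (eq 0) (·-cong g (eq ∘ suc) m)) (sym (·-suc f′ g m)))

·-zero : ∀ {f} g → f ≗ (λ _ → 0ℚ) → f · g ≗ (λ _ → 0ℚ)
·-zero {f} g eq zero    = trans (·-0 f g) (trans (cong (ℚ._* g 0) (eq 0)) (ℚ.*-zeroˡ (g 0)))
·-zero {f} g eq (suc m) = trans (·-suc f g m)
  (cong₂ ℚ._+_ (trans (cong (ℚ._* g (suc m)) (eq 0)) (ℚ.*-zeroˡ (g (suc m)))) (·-zero g (eq ∘ suc) m))

·-minus : ∀ f f′ g → (λ n → f n ℚ.- f′ n) · g ≗ (λ n → (f · g) n ℚ.- (f′ · g) n)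
·-minus f f′ g zero    = trans (·-0 (λ n → f n ℚ.- f′ n) g)
  (trans (distrib (f 0) (f′ 0) (g 0)) (sym (cong₂ ℚ._-_ (·-0 f g) (·-0 f′ g))))
  where
  open ℚSolver.+-*-Solver
  distrib : ∀ p q s → (p ℚ.- q) ℚ.* s ≡ p ℚ.* s ℚ.- q ℚ.* s
  distrib = solve 3 (λ p q s → (p :- q) :* s := p :* s :- q :* s) refl
·-minus f f′ g (suc m) = trans (·-suc (λ n → f n ℚ.- f′ n) g m)
  (trans (cong (λ z → (f 0 ℚ.- f′ 0) ℚ.* g (suc m) ℚ.+ z) (·-minus (f ∘ suc) (f′ ∘ suc) g m))
    (trans (regroup (f 0) (f′ 0) (g (suc m)) (((f ∘ suc) · g) m) (((f′ ∘ suc) · g) m))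
      (sym (cong₂ ℚ._-_ (·-suc f g m) (·-suc f′ g m)))))
  where
  open ℚSolver.+-*-Solver
  regroup : ∀ p q s x y → (p ℚ.- q) ℚ.* s ℚ.+ (x ℚ.- y) ≡ p ℚ.* s ℚ.+ x ℚ.- (q ℚ.* s ℚ.+ y)
  regroup = solve 5 (λ p q s x y → (p :- q) :* s :+ (x :- y) := p :* s :+ x :- (q :* s :+ y)) refl

U-· : ∀ f g → U f · g ≗ U (f · g)
U-· f g zero    = trans (·-0 (U f) g) (ℚ.*-zeroˡ (g 0))
U-· f g (suc m) = trans (·-suc (U f) g m) (trans (cong (ℚ._+ (f · g) m) (ℚ.*-zeroˡ (g (suc m)))) (ℚ.+-identityˡ ((f · g) m)))

∇-U : ∀ f → ∇ f ≗ (λ n → f n ℚ.- U f n)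
∇-U f zero    = sym (p-0≡p (f 0))
∇-U f (suc n) = refl

∇-· : ∀ f g → ∇ f · g ≗ ∇ (f · g)
∇-· f g m = trans (·-cong g (∇-U f) m) (trans (·-minus f (U f) g m)
  (trans (cong (ℚ._-_ ((f · g) m)) (U-· f g m)) (sym (∇-U (f · g) m))))

one-· : ∀ g → (z^ 0) · g ≗ g
one-· g zero    = trans (·-0 (z^ 0) g) (ℚ.*-identityˡ (g 0))
one-· g (suc m) = trans (·-suc (z^ 0) g m)
  (trans (cong₂ ℚ._+_ (ℚ.*-identityˡ (g (suc m))) (·-zero g (λ _ → refl) m)) (ℚ.+-identityʳ (g (suc m))))

1-z-· : ∀ g → 1-z · g ≗ ∇ g
1-z-· g m = trans (·-cong g (λ i → sym (difference i)) m) (trans (∇-· (z^ 0) g m) (∇-cong (one-· g) m))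
  where
  difference : ∇ (z^ 0) ≗ 1-z
  difference zero          = refl
  difference (suc zero)    = refl
  difference (suc (suc i)) = refl

power-1-z : ∀ d g → power 1-z d · g ≗ ∇^ d g
power-1-z zero    g m = one-· g m
power-1-z (suc d) g m = trans (·-cong g (1-z-· (power 1-z d)) m)
  (trans (∇-· (power 1-z d) g m) (∇-cong (power-1-z d g) m))

U-cong : ∀ {f g} → f ≗ g → U f ≗ U g
U-cong eq zero    = refl
U-cong eq (suc n) = eq n

∇-U-comm : ∀ f → ∇ (U f) ≗ U (∇ f)
∇-U-comm f zero          = refl
∇-U-comm f (suc zero)    = p-0≡p (f 0)
∇-U-comm f (suc (suc n)) = refl

∇^-U : ∀ d f → ∇^ d (U f) ≗ U (∇^ d f)
∇^-U zero    f n = refl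
∇^-U (suc d) f n = trans (∇-cong (∇^-U d f) n) (∇-U-comm (∇^ d f) n)

U-z^ : ∀ k → U (z^ k) ≗ z^ (suc k)
U-z^ k zero    = refl
U-z^ k (suc n) = refl

∇-+ : ∀ f g → ∇ (λ n → f n ℚ.+ g n) ≗ (λ n → ∇ f n ℚ.+ ∇ g n)
∇-+ f g zero    = refl
∇-+ f g (suc n) = interchange (f (suc n)) (g (suc n)) (f n) (g n)
  where
  open ℚSolver.+-*-Solver
  interchange : ∀ p q s t → p ℚ.+ q ℚ.- (s ℚ.+ t) ≡ p ℚ.- s ℚ.+ (q ℚ.- t)
  interchange = solve 4 (λ p q s t → p :+ q :- (s :+ t) := p :- s :+ (q :- t)) refl

∇^-+ : ∀ d f g → ∇^ d (λ n → f n ℚ.+ g n) ≗ (λ n → ∇^ d f n ℚ.+ ∇^ d g n)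
∇^-+ zero    f g n = refl
∇^-+ (suc d) f g n = trans (∇-cong (∇^-+ d f g) n) (∇-+ (∇^ d f) (∇^ d g) n)

∇^-0 : ∀ d → ∇^ d (λ _ → 0ℚ) ≗ (λ _ → 0ℚ)
∇^-0 zero    n       = refl
∇^-0 (suc d) zero    = ∇^-0 d zero
∇^-0 (suc d) (suc n) = cong₂ ℚ._-_ (∇^-0 d (suc n)) (∇^-0 d n)

Δ^-cong : ∀ d {f g} → f ≗ g → Δ^ d f ≗ Δ^ d g
Δ^-cong zero    eq = eq
Δ^-cong (suc d) eq = Δ^-cong d (λ n → cong₂ ℚ._-_ (eq (suc n)) (eq n))

Δ^-0 : ∀ d → Δ^ d (λ _ → 0ℚ) ≗ (λ _ → 0ℚ)
Δ^-0 zero    n = refl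
Δ^-0 (suc d) n = Δ^-0 d n

Δ^-+ : ∀ d f g → Δ^ d (λ n → f n ℚ.+ g n) ≗ (λ n → Δ^ d f n ℚ.+ Δ^ d g n)
Δ^-+ zero    f g n = refl
Δ^-+ (suc d) f g n = trans (Δ^-cong d (λ m → ∇-+ f g (suc m)) n) (Δ^-+ d (Δ f) (Δ g) n)

Δ^-minus : ∀ d f g → Δ^ d (λ n → f n ℚ.- g n) ≗ (λ n → Δ^ d f n ℚ.- Δ^ d g n)
Δ^-minus zero    f g n = refl
Δ^-minus (suc d) f g n = trans (Δ^-cong d (λ m → interchange (f (suc m)) (g (suc m)) (f m) (g m)) n) (Δ^-minus d (Δ f) (Δ g) n)
  where
  open ℚSolver.+-*-Solver
  interchange : ∀ p q s t → p ℚ.- q ℚ.- (s ℚ.- t) ≡ p ℚ.- s ℚ.- (q ℚ.- t)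
  interchange = solve 4 (λ p q s t → p :- q :- (s :- t) := p :- s :- (q :- t)) refl

Δ^-shift : ∀ d f n → Δ^ d (f ∘ suc) n ≡ Δ^ d f (suc n)
Δ^-shift zero    f n = refl
Δ^-shift (suc d) f n = Δ^-shift d (Δ f) n

Δ^-vanish-≤ : ∀ {d} k f → Δ^ d f ≗ (λ _ → 0ℚ) → Δ^ (k + d) f ≗ (λ _ → 0ℚ)
Δ^-vanish-≤     zero    f vanish n = vanish n
Δ^-vanish-≤ {d} (suc k) f vanish n = trans (Δ^-minus (k + d) (f ∘ suc) f n)
  (cong₂ ℚ._-_ (trans (Δ^-shift (k + d) f n) (Δ^-vanish-≤ {d} k f vanish (suc n))) (Δ^-vanish-≤ {d} k f vanish n))

-- One step of Horner's scheme. By the product rule Δ (n g n) = n Δ g n + g (n + 1), a factor n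
-- costs one more difference.
Δ^-affine : ∀ d a g → Δ^ d g ≗ (λ _ → 0ℚ) → Δ^ (suc d) (λ n → a ℚ.+ fromℕ n ℚ.* g n) ≗ (λ _ → 0ℚ)
Δ^-affine d a g vanish n = trans (Δ^-cong d step n) (rest d vanish)
  where
  open ℚSolver.+-*-Solver
  regroup : ∀ a x g g′ → a ℚ.+ (1ℚ ℚ.+ x) ℚ.* g′ ℚ.- (a ℚ.+ x ℚ.* g) ≡ 0ℚ ℚ.+ x ℚ.* (g′ ℚ.- g) ℚ.+ g′
  regroup = solve 4 (λ a x g g′ → a :+ (con 1ℚ :+ x) :* g′ :- (a :+ x :* g) := con 0ℚ :+ x :* (g′ :- g) :+ g′) refl
  step : Δ (λ n → a ℚ.+ fromℕ n ℚ.* g n) ≗ (λ n → (0ℚ ℚ.+ fromℕ n ℚ.* Δ g n) ℚ.+ g (suc n))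
  step m = trans (cong (λ x → a ℚ.+ x ℚ.* g (suc m) ℚ.- (a ℚ.+ fromℕ m ℚ.* g m)) (fromℕ-+ 1 m))
    (regroup a (fromℕ m) (g m) (g (suc m)))
  rest : ∀ d → Δ^ d g ≗ (λ _ → 0ℚ) → Δ^ d (λ n → (0ℚ ℚ.+ fromℕ n ℚ.* Δ g n) ℚ.+ g (suc n)) n ≡ 0ℚ
  rest zero    vanish = trans (cong₂ (λ p q → 0ℚ ℚ.+ fromℕ n ℚ.* p ℚ.+ q) (cong₂ ℚ._-_ (vanish (suc n)) (vanish n)) (vanish (suc n)))
    (trans (ℚ.+-identityʳ (0ℚ ℚ.+ fromℕ n ℚ.* 0ℚ)) (trans (ℚ.+-identityˡ (fromℕ n ℚ.* 0ℚ)) (ℚ.*-zeroʳ (fromℕ n))))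
  rest (suc d) vanish = trans (Δ^-+ (suc d) (λ n → 0ℚ ℚ.+ fromℕ n ℚ.* Δ g n) (g ∘ suc) n)
    (cong₂ ℚ._+_ (Δ^-affine d 0ℚ (Δ g) vanish n) (trans (Δ^-shift (suc d) g n) (vanish (suc n))))

Δ^-eval : ∀ p → Δ^ (length p) (λ t → eval p (fromℕ t)) ≗ (λ _ → 0ℚ)
Δ^-eval []      n = refl
Δ^-eval (a ∷ p) n = Δ^-affine (length p) a (λ t → eval p (fromℕ t)) (Δ^-eval p) n

-- The difference of a sequence supported at 0 is supported at 0 again, with the opposite value
-- there.
Δ^-isolated : ∀ d f → (∀ n → f (suc n) ≡ 0ℚ) → Δ^ d f ≗ (λ _ → 0ℚ) → f 0 ≡ 0ℚ
Δ^-isolated zero    f zeros vanish = vanish 0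
Δ^-isolated (suc d) f zeros vanish = sym (p-q≡0⇒p≡q 0ℚ (f 0) (trans (cong (ℚ._- f 0) (sym (zeros 0)))
  (Δ^-isolated d (Δ f) (λ n → trans (cong₂ ℚ._-_ (zeros (suc n)) (zeros n)) refl) vanish)))

-- The difference of the two sequences is supported at 0, and `d + d′` iterations of `Δ` annihilate
-- it.
Δ^-agree : ∀ {d d′} f g → Δ^ d f ≗ (λ _ → 0ℚ) → Δ^ d′ g ≗ (λ _ → 0ℚ) → (∀ t → f (suc t) ≡ g (suc t)) → f ≗ g
Δ^-agree          f g vanish vanish′ eq (suc t) = eq t
Δ^-agree {d} {d′} f g vanish vanish′ eq zero    = p-q≡0⇒p≡q (f 0) (g 0)
  (Δ^-isolated (d + d′) (λ n → f n ℚ.- g n) (λ n → trans (cong (ℚ._- g (suc n)) (eq n)) (p-p≡0 (g (suc n)))) λ n →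
    trans (Δ^-minus (d + d′) f g n) (cong₂ ℚ._-_
      (subst (λ k → Δ^ k f n ≡ 0ℚ) (ℕ.+-comm d′ d) (Δ^-vanish-≤ {d} d′ f vanish n))
      (Δ^-vanish-≤ {d′} d g vanish′ n)))

module _ {X : Set} (n : ℕ) (W : X → ℕ → ℕ) (d : X → ℕ)
  (∇-W : ∀ x → ∇^ (suc n) (fromℕ ∘ W x) ≗ z^ (d x))
  (Δ-W : ∀ x → Δ^ (suc n) (fromℕ ∘ W x) ≗ (λ _ → 0ℚ)) where

  fromℕ-∑ˡⁿ : ∀ xs t → fromℕ (∑ˡⁿ (λ x → W x t) xs) ≡ sumℚ (map (λ x → fromℕ (W x t)) xs)
  fromℕ-∑ˡⁿ []       t = refl
  fromℕ-∑ˡⁿ (x ∷ xs) t = trans (fromℕ-+ (W x t) (∑ˡⁿ (λ x → W x t) xs)) (cong (ℚ._+_ (fromℕ (W x t))) (fromℕ-∑ˡⁿ xs t))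

  ∇^-sum : ∀ xs → ∇^ (suc n) (λ t → sumℚ (map (λ x → fromℕ (W x t)) xs)) ≗ sumSeries (map (λ x → z^ d x) xs)
  ∇^-sum []       m = ∇^-0 (suc n) m
  ∇^-sum (x ∷ xs) m = trans (∇^-+ (suc n) (fromℕ ∘ W x) (λ t → sumℚ (map (λ x → fromℕ (W x t)) xs)) m)
    (cong₂ ℚ._+_ (∇-W x m) (∇^-sum xs m))

  Δ^-sum : ∀ xs → Δ^ (suc n) (λ t → sumℚ (map (λ x → fromℕ (W x t)) xs)) ≗ (λ _ → 0ℚ)
  Δ^-sum []       m = Δ^-0 (suc n) m
  Δ^-sum (x ∷ xs) m = trans (Δ^-+ (suc n) (fromℕ ∘ W x) (λ t → sumℚ (map (λ x → fromℕ (W x t)) xs)) m)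
    (cong₂ ℚ._+_ (Δ-W x m) (Δ^-sum xs m))

  E*-sum : ∀ E xs → (∀ t → 0 < t → eval E (fromℕ t) ≡ fromℕ (∑ˡⁿ (λ x → W x t) xs)) →
           E* n E ≗ sumSeries (map (λ x → z^ d x) xs)
  E*-sum E xs values m = trans (power-1-z (suc n) (λ t → eval E (fromℕ t)) m)
    (trans (∇^-cong (suc n) (Δ^-agree {length E} {suc n} (λ t → eval E (fromℕ t)) (λ t → sumℚ (map (λ x → fromℕ (W x t)) xs))
      (Δ^-eval E) (Δ^-sum xs) (λ t → trans (values (suc t) (s≤s z≤n)) (fromℕ-∑ˡⁿ xs (suc t)))) m) (∇^-sum xs m))

-- Differences of the chain counts

∑ⁿ-last : ∀ k (f : ℕ → ℕ) → ∑ⁿ {suc k} (f ∘ toℕ) ≡ ∑ⁿ {k} (f ∘ toℕ) + f k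
∑ⁿ-last zero    f = ℕ.+-identityʳ (f 0)
∑ⁿ-last (suc k) f = trans (cong (f 0 +_) (∑ⁿ-last k (f ∘ suc))) (sym (ℕ.+-assoc (f 0) _ (f (suc k))))

descentCount : ∀ {r m n} → ℕ → ℕ → Vec (Fin m) n → Vec (Fin r) n → ℕ
descentCount c₀ s₀ []      []       = 0
descentCount c₀ s₀ (s ∷ σ) (c ∷ cs) = ind (descent? c₀ s₀ (toℕ c) (suc (toℕ s))) + descentCount (toℕ c) (suc (toℕ s)) σ cs

module _ {r m : ℕ} where

  -- Raising the start by one period admits a single new first quotient, `bound b q`.
  ways-suc : ∀ {n} c₀ s₀ s (σ : Vec (Fin m) n) c (cs : Vec (Fin r) n) q →
    let b = descends c₀ s₀ c s in
    ways c₀ s₀ (s ∷ σ) (c ∷ cs) (suc q) ≡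
    ways c₀ s₀ (s ∷ σ) (c ∷ cs) q + ways (toℕ c) (suc (toℕ s)) σ cs (bound b q)
  ways-suc c₀ s₀ s σ c cs q with descends c₀ s₀ c s
  ... | true  = ∑ⁿ-last q (ways (toℕ c) (suc (toℕ s)) σ cs)
  ... | false = ∑ⁿ-last (suc q) (ways (toℕ c) (suc (toℕ s)) σ cs)

  Δ-ways : ∀ {n} c₀ s₀ s (σ : Vec (Fin m) n) c (cs : Vec (Fin r) n) q →
    let b = descends c₀ s₀ c s in
    Δ (fromℕ ∘ ways c₀ s₀ (s ∷ σ) (c ∷ cs)) q ≡ fromℕ (ways (toℕ c) (suc (toℕ s)) σ cs (bound b q))
  Δ-ways c₀ s₀ s σ c cs q = trans
    (cong (λ k → fromℕ k ℚ.- fromℕ x) (ways-suc c₀ s₀ s σ c cs q))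
    (trans (cong (ℚ._- fromℕ x) (fromℕ-+ x w)) ([p+q]-p≡q (fromℕ x) (fromℕ w)))
    where
    x = ways c₀ s₀ (s ∷ σ) (c ∷ cs) q
    w = ways (toℕ c) (suc (toℕ s)) σ cs (bound (descends c₀ s₀ c s) q)

  -- Each letter costs one difference, so `ways` is a polynomial of degree at most `n` in `q`,
  -- already from `q = 0` on.
  Δ^-ways : ∀ {n} c₀ s₀ (σ : Vec (Fin m) n) (cs : Vec (Fin r) n) → Δ^ (suc n) (fromℕ ∘ ways c₀ s₀ σ cs) ≗ (λ _ → 0ℚ)
  Δ^-ways         c₀ s₀ []      []       q = refl
  Δ^-ways {suc n} c₀ s₀ (s ∷ σ) (c ∷ cs) q = trans (Δ^-cong (suc n) (Δ-ways c₀ s₀ s σ c cs) q)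
    (case (descends c₀ s₀ c s))
    where
    case : ∀ b → Δ^ (suc n) (λ q → fromℕ (ways (toℕ c) (suc (toℕ s)) σ cs (bound b q))) q ≡ 0ℚ
    case true  = Δ^-ways (toℕ c) (suc (toℕ s)) σ cs q
    case false = trans (Δ^-shift (suc n) (fromℕ ∘ ways (toℕ c) (suc (toℕ s)) σ cs) q) (Δ^-ways (toℕ c) (suc (toℕ s)) σ cs (suc q))

  -- The generating function is z^d / (1 - z)^(n+1), where d is the descent count: each sum over a
  -- quotient divides by 1 - z, and at a descent the strict bound gives a factor z.
  ∇^-ways : ∀ {n} c₀ s₀ (σ : Vec (Fin m) n) (cs : Vec (Fin r) n) →
            ∇^ (suc n) (fromℕ ∘ ways c₀ s₀ σ cs) ≗ z^ (descentCount c₀ s₀ σ cs)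
  ∇^-ways         c₀ s₀ []      []       zero    = refl
  ∇^-ways         c₀ s₀ []      []       (suc q) = refl
  ∇^-ways {suc n} c₀ s₀ (s ∷ σ) (c ∷ cs) q       = trans (∇^-∇ (suc n) (fromℕ ∘ ways c₀ s₀ (s ∷ σ) (c ∷ cs)) q)
    (trans (∇^-cong (suc n) ∇W q) (case (descends c₀ s₀ c s)))
    where
    w : ℕ → ℚ
    w = fromℕ ∘ ways (toℕ c) (suc (toℕ s)) σ cs
    ∇W : ∇ (fromℕ ∘ ways c₀ s₀ (s ∷ σ) (c ∷ cs)) ≗ (if descends c₀ s₀ c s then U w else w)
    ∇W zero with descends c₀ s₀ c s
    ... | true  = refl
    ... | false = cong fromℕ (ℕ.+-identityʳ (ways (toℕ c) (suc (toℕ s)) σ cs 0))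
    ∇W (suc q) = trans (Δ-ways c₀ s₀ s σ c cs q) (shifted (descends c₀ s₀ c s))
      where
      shifted : ∀ b → w (bound b q) ≡ (if b then U w else w) (suc q)
      shifted true  = refl
      shifted false = refl
    case : ∀ b → ∇^ (suc n) (if b then U w else w) q ≡ (z^ ((if b then 1 else 0) + descentCount (toℕ c) (suc (toℕ s)) σ cs)) q
    case true  = trans (∇^-U (suc n) w q) (trans (U-cong (∇^-ways (toℕ c) (suc (toℕ s)) σ cs) q) (U-z^ (descentCount (toℕ c) (suc (toℕ s)) σ cs) q))
    case false = ∇^-ways (toℕ c) (suc (toℕ s)) σ cs q

-- Lattice points

fromℤ-mono-≤ : ∀ {i j} → i ℤ.≤ j → fromℤ i ℚ.≤ fromℤ j
fromℤ-mono-≤ {i} {j} i≤j = ℚ.toℚᵘ-cancel-≤ (begin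
  ℚ.toℚᵘ (fromℤ i) ≃⟨ toℚᵘ-fromℤ i ⟩
  ℚᵘ.mkℚᵘ i 0 ≤⟨ ℚᵘ.*≤* (ℤ.*-monoʳ-≤-nonNeg 1ℤ i≤j) ⟩
  ℚᵘ.mkℚᵘ j 0 ≃⟨ toℚᵘ-fromℤ j ⟨
  ℚ.toℚᵘ (fromℤ j) ∎)
  where open ℚᵘ.≤-Reasoning

fromℤ-cancel-≤ : ∀ {i j} → fromℤ i ℚ.≤ fromℤ j → i ℤ.≤ j
fromℤ-cancel-≤ {i} {j} le = subst₂ ℤ._≤_ (ℤ.*-identityʳ i) (ℤ.*-identityʳ j) (ℚᵘ.drop-*≤* (begin
  ℚᵘ.mkℚᵘ i 0 ≃⟨ toℚᵘ-fromℤ i ⟨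
  ℚ.toℚᵘ (fromℤ i) ≤⟨ ℚ.toℚᵘ-mono-≤ le ⟩
  ℚ.toℚᵘ (fromℤ j) ≃⟨ toℚᵘ-fromℤ j ⟩
  ℚᵘ.mkℚᵘ j 0 ∎))
  where open ℚᵘ.≤-Reasoning

module _ (t′ : ℕ) where

  private t = suc t′

  instance
    t-positive : ℚ.Positive (fromℕ t)
    t-positive = ℚ.normalize-pos t 1

    t-nonNegative : ℚ.NonNegative (fromℕ t)
    t-nonNegative = ℚ.normalize-nonNeg t 1

  scale-/ : ∀ z → fromℕ t ℚ.* (z ℚ./ t) ≡ fromℤ z
  scale-/ z = ℚ.toℚᵘ-injective (begin
    ℚ.toℚᵘ (fromℕ t ℚ.* (z ℚ./ t)) ≈⟨ ℚ.toℚᵘ-homo-* (fromℕ t) (z ℚ./ t) ⟩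
    ℚ.toℚᵘ (fromℕ t) ℚᵘ.* ℚ.toℚᵘ (z ℚ./ t) ≈⟨ ℚᵘ.*-cong (toℚᵘ-fromℤ (pos t)) (ℚ.toℚᵘ-fromℚᵘ (ℚᵘ.mkℚᵘ z t′)) ⟩
    ℚᵘ.mkℚᵘ (pos t) 0 ℚᵘ.* ℚᵘ.mkℚᵘ z t′ ≈⟨ ℚᵘ.*≡* (cross (pos t) z) ⟩
    ℚᵘ.mkℚᵘ z 0 ≈⟨ toℚᵘ-fromℤ z ⟨
    ℚ.toℚᵘ (fromℤ z) ∎)
    where
    open ℚᵘ.≃-Reasoning
    cross : ∀ t z → t ℤ.* z ℤ.* 1ℤ ≡ z ℤ.* (1ℤ ℤ.* t)
    cross = solve-∀

  module _ {p q : ℚ} (i j : ℤ) (p≡ : fromℕ t ℚ.* p ≡ fromℤ i) (q≡ : fromℕ t ℚ.* q ≡ fromℤ j) where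

    scale-≤ : p ℚ.≤ q → i ℤ.≤ j
    scale-≤ p≤q = fromℤ-cancel-≤ {i} {j} (subst₂ ℚ._≤_ p≡ q≡ (ℚ.*-monoˡ-≤-nonNeg (fromℕ t) p≤q))

    unscale-≤ : i ℤ.≤ j → p ℚ.≤ q
    unscale-≤ i≤j = ℚ.*-cancelˡ-≤-pos (fromℕ t) (subst₂ ℚ._≤_ (sym p≡) (sym q≡) (fromℤ-mono-≤ {i} {j} i≤j))

  scale-fromℕ : ∀ k → fromℕ t ℚ.* fromℕ k ≡ fromℤ (pos (t * k))
  scale-fromℕ k = sym (fromℕ-* t k)

  scale-0 : fromℕ t ℚ.* 0ℚ ≡ fromℤ 0ℤ
  scale-0 = ℚ.*-zeroʳ (fromℕ t)

  integerSum : ∀ {n} → Vec ℤ n → ℤ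
  integerSum []      = 0ℤ
  integerSum (z ∷ v) = z ℤ.+ integerSum v

  scale-coordinateSum : ∀ {n} (x : Vec ℚ n) (z : Vec ℤ n) → Vec.map (fromℕ t ℚ.*_) x ≡ Vec.map fromℤ z →
                        fromℕ t ℚ.* coordinateSum x ≡ fromℤ (integerSum z)
  scale-coordinateSum []      []      eq = scale-0
  scale-coordinateSum (p ∷ x) (i ∷ z) eq = trans (ℚ.*-distribˡ-+ (fromℕ t) p (coordinateSum x))
    (trans (cong₂ ℚ._+_ (Vec.∷-injectiveˡ eq) (scale-coordinateSum x z (Vec.∷-injectiveʳ eq))) (sym (fromℤ-+ i (integerSum z))))

  module _ (r : ℕ) where

    private R = t * r

    -- Complementing the coordinates turns the lower facets of the half-open
    -- slices into upper ones.
    lattice : ∀ {n} → Vec (Fin (suc R)) n → Vec ℤ n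
    lattice = Vec.map (λ b → pos (R ∸ toℕ b))

    point : ∀ {n} → Vec (Fin (suc R)) n → Vec ℚ n
    point = Vec.map (λ b → pos (R ∸ toℕ b) ℚ./ t)

    cototal : ∀ {n} → Vec (Fin (suc R)) n → ℕ
    cototal []      = 0
    cototal (b ∷ u) = (R ∸ toℕ b) + cototal u

    lattice-injective : ∀ {n} {u v : Vec (Fin (suc R)) n} → lattice u ≡ lattice v → u ≡ v
    lattice-injective {u = []}    {[]}    eq = refl
    lattice-injective {u = b ∷ u} {c ∷ v} eq = cong₂ _∷_
      (Fin.toℕ-injective (ℕ.∸-cancelˡ-≡ (ℕ.s≤s⁻¹ (Fin.toℕ<n b)) (ℕ.s≤s⁻¹ (Fin.toℕ<n c)) (ℤ.+-injective (Vec.∷-injectiveˡ eq))))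
      (lattice-injective (Vec.∷-injectiveʳ eq))

    cototal+total : ∀ {n} (u : Vec (Fin (suc R)) n) → cototal u + total (Vec.toList u) ≡ n * R
    cototal+total []      = refl
    cototal+total (b ∷ u) = trans (regroup (R ∸ toℕ b) (cototal u) (toℕ b) (total (Vec.toList u)))
      (cong₂ _+_ (ℕ.m∸n+n≡m (ℕ.s≤s⁻¹ (Fin.toℕ<n b))) (cototal+total u))
      where
      regroup : ∀ a b c d → a + b + (c + d) ≡ a + c + (b + d)
      regroup = ℕSolver.solve-∀

    integerSum-lattice : ∀ {n} (u : Vec (Fin (suc R)) n) → integerSum (lattice u) ≡ pos (cototal u)
    integerSum-lattice []      = refl
    integerSum-lattice (b ∷ u) = trans (cong (ℤ._+_ (pos (R ∸ toℕ b))) (integerSum-lattice u)) (sym (ℤ.pos-+ (R ∸ toℕ b) (cototal u)))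

    InBox : ∀ {n} → Vec ℚ n → Set
    InBox = VecAll.All (λ x → 0ℚ ℚ.≤ x × x ℚ.≤ fromℕ r)

    point-lattice : ∀ {n} (u : Vec (Fin (suc R)) n) → Vec.map (fromℕ t ℚ.*_) (point u) ≡ Vec.map fromℤ (lattice u)
    point-lattice []      = refl
    point-lattice (b ∷ u) = cong₂ _∷_ (scale-/ (pos (R ∸ toℕ b))) (point-lattice u)

    point-inBox : ∀ {n} (u : Vec (Fin (suc R)) n) → InBox (point u)
    point-inBox []      = VecAll.[]
    point-inBox (b ∷ u) =
      ( unscale-≤ 0ℤ (pos (R ∸ toℕ b)) scale-0 (scale-/ (pos (R ∸ toℕ b))) (ℤ.+≤+ z≤n)
      , unscale-≤ (pos (R ∸ toℕ b)) (pos R) (scale-/ (pos (R ∸ toℕ b))) (scale-fromℕ r) (ℤ.+≤+ (ℕ.m∸n≤m R (toℕ b)))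
      ) VecAll.∷ point-inBox u

    coordinate : ∀ {i} → 0ℤ ℤ.≤ i → i ℤ.≤ pos R → ∃[ b ] pos (R ∸ toℕ {suc R} b) ≡ i
    coordinate (ℤ.+≤+ {n = a} _) (ℤ.+≤+ a≤R) = Fin.fromℕ< (s≤s (ℕ.m∸n≤m R a)) ,
      cong pos (trans (cong (R ∸_) (Fin.toℕ-fromℕ< (s≤s (ℕ.m∸n≤m R a)))) (ℕ.m∸[m∸n]≡n a≤R))

    inBox⇒lattice : ∀ {n} (x : Vec ℚ n) (z : Vec ℤ n) → InBox x → Vec.map (fromℕ t ℚ.*_) x ≡ Vec.map fromℤ z →
                    ∃[ u ] lattice u ≡ z
    inBox⇒lattice []      []      _  _  = [] , refl
    inBox⇒lattice (p ∷ x) (i ∷ z) ((0≤p , p≤r) VecAll.∷ box) eq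
      with inBox⇒lattice x z box (Vec.∷-injectiveʳ eq)
         | coordinate (scale-≤ 0ℤ i scale-0 (Vec.∷-injectiveˡ eq) 0≤p) (scale-≤ i (pos R) (Vec.∷-injectiveˡ eq) (scale-fromℕ r) p≤r)
    ... | u , eq′ | b , eq″ = b ∷ u , cong₂ _∷_ eq″ eq′

    module _ (n k : ℕ) where

      -- The dilated inequalities for a coordinate sum `d`; the lower bound t k - t is moved across
      -- to avoid truncated subtraction.
      Slice : ℕ → Set
      Slice d = t * k ≤ d + t × ((k < r * n × d < t * k) ⊎ (k ≡ r * n × d ≤ t * k))

      -- For the complementary sum `s` the slice is the interval from j t + 1 to j t + t, where j =
      -- r n - k. For k = r n it is closed and also contains s = 0, which the truncated `s ∸ 1` duly
      -- places on level 0.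
      slice⇔level : ∀ d s → k ≤ r * n → d + s ≡ n * R → Slice d ⇔ (s ∸ 1) ℕ./ t ≡ r * n ∸ k
      slice⇔level d s k≤rn d+s = mk⇔ to from
        where
        j = r * n ∸ k
        d+s≡ : d + s ≡ t * k + j * t
        d+s≡ = begin
          d + s ≡⟨ d+s ⟩
          n * (t * r) ≡⟨ rearrange n t r ⟩
          t * (r * n) ≡⟨ cong (t *_) (ℕ.m+[n∸m]≡n k≤rn) ⟨
          t * (k + j) ≡⟨ ℕ.*-distribˡ-+ t k j ⟩
          t * k + t * j ≡⟨ cong (t * k +_) (ℕ.*-comm t j) ⟩
          t * k + j * t ∎
          where
          open ≡-Reasoning
          rearrange : ∀ n t r → n * (t * r) ≡ t * (r * n)
          rearrange = ℕSolver.solve-∀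
        upper : t * k ≤ d + t → s ≤ j * t + t
        upper le = ℕ.+-cancelˡ-≤ d s (j * t + t) (begin
          d + s ≡⟨ d+s≡ ⟩
          t * k + j * t ≤⟨ ℕ.+-monoˡ-≤ (j * t) le ⟩
          d + t + j * t ≡⟨ trans (ℕ.+-assoc d t (j * t)) (cong (d +_) (ℕ.+-comm t (j * t))) ⟩
          d + (j * t + t) ∎)
          where open ℕ.≤-Reasoning
        upper⁻ : s ≤ j * t + t → t * k ≤ d + t
        upper⁻ le = ℕ.+-cancelʳ-≤ (j * t) (t * k) (d + t) (begin
          t * k + j * t ≡⟨ d+s≡ ⟨
          d + s ≤⟨ ℕ.+-monoʳ-≤ d le ⟩
          d + (j * t + t) ≡⟨ trans (cong (d +_) (ℕ.+-comm (j * t) t)) (sym (ℕ.+-assoc d t (j * t))) ⟩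
          d + t + j * t ∎)
          where open ℕ.≤-Reasoning
        lower-bound : d < t * k → j * t < s
        lower-bound lt = ℕ.+-cancelˡ-< d (j * t) s (ℕ.<-≤-trans (ℕ.+-monoˡ-< (j * t) lt) (ℕ.≤-reflexive (sym d+s≡)))
        lower-bound⁻ : j * t < s → d < t * k
        lower-bound⁻ lt = ℕ.+-cancelʳ-< (j * t) d (t * k) (ℕ.<-≤-trans (ℕ.+-monoʳ-< d lt) (ℕ.≤-reflexive d+s≡))
        between : ∀ s → j * t < s → s ≤ j * t + t → (s ∸ 1) ℕ./ t ≡ j
        between (suc s) (s≤s jt≤s) s<jt+t = ℕ.≤-antisym
          (ℕ.s≤s⁻¹ (ℕ.m<n*o⇒m/o<n {s} {suc j} {t} (ℕ.≤-trans s<jt+t (ℕ.≤-reflexive (ℕ.+-comm (j * t) t)))))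
          (ℕ.≤-trans (ℕ.≤-reflexive (sym (ℕ.m*n/n≡m j t))) (ℕ./-monoˡ-≤ t jt≤s))
        to : Slice d → (s ∸ 1) ℕ./ t ≡ j
        to (le , inj₁ (_ , lt))    = between s (lower-bound lt) (upper le)
        to (le , inj₂ (refl , _)) = trans (ℕ.m<n⇒m/n≡0 (pred-< (subst (λ i → s ≤ i * t + t) (ℕ.n∸n≡0 k) (upper le)))) (sym (ℕ.n∸n≡0 k))
          where
          pred-< : ∀ {s} → s ≤ t → s ∸ 1 < t
          pred-< {zero}  _   = s≤s z≤n
          pred-< {suc s} s<t = s<t
        from : (s ∸ 1) ℕ./ t ≡ j → Slice d
        from level = upper⁻ s≤ , side (ℕ.m≤n⇒m<n∨m≡n k≤rn)
          where
          split : s ∸ 1 ≡ (s ∸ 1) ℕ.% t + j * t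
          split = trans (ℕ.m≡m%n+[m/n]*n (s ∸ 1) t) (cong (λ i → (s ∸ 1) ℕ.% t + i * t) level)
          s≤ : s ≤ j * t + t
          s≤ = begin
            s ≤⟨ ℕ.m≤n+m∸n s 1 ⟩
            suc (s ∸ 1) ≡⟨ cong suc split ⟩
            suc ((s ∸ 1) ℕ.% t) + j * t ≤⟨ ℕ.+-monoˡ-≤ (j * t) (ℕ.m%n<n (s ∸ 1) t) ⟩
            t + j * t ≡⟨ ℕ.+-comm t (j * t) ⟩
            j * t + t ∎
            where open ℕ.≤-Reasoning
          jt≤ : j * t ≤ s ∸ 1
          jt≤ = ℕ.≤-trans (ℕ.m≤n+m (j * t) ((s ∸ 1) ℕ.% t)) (ℕ.≤-reflexive (sym split))
          side : k < r * n ⊎ k ≡ r * n → (k < r * n × d < t * k) ⊎ (k ≡ r * n × d ≤ t * k)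
          side (inj₁ k<rn) = inj₁ (k<rn , lower-bound⁻ (positive s 1≤s-1 jt≤))
            where
            -- As `k < r * n`, the level `j` is positive; this rules out `s = 0`, where `s ∸ 1` is
            -- not a predecessor.
            1≤s-1 : 1 ≤ s ∸ 1
            1≤s-1 = ℕ.≤-trans (ℕ.*-mono-≤ {1} {j} {1} {t} (ℕ.m<n⇒0<n∸m k<rn) (s≤s z≤n)) jt≤
            positive : ∀ s {i} → 1 ≤ s ∸ 1 → i ≤ s ∸ 1 → i < s
            positive (suc s) _ le = s≤s le
          side (inj₂ refl) = inj₂ (refl , (begin
            d ≤⟨ ℕ.m≤m+n d s ⟩
            d + s ≡⟨ d+s≡ ⟩
            t * k + (r * n ∸ r * n) * t ≡⟨ cong (λ i → t * k + i * t) (ℕ.n∸n≡0 (r * n)) ⟩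
            t * k + 0 ≡⟨ ℕ.+-identityʳ (t * k) ⟩
            t * k ∎))
            where open ℕ.≤-Reasoning

      module _ {x : Vec ℚ n} {d : ℕ} (eq : fromℕ t ℚ.* coordinateSum x ≡ fromℤ (pos d)) where

        private S = coordinateSum x

        scale-S+1 : fromℕ t ℚ.* (S ℚ.+ 1ℚ) ≡ fromℤ (pos (d + t))
        scale-S+1 = trans (ℚ.*-distribˡ-+ (fromℕ t) S 1ℚ) (trans (cong₂ ℚ._+_ eq (ℚ.*-identityʳ (fromℕ t))) (sym (fromℕ-+ d t)))

        k-1≤S⇒ : fromℕ k ℚ.- 1ℚ ℚ.≤ S → fromℕ k ℚ.≤ S ℚ.+ 1ℚ
        k-1≤S⇒ le = subst (ℚ._≤ S ℚ.+ 1ℚ) (cancel (fromℕ k)) (ℚ.+-monoˡ-≤ 1ℚ le)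
          where
          open ℚSolver.+-*-Solver
          cancel : ∀ p → p ℚ.- 1ℚ ℚ.+ 1ℚ ≡ p
          cancel = solve 1 (λ p → p :- con 1ℚ :+ con 1ℚ := p) refl

        k-1≤S⇐ : fromℕ k ℚ.≤ S ℚ.+ 1ℚ → fromℕ k ℚ.- 1ℚ ℚ.≤ S
        k-1≤S⇐ le = subst (fromℕ k ℚ.- 1ℚ ℚ.≤_) (cancel S) (ℚ.+-monoˡ-≤ (ℚ.- 1ℚ) le)
          where
          open ℚSolver.+-*-Solver
          cancel : ∀ p → p ℚ.+ 1ℚ ℚ.- 1ℚ ≡ p
          cancel = solve 1 (λ p → p :+ con 1ℚ :- con 1ℚ := p) refl

        hypersimplex⇒slice : multiHypersimplex r n k x → Slice d
        hypersimplex⇒slice (_ , low , high) = ℤ.drop‿+≤+ (scale-≤ (pos (t * k)) (pos (d + t)) (scale-fromℕ k) scale-S+1 (k-1≤S⇒ low)) , side high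
          where
          side : (k < r * n × S ℚ.< fromℕ k) ⊎ (k ≡ r * n × S ℚ.≤ fromℕ k) → (k < r * n × d < t * k) ⊎ (k ≡ r * n × d ≤ t * k)
          side (inj₁ (k< , S<k)) = inj₁ (k< , ℕ.≰⇒> (λ tk≤d →
            ℚ.<-irrefl refl (ℚ.<-≤-trans S<k (unscale-≤ (pos (t * k)) (pos d) (scale-fromℕ k) eq (ℤ.+≤+ tk≤d)))))
          side (inj₂ (k≡ , S≤k)) = inj₂ (k≡ , ℤ.drop‿+≤+ (scale-≤ (pos d) (pos (t * k)) eq (scale-fromℕ k) S≤k))

        slice⇒hypersimplex : InBox x → Slice d → multiHypersimplex r n k x
        slice⇒hypersimplex box (low , high) = box , k-1≤S⇐ (unscale-≤ (pos (t * k)) (pos (d + t)) (scale-fromℕ k) scale-S+1 (ℤ.+≤+ low)) , side high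
          where
          side : (k < r * n × d < t * k) ⊎ (k ≡ r * n × d ≤ t * k) → (k < r * n × S ℚ.< fromℕ k) ⊎ (k ≡ r * n × S ℚ.≤ fromℕ k)
          side (inj₁ (k< , d<tk)) = inj₁ (k< , ℚ.≰⇒> (λ k≤S → ℕ.<⇒≱ d<tk (ℤ.drop‿+≤+ (scale-≤ (pos (t * k)) (pos d) (scale-fromℕ k) eq k≤S))))
          side (inj₂ (k≡ , d≤tk)) = inj₂ (k≡ , unscale-≤ (pos d) (pos (t * k)) eq (scale-fromℕ k) (ℤ.+≤+ d≤tk))

      levelWords : List (Vec (Fin (suc R)) n)
      levelWords = List.filter (λ u → wordLevel t u ℕ.≟ r * n ∸ k) (words (suc R) n)

      latticePoints : k ≤ r * n → ∀ z → z ∈ map lattice levelWords ⇔ (LatticePointOf t · multiHypersimplex r n k) z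
      latticePoints k≤rn z = mk⇔ to from
        where
        scale-sum : ∀ x u → Vec.map (fromℕ t ℚ.*_) x ≡ Vec.map fromℤ (lattice u) →
                    fromℕ t ℚ.* coordinateSum x ≡ fromℤ (pos (cototal u))
        scale-sum x u eq = trans (scale-coordinateSum x (lattice u) eq) (cong fromℤ (integerSum-lattice u))
        level : ∀ u → Slice (cototal u) ⇔ wordLevel t u ≡ r * n ∸ k
        level u = slice⇔level (cototal u) (total (Vec.toList u)) k≤rn (cototal+total u)
        to : z ∈ map lattice levelWords → (LatticePointOf t · multiHypersimplex r n k) z
        to z∈ with ∈.∈-map⁻ lattice z∈
        ... | u , u∈ , refl = point u ,
              slice⇒hypersimplex (scale-sum (point u) u (point-lattice u)) (point-inBox u)
                (Equivalence.from (level u) (proj₂ (∈.∈-filter⁻ (λ u → wordLevel t u ℕ.≟ r * n ∸ k) {xs = words (suc R) n} u∈))) ,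
              point-lattice u
        from : (LatticePointOf t · multiHypersimplex r n k) z → z ∈ map lattice levelWords
        from (x , hyper , eq) with inBox⇒lattice x z (proj₁ hyper) eq
        ... | u , refl = ∈.∈-map⁺ lattice (∈.∈-filter⁺ (λ u → wordLevel t u ℕ.≟ r * n ∸ k) (words-complete u)
              (Equivalence.to (level u) (hypersimplex⇒slice (scale-sum x u eq) hyper)))

      -- Two duplicate-free lists with the same members are permutations of each other, so the given
      -- enumeration has the length of the explicit one.
      cardinality : k ≤ r * n → ∀ {m} → HasCardinality (LatticePointOf t · multiHypersimplex r n k) m → m ≡ length levelWords
      cardinality k≤rn (zs , unique , member , refl) = trans
        (↭-length (∼bag⇒↭ (unique∧set⇒bag unique
          (Unique.map⁺ lattice-injective (Unique.filter⁺ (λ u → wordLevel t u ℕ.≟ r * n ∸ k) (words-unique (suc R) n)))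
          (λ {z} → mk⇔ (Equivalence.from (latticePoints k≤rn z) ∘ Equivalence.to (member z))
                        (Equivalence.from (member z) ∘ Equivalence.to (latticePoints k≤rn z))))))
        (List.length-map lattice levelWords)

-- Descents

DescentAt : ∀ {r m n} → Vec (Fin m) (suc n) → Vec (Fin r) (suc n) → Fin n → Set
DescentAt σ c i = toℕ (lookup c (Fin.inject₁ i)) < toℕ (lookup c (suc i)) ⊎
  (lookup c (Fin.inject₁ i) ≡ lookup c (suc i) × toℕ (lookup σ (suc i)) < toℕ (lookup σ (Fin.inject₁ i)))

descentAt? : ∀ {r m n} (σ : Vec (Fin m) (suc n)) (c : Vec (Fin r) (suc n)) i → Dec (DescentAt σ c i)
descentAt? σ c i = (lookup c (Fin.inject₁ i) Fin.<? lookup c (suc i)) ⊎-dec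
  ((lookup c (Fin.inject₁ i) Fin.≟ lookup c (suc i)) ×-dec (lookup σ (suc i) Fin.<? lookup σ (Fin.inject₁ i)))

-- At equal colours one side asks for `¬ s < s′` and the other for `s′ < s`; these agree because the
-- letters of a permutation are distinct.
descentCount-∑ : ∀ {r m n} s (σ : Vec (Fin m) n) c (cs : Vec (Fin r) n) → VecAllPairs.AllPairs _≢_ (s ∷ σ) →
  descentCount (toℕ c) (suc (toℕ s)) σ cs ≡ ∑ⁿ (λ i → ind (descentAt? (s ∷ σ) (c ∷ cs) i))
descentCount-∑ s []       c []        _                                            = refl
descentCount-∑ s (s′ ∷ σ) c (c′ ∷ cs) ((s≢s′ VecAll.∷ _) VecAllPairs.∷ unique) = cong₂ _+_
  (ind-cong (descent? (toℕ c) (suc (toℕ s)) (toℕ c′) (suc (toℕ s′))) (descentAt? (s ∷ s′ ∷ σ) (c ∷ c′ ∷ cs) zero) to from)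
  (descentCount-∑ s′ σ c′ cs unique)
  where
  to : Descent (toℕ c) (suc (toℕ s)) (toℕ c′) (suc (toℕ s′)) → DescentAt (s ∷ s′ ∷ σ) (c ∷ c′ ∷ cs) zero
  to (inj₁ c<c′)        = inj₁ c<c′
  to (inj₂ (c≡c′ , s≮s′)) = inj₂ (Fin.toℕ-injective c≡c′ ,
    ℕ.≤∧≢⇒< (ℕ.≮⇒≥ (s≮s′ ∘ s≤s)) (s≢s′ ∘ sym ∘ Fin.toℕ-injective))
  from : DescentAt (s ∷ s′ ∷ σ) (c ∷ c′ ∷ cs) zero → Descent (toℕ c) (suc (toℕ s)) (toℕ c′) (suc (toℕ s′))
  from (inj₁ c<c′)          = inj₁ c<c′
  from (inj₂ (c≡c′ , s′<s)) = inj₂ (cong toℕ c≡c′ , λ s<s′ → ℕ.<-asym s′<s (ℕ.s≤s⁻¹ s<s′))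

-- The colour is less than `r`, so rounding up adds one just when it is positive.
⌈⌉-colour : ∀ r d (c : Fin r) .{{_ : NonZero r}} → ⌈ r * d + toℕ c / r ⌉ ≡ ind (0 ℕ.<? toℕ c) + d
⌈⌉-colour r@(suc r′) d zero    = trans (ℕ./-congˡ {o = r} (rearrange r d r′))
  (trans (ℕ.+-distrib-/-∣ʳ r′ (ℕ.divides d refl)) (cong₂ _+_ (ℕ.m<n⇒m/n≡0 (ℕ.n<1+n r′)) (ℕ.m*n/n≡m d r)))
  where
  rearrange : ∀ r d r′ → r * d + 0 + r′ ≡ r′ + d * r
  rearrange = ℕSolver.solve-∀
⌈⌉-colour r@(suc r′) d (suc c) = trans (ℕ./-congˡ {o = r} (rearrange r′ d (toℕ c)))
  (trans (ℕ.+-distrib-/-∣ʳ (toℕ c) (ℕ.divides (suc d) refl))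
    (cong₂ _+_ (ℕ.m<n⇒m/n≡0 (ℕ.m≤n⇒m≤1+n (Fin.toℕ<n c))) (ℕ.m*n/n≡m (suc d) r)))
  where
  rearrange : ∀ r′ d c → suc r′ * d + suc c + r′ ≡ c + suc d * suc r′
  rearrange = ℕSolver.solve-∀

descentCount-fdes* : ∀ {r n} .{{_ : NonZero r}} .{{_ : NonZero n}} (σ : Vec (Fin n) n) (c : Vec (Fin r) n) →
  IsPermutation σ → descentCount 0 0 σ c ≡ ⌈ fdes* (σ , c) / r ⌉
descentCount-fdes* {r} {suc n} (s ∷ σ) (c ∷ cs) unique = begin
  ind (descent? 0 0 (toℕ c) (suc (toℕ s))) + descentCount (toℕ c) (suc (toℕ s)) σ cs
    ≡⟨ cong₂ _+_ (first c) (trans (descentCount-∑ s σ c cs unique) (sym (count-tabulate (isDescent*? (s ∷ σ) (c ∷ cs)) id))) ⟩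
  ind (0 ℕ.<? toℕ c) + des* (s ∷ σ , c ∷ cs)
    ≡⟨ ⌈⌉-colour r (des* (s ∷ σ , c ∷ cs)) c ⟨
  ⌈ fdes* (s ∷ σ , c ∷ cs) / r ⌉ ∎
  where
  open ≡-Reasoning
  -- From the start (0, 0) a tie in the colour is never a descent, since the shifted letter is
  -- positive. Hence the initial term is the contribution of the first colour to the ceiling.
  first : ∀ {r} (c : Fin r) → ind (descent? 0 0 (toℕ c) (suc (toℕ s))) ≡ ind (0 ℕ.<? toℕ c)
  first zero    = refl
  first (suc c) = refl

sumSeries-cong : ∀ {X : Set} (f g : X → ℕ) xs → (∀ x → x ∈ xs → f x ≡ g x) →
                 sumSeries (map (λ x → z^ f x) xs) ≗ sumSeries (map (λ x → z^ g x) xs)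
sumSeries-cong f g []       eq m = refl
sumSeries-cong f g (x ∷ xs) eq m = cong₂ ℚ._+_ (cong (λ k → (z^ k) m) (eq x (here refl)))
  (sumSeries-cong f g xs (λ z z∈ → eq z (there z∈)) m)

ehrhart-fexc : ∀ r n k .{{_ : NonZero r}} → k ≤ r * n → ∀ E → IsEhrhartPolynomial (multiHypersimplex r n k) E →
  ∀ t → 0 < t → eval E (fromℕ t) ≡
  fromℕ (∑ˡⁿ (chains t) (coloredPermutationsWithFexc r n (r * n ∸ k)))
ehrhart-fexc r n k k≤rn E ehrhart t@(suc t′) 0<t = trans (proj₂ (proj₂ (ehrhart t 0<t)))
  (cong fromℕ (trans (cardinality t′ r n k k≤rn (proj₁ (proj₂ (ehrhart t 0<t)))) (sym (fexc-level r t n (r * n ∸ k)))))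

∈-withFexc⇒permutation : ∀ r n j {w} → w ∈ coloredPermutationsWithFexc r n j → IsPermutation (proj₁ w)
∈-withFexc⇒permutation r n j w∈ = proj₂ (∈.∈-filter⁻ isPermutation? {xs = words n n}
  (proj₁ (∈.∈-cartesianProduct⁻ (permutations n) (words r n)
    (proj₁ (∈.∈-filter⁻ (λ w → fexc w ℕ.≟ j) {xs = coloredPermutations r n} w∈)))))

theorem4p5 : (r n k : ℕ) .{{_ : NonZero r}} .{{_ : NonZero n}} →
    1 ≤ k → k ≤ r * n →
    (E : Polynomial) → IsEhrhartPolynomial (multiHypersimplex r n k) E →
    E* n E ≗ sumSeries (map (λ w → z^ ⌈ fdes* w / r ⌉) (coloredPermutationsWithFexc r n (r * n ∸ k)))
theorem4p5 r n k 1≤k k≤rn E ehrhart m = trans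
  (E*-sum n (λ w t → chains t w) (λ w → descentCount 0 0 (proj₁ w) (proj₂ w))
    (λ w → ∇^-ways 0 0 (proj₁ w) (proj₂ w)) (λ w → Δ^-ways 0 0 (proj₁ w) (proj₂ w)) E
    (coloredPermutationsWithFexc r n (r * n ∸ k)) (ehrhart-fexc r n k k≤rn E ehrhart) m)
  (sumSeries-cong (λ w → descentCount 0 0 (proj₁ w) (proj₂ w)) (λ w → ⌈ fdes* w / r ⌉)
    (coloredPermutationsWithFexc r n (r * n ∸ k))
    (λ { (σ , c) w∈ → descentCount-fdes* σ c (∈-withFexc⇒permutation r n (r * n ∸ k) w∈) }) m)
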